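{- Let $k\ge3$, $c_1,\dots,c_k\in\mathbb{Z}\setminus\{0\}$, and let $\mathcal{L}$ be the equation $\sum_{i=1}^kc_ix_i=0$. Assume there is no $I\subseteq[k]$ with $|I|\ge3$ and $\sum_{i\in I}c_i=0$. Then there exists $\varepsilon>0$ such that for every integer $t$ and every sufficiently large prime $p$ (depending on $t$ and $\mathcal{L}$), there is an $\mathcal{L}$-solution-free set $A\subseteq\mathbb{F}_p$ with $|A|\ge\varepsilon p$ and $\chi(\mathsf{Cay}(\mathbb{F}_p,A))\ge t$.
   Context: Coefficients are reduced modulo $p$. A set $A\subseteq\mathbb{F}_p$ is $\mathcal{L}$-solution-free if there is no $(x_1,\dots,x_k)\in A^k$ with pairwise distinct entries and $\sum_i c_ix_i=0$ in $\mathbb{F}_p$. $\mathsf{Cay}(\mathbb{F}_p,A)$ is the Cayley digraph with an arc from $u$ to $v$ whenever $v-u\in A$; $\chi$ is the chromatic number of its underlying undirected graph (distinct $u,v$ adjacent iff $v-u\in A$ or $u-v\in A$). -}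

module Defs where

open import Data.Nat using (ℕ; zero; suc; _≤_; _<_; _*_)
open import Data.Integer as ℤ using (ℤ; +_; _-_)
open import Data.Integer.Divisibility using (_∣_)
open import Data.Fin using (Fin; toℕ)
import Data.Fin as F
open import Data.Fin.Subset using (Subset; _∈_; ∣_∣)
open import Data.Bool using (if_then_else_)
open import Data.Vec using (lookup)
open import Data.Product using (Σ; ∃; _×_)
open import Data.Sum using (_⊎_)
open import Relation.Nullary using (¬_)
open import Relation.Binary.PropositionalEquality using (_≡_; _≢_)
open import Function.Definitions using (Injective)

∑ : ∀ {k} → (Fin k → ℤ) → ℤ
∑ {zero} f = + 0
∑ {suc k} f = f F.zero ℤ.+ ∑ (λ i → f (F.suc i))

∑over : ∀ {k} → Subset k → (Fin k → ℤ) → ℤ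
∑over I c = ∑ (λ i → if lookup I i then c i else + 0)

-- Elements of F_p are represented by Fin p (residues 0..p-1).
toℤ : ∀ {p} → Fin p → ℤ
toℤ x = + toℕ x

SolutionFree : ∀ {k} (c : Fin k → ℤ) (p : ℕ) → Subset p → Set
SolutionFree {k} c p A =
  ¬ (Σ (Fin k → Fin p) λ x →
       Injective _≡_ _≡_ x × (∀ i → x i ∈ A) × ((+ p) ∣ ∑ (λ i → c i ℤ.* toℤ (x i))))

-- Adjacency in the underlying undirected graph of Cay(F_p, A).
Adj : ∀ {p} → Subset p → Fin p → Fin p → Set
Adj {p} A u v = u ≢ v × ∃ λ a → a ∈ A ×
  (((+ p) ∣ ((toℤ v - toℤ u) - toℤ a)) ⊎ ((+ p) ∣ ((toℤ u - toℤ v) - toℤ a)))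

ProperColouring : ∀ {p} → Subset p → ℕ → Set
ProperColouring {p} A m =
  Σ (Fin p → Fin m) λ col → ∀ u v → Adj A u v → col u ≢ col v

ChromaticAtLeast : ∀ {p} → Subset p → ℕ → Set
ChromaticAtLeast A t = ∀ m → m < t → ¬ ProperColouring A m

{-# OPTIONS --safe #-}
module Submission where

-- Fix a large prime q. In ℤ_q^n call y an m-rotation of x if y_i = x_i + 1 for all but m indices i. For m large in
-- terms of q and M, every M-colouring of ℤ_q^n has a monochromatic m-rotation, whatever n is. Indeed, otherwise
-- recording which colours occur on which of the q rotates of a face of the cube gives a ℤ_q-equivariant label on
-- faces with few free coordinates; along a flag of faces this label changes at most qM times, so high cup powers of
-- its Bockstein vanish on flags. But contracting the cube coordinate by coordinate yields chains on which every
-- such power has value 1 modulo q.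
--
-- Encode a word x as the integer value x = W ∑ x_i Q^i with Q = qW, and let A consist of all D (value y - value x)
-- with y an m-rotation of x, together with those a in an interval [4Kw, 4Kw + w) whose base-Q digits avoid the ends
-- of the q intervals of length W and lie in interval number 0 more often, by a margin, than in any other. Here
-- K = ∑ |c_i| and D = ∏ |c_i|. The first part makes the chromatic number large. In a solution within A the indices
-- whose entry lies in the second part have coefficient sum 0, so there are at most two of them, and if there are two,
-- a and a′, then a′ - a = η ∑ c_i s_i with D s_i in the first part and c_i η = D. This difference moves nearly all
-- digits by η ∑ c_i ≢ 0 (mod q) intervals, which is impossible if interval 0 leads by a margin both in a and in a′.
-- The second part has density bounded below independently of m: some letter leads in every word, and raising the
-- margin by one, by turning a letter into 0, loses only O(n^(-1/2)) of all words by a second moment estimate.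

-- The margin must exceed the `k * m` digits that `k` small entries may leave unrotated, and `m`
-- grows with `t`. Taking `n` of the order of the squared margin keeps the loss of leading words at
-- a constant share, and intervals of length proportional to `n` keep all digits safe with
-- probability at least 1/2; so neither cost depends on `t`.
--
-- Binary words would not do: a solution moves digits by a multiple of `∑ c` intervals, and that sum
-- may be even. A prime `q` above `D * |∑ c|` keeps the move nonzero. Primality also serves the
-- topology: a colour on some but not all of the `q` rotates of a face occurs on a number of them
-- coprime to `q`, so its mean position modulo `q` makes sense and moves by one under rotation.
--
-- The factor `D` makes the division by `c_i` exact when two large entries with opposite
-- coefficients are compared. If no entry is large, then `∑ c_i s_i = 0`, and a single number led by
-- interval 0 is compared with itself.

open import Data.Product using (∃; _,_; _×_; proj₁; proj₂; Σ)
open import Data.Sum using (_⊎_; inj₁; inj₂; [_,_]′)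
open import Data.Empty using (⊥-elim; ⊥)
open import Function using (_∘_)
open import Relation.Nullary using (¬_; Dec; yes; no; contradiction; does)
open import Relation.Nullary.Decidable using (_×-dec_; dec-true; _⊎-dec_; decidable-stable)
open import Relation.Binary.PropositionalEquality using (_≡_; refl; sym; trans; cong; cong₂; module ≡-Reasoning; subst; _≢_)
open import Data.Fin using (Fin; toℕ)
open import Data.Fin.Properties using (toℕ-fromℕ<; toℕ-injective; toℕ<n; any?; all?)
open import Data.Vec using (Vec; []; _∷_; replicate; lookup; _[_]≔_; tabulate)
open import Data.Bool using (true; false; Bool; if_then_else_)
open import Data.Vec.Properties using (lookup⇒[]=; []=⇒lookup; lookup∘tabulate; lookup-replicate)
import Data.Fin as F

-- Augmented cochains on lists of points, and the prism homotopy between two maps.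

module Cochain-Calculus where

  open import Data.Nat using (ℕ; zero; suc)
  open import Data.Integer using (ℤ; +_; _+_; _-_; _*_; -_; 0ℤ; 1ℤ)
  open import Data.Integer.Properties using (+-identityˡ; *-zeroʳ; +-inverseʳ)
  open import Data.Integer.Tactic.RingSolver using (solve-∀)
  open import Data.List using (List; []; _∷_; map)

  iter : {X : Set} → (X → X) → ℕ → X → X
  iter A zero x = x
  iter A (suc i) x = iter A i (A x)

  iter-comm : {X : Set} (A : X → X) (i : ℕ) (x : X) → iter A i (A x) ≡ A (iter A i x)
  iter-comm A zero x = refl
  iter-comm A (suc i) x = iter-comm A i (A x)

  dbl : ℕ → ℕ
  dbl zero = zero
  dbl (suc d) = suc (suc (dbl d))

  Σ< : ℕ → (ℕ → ℤ) → ℤ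
  Σ< zero h = 0ℤ
  Σ< (suc k) h = Σ< k h + h k

  Σ<-cong : ∀ k {g h : ℕ → ℤ} → (∀ i → g i ≡ h i) → Σ< k g ≡ Σ< k h
  Σ<-cong zero e = refl
  Σ<-cong (suc k) e = cong₂ _+_ (Σ<-cong k e) (e k)

  Σ<-+ : ∀ k (g h : ℕ → ℤ) → Σ< k (λ i → g i + h i) ≡ Σ< k g + Σ< k h
  Σ<-+ zero g h = refl
  Σ<-+ (suc k) g h = trans (cong (_+ (g k + h k)) (Σ<-+ k g h)) (lemma (Σ< k g) (Σ< k h) (g k) (h k))
    where
    lemma : ∀ a b x y → (a + b) + (x + y) ≡ (a + x) + (b + y)
    lemma = solve-∀

  Σ<-*ˡ : ∀ k a (h : ℕ → ℤ) → Σ< k (λ i → a * h i) ≡ a * Σ< k h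
  Σ<-*ˡ zero a h = sym (*-zeroʳ a)
  Σ<-*ˡ (suc k) a h = trans (cong (_+ a * h k) (Σ<-*ˡ k a h)) (lemma a (Σ< k h) (h k))
    where
    lemma : ∀ a x y → a * x + a * y ≡ a * (x + y)
    lemma = solve-∀

  Σ<-*ʳ : ∀ k a (h : ℕ → ℤ) → Σ< k (λ i → h i * a) ≡ Σ< k h * a
  Σ<-*ʳ zero a h = refl
  Σ<-*ʳ (suc k) a h = trans (cong (_+ h k * a) (Σ<-*ʳ k a h)) (lemma a (Σ< k h) (h k))
    where
    lemma : ∀ a x y → x * a + y * a ≡ (x + y) * a
    lemma = solve-∀

  Σ<-const : ∀ k a → Σ< k (λ _ → a) ≡ + k * a
  Σ<-const zero a = refl
  Σ<-const (suc k) a = trans (cong (_+ a) (Σ<-const k a)) (lemma (+ k) a)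
    where
    lemma : ∀ k a → k * a + a ≡ (1ℤ + k) * a
    lemma = solve-∀

  Σ<-telescope : ∀ k (h : ℕ → ℤ) → Σ< k (λ i → h (suc i) - h i) ≡ h k - h 0
  Σ<-telescope zero h = sym (+-inverseʳ (h 0))
  Σ<-telescope (suc k) h = trans (cong (_+ (h (suc k) - h k)) (Σ<-telescope k h)) (lemma (h k) (h 0) (h (suc k)))
    where
    lemma : ∀ a b c → (a - b) + (c - a) ≡ c - b
    lemma = solve-∀

  Σ<-cycle : ∀ k (h : ℕ → ℤ) → h k ≡ h 0 → Σ< k (h ∘ suc) ≡ Σ< k h
  Σ<-cycle k h e = begin
    Σ< k (h ∘ suc) ≡⟨ Σ<-cong k (λ i → lemma (h (suc i)) (h i)) ⟩
    Σ< k (λ i → (h (suc i) - h i) + h i) ≡⟨ Σ<-+ k _ _ ⟩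
    Σ< k (λ i → h (suc i) - h i) + Σ< k h ≡⟨ cong (_+ Σ< k h) (Σ<-telescope k h) ⟩
    (h k - h 0) + Σ< k h ≡⟨ cong (λ z → (z - h 0) + Σ< k h) e ⟩
    (h 0 - h 0) + Σ< k h ≡⟨ cong (_+ Σ< k h) (+-inverseʳ (h 0)) ⟩
    0ℤ + Σ< k h ≡⟨ +-identityˡ _ ⟩
    Σ< k h                                      ∎
    where
    open ≡-Reasoning
    lemma : ∀ a b → a ≡ (a - b) + b
    lemma = solve-∀

  module Cochains {P : Set} where

    Cochain : Set
    Cochain = List P → ℤ

    -- Lists of length `j + 1` serve as `j`-simplices and the empty list as the augmentation, so one
    -- untyped function carries cochains of every degree. The recursion unfolds to the alternating
    -- sum over deleted entries.
    δ : Cochain → Cochain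
    δ f [] = 0ℤ
    δ f (x ∷ l) = f l - δ (λ l′ → f (x ∷ l′)) l

    δ-cong : ∀ {f g} → (∀ l → f l ≡ g l) → ∀ l → δ f l ≡ δ g l
    δ-cong e [] = refl
    δ-cong e (x ∷ l) = cong₂ _-_ (e l) (δ-cong (λ l′ → e (x ∷ l′)) l)

    δ-+ : ∀ f g l → δ (λ l′ → f l′ + g l′) l ≡ δ f l + δ g l
    δ-+ f g [] = refl
    δ-+ f g (x ∷ l) = trans (cong (_-_ (f l + g l)) (δ-+ _ _ l)) (lemma (f l) (g l) _ _)
      where
      lemma : ∀ a b c d → (a + b) - (c + d) ≡ (a - c) + (b - d)
      lemma = solve-∀

    δ-*ˡ : ∀ a f l → δ (λ l′ → a * f l′) l ≡ a * δ f l
    δ-*ˡ a f [] = sym (*-zeroʳ a)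
    δ-*ˡ a f (x ∷ l) = trans (cong (_-_ (a * f l)) (δ-*ˡ a _ l)) (lemma a (f l) _)
      where
      lemma : ∀ a b c → a * b - a * c ≡ a * (b - c)
      lemma = solve-∀

    δ-- : ∀ f g l → δ (λ l′ → f l′ - g l′) l ≡ δ f l - δ g l
    δ-- f g [] = refl
    δ-- f g (x ∷ l) = trans (cong (_-_ (f l - g l)) (δ-- _ _ l)) (lemma (f l) (g l) _ _)
      where
      lemma : ∀ a b c d → (a - b) - (c - d) ≡ (a - c) - (b - d)
      lemma = solve-∀

    δ-map : ∀ (v : P → P) f l → δ (f ∘ map v) l ≡ δ f (map v l)
    δ-map v f [] = refl
    δ-map v f (x ∷ l) = cong (_-_ (f (map v l))) (δ-map v (λ l′ → f (v x ∷ l′)) l)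

    δδ≡0 : ∀ f l → δ (δ f) l ≡ 0ℤ
    δδ≡0 f [] = refl
    δδ≡0 f (x ∷ l) = begin
      δ f l - δ (λ l′ → f l′ - δ (λ m → f (x ∷ m)) l′) l ≡⟨ cong (_-_ (δ f l)) (δ-- f _ l) ⟩
      δ f l - (δ f l - δ (δ (λ m → f (x ∷ m))) l) ≡⟨ cong (λ z → δ f l - (δ f l - z)) (δδ≡0 _ l) ⟩
      δ f l - (δ f l - 0ℤ) ≡⟨ lemma (δ f l) ⟩
      0ℤ                                                     ∎
      where
      open ≡-Reasoning
      lemma : ∀ a → a - (a - 0ℤ) ≡ 0ℤ
      lemma = solve-∀

    -- The alternating sum of `f` over the simplices `u x₀ … u xᵢ, v xᵢ … v xₙ` that triangulate the
    -- prism over the list, as in the homotopy invariance of singular homology.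
    prism : (u v : P → P) → Cochain → Cochain
    prism u v f [] = 0ℤ
    prism u v f (x ∷ l) = f (u x ∷ v x ∷ map v l) - prism u v (λ l′ → f (u x ∷ l′)) l

    data PrismFace (u v : P → P) : List P → List P → Set where
      here  : ∀ {x l} → PrismFace u v (x ∷ l) (u x ∷ v x ∷ map v l)
      there : ∀ {x l l′} → PrismFace u v l l′ → PrismFace u v (x ∷ l) (u x ∷ l′)

    prism-cong : ∀ u v {f g} l → (∀ l′ → PrismFace u v l l′ → f l′ ≡ g l′) → prism u v f l ≡ prism u v g l
    prism-cong u v [] e = refl
    prism-cong u v (x ∷ l) e = cong₂ _-_ (e _ here) (prism-cong u v l (λ l′ m → e _ (there m)))

    prism-+ : ∀ u v f g l → prism u v (λ l′ → f l′ + g l′) l ≡ prism u v f l + prism u v g l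
    prism-+ u v f g [] = refl
    prism-+ u v f g (x ∷ l) = trans
      (cong (_-_ ((f (u x ∷ v x ∷ map v l)) + (g (u x ∷ v x ∷ map v l)))) (prism-+ u v (λ l′ → f (u x ∷ l′)) (λ l′ → g (u x ∷ l′)) l))
      (lemma (f (u x ∷ v x ∷ map v l)) (g (u x ∷ v x ∷ map v l)) (prism u v (λ l′ → f (u x ∷ l′)) l) (prism u v (λ l′ → g (u x ∷ l′)) l))
      where
      lemma : ∀ a b c d → (a + b) - (c + d) ≡ (a - c) + (b - d)
      lemma = solve-∀

    prism-*ˡ : ∀ u v a f l → prism u v (λ l′ → a * f l′) l ≡ a * prism u v f l
    prism-*ˡ u v a f [] = sym (*-zeroʳ a)
    prism-*ˡ u v a f (x ∷ l) = trans
      (cong (_-_ (a * (f (u x ∷ v x ∷ map v l)))) (prism-*ˡ u v a (λ l′ → f (u x ∷ l′)) l))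
      (lemma a (f (u x ∷ v x ∷ map v l)) (prism u v (λ l′ → f (u x ∷ l′)) l))
      where
      lemma : ∀ a b c → a * b - a * c ≡ a * (b - c)
      lemma = solve-∀

    prism-- : ∀ u v f g l → prism u v (λ l′ → f l′ - g l′) l ≡ prism u v f l - prism u v g l
    prism-- u v f g [] = refl
    prism-- u v f g (x ∷ l) = trans
      (cong (_-_ ((f (u x ∷ v x ∷ map v l)) - (g (u x ∷ v x ∷ map v l)))) (prism-- u v (λ l′ → f (u x ∷ l′)) (λ l′ → g (u x ∷ l′)) l))
      (lemma (f (u x ∷ v x ∷ map v l)) (g (u x ∷ v x ∷ map v l)) (prism u v (λ l′ → f (u x ∷ l′)) l) (prism u v (λ l′ → g (u x ∷ l′)) l))
      where
      lemma : ∀ a b c d → (a - b) - (c - d) ≡ (a - c) - (b - d)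
      lemma = solve-∀

    -- Faces shared by neighbouring prism simplices cancel, which leaves the `v` end, the `u` end
    -- and the prism over the boundary.
    prism-δ : ∀ u v f l → prism u v (δ f) l ≡ (f (map v l) - f (map u l)) - δ (prism u v f) l
    prism-δ u v f [] = lemma (f [])
      where
      lemma : ∀ a → 0ℤ ≡ (a - a) - 0ℤ
      lemma = solve-∀
    prism-δ u v f (x ∷ l) = begin
      (f (v x ∷ map v l) - (f (u x ∷ map v l) - δ fuv (map v l)))
        - prism u v (λ l′ → f l′ - δ fu l′) l
        ≡⟨ cong (_-_ (f (v x ∷ map v l) - (f (u x ∷ map v l) - δ fuv (map v l)))) (prism-- u v f (δ fu) l) ⟩
      (f (v x ∷ map v l) - (f (u x ∷ map v l) - δ fuv (map v l)))
        - (prism u v f l - prism u v (δ fu) l)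
        ≡⟨ cong (λ z → (f (v x ∷ map v l) - (f (u x ∷ map v l) - δ fuv (map v l))) - (prism u v f l - z)) (prism-δ u v fu l) ⟩
      (f (v x ∷ map v l) - (f (u x ∷ map v l) - δ fuv (map v l)))
        - (prism u v f l - ((f (u x ∷ map v l) - f (u x ∷ map u l)) - δ (prism u v fu) l))
        ≡⟨ lemma (f (v x ∷ map v l)) (f (u x ∷ map v l)) (f (u x ∷ map u l)) (δ fuv (map v l)) (prism u v f l) (δ (prism u v fu) l) ⟩
      (f (v x ∷ map v l) - f (u x ∷ map u l)) - (prism u v f l - (δ fuv (map v l) - δ (prism u v fu) l))
        ≡⟨ cong (λ z → (f (v x ∷ map v l) - f (u x ∷ map u l)) - (prism u v f l - (z - δ (prism u v fu) l))) (sym (δ-map v fuv l)) ⟩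
      (f (v x ∷ map v l) - f (u x ∷ map u l)) - (prism u v f l - (δ (fuv ∘ map v) l - δ (prism u v fu) l))
        ≡⟨ cong (λ z → (f (v x ∷ map v l) - f (u x ∷ map u l)) - (prism u v f l - z)) (sym (δ-- (fuv ∘ map v) (prism u v fu) l)) ⟩
      (f (v x ∷ map v l) - f (u x ∷ map u l)) - δ (prism u v f) (x ∷ l) ∎
      where
      open ≡-Reasoning
      fu fuv : Cochain
      fu l′ = f (u x ∷ l′)
      fuv l′ = f (u x ∷ v x ∷ l′)
      lemma : ∀ a b c d e g → (a - (b - d)) - (e - ((b - c) - g)) ≡ (a - c) - (e - (d - g))
      lemma = solve-∀

-- Equivariant chains as linear functionals, and their values on cup powers.

module Equivariant-Functionals where

  open import Data.Nat using (ℕ; zero; suc; _≤_; NonZero)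
  open import Data.Nat.Properties using (≤-trans; n≤1+n)
  open import Data.List.Relation.Unary.All as All′ using (All; []; _∷_)
  import Data.List.Relation.Unary.All.Properties as All
  open import Data.Integer using (ℤ; +_; _+_; _-_; _*_; -_; 0ℤ; 1ℤ; -1ℤ)
  open import Data.Integer.Properties using (*-zeroʳ; +-inverseʳ; *-cancelˡ-≡)
  open import Data.Integer.Tactic.RingSolver using (solve-∀)
  open import Data.List using (List; []; _∷_; map; length)
  open import Data.List.Properties using (map-∘; map-cong; map-id; length-map)
  open Cochain-Calculus

  -- The maps `c s` and `u s` form a zigzag from the identity to a constant; for faces of the cube
  -- it is `c s ⊑ u s ⊒ c (suc s)`. `Good k` abstracts flags of faces with at most `k` free
  -- coordinates, and every prism raises `k` by one.
  module Equivariant {P : Set} (A : P → P) (q : ℕ) (A-cyclic : ∀ x → iter A q x ≡ x)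
    (n : ℕ) (c u : ℕ → P → P) (c-zero : ∀ x → c 0 x ≡ x) (c-const : ∀ x y → c n x ≡ c n y) (o : P)
    (Good : ℕ → List P → Set)
    (Good-A : ∀ {k l} → Good k l → Good k (map A l))
    (Good-here : ∀ {k l l′} s → Good k l → Cochains.PrismFace (c s) (u s) l l′ → Good (suc k) l′)
    (Good-there : ∀ {k l l′} s → Good k l → Cochains.PrismFace (c (suc s)) (u s) l l′ → Good (suc k) l′)
    (Good-o : Good 0 (o ∷ []))
    where

    open Cochains {P} public

    -- Neighbours `c s` and `c (suc s)` are comparable only through `u s`, so each stage is one
    -- prism up minus one prism down. The whole sum is a contraction to a point.
    Γ : ℕ → Cochain → Cochain
    Γ zero f l = 0ℤ
    Γ (suc k) f l = Γ k f l + (prism (c k) (u k) f l - prism (c (suc k)) (u k) f l)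

    Γ-+ : ∀ k f g l → Γ k (λ l′ → f l′ + g l′) l ≡ Γ k f l + Γ k g l
    Γ-+ zero f g l = refl
    Γ-+ (suc k) f g l = trans
      (cong₂ _+_ (Γ-+ k f g l) (cong₂ _-_ (prism-+ _ _ f g l) (prism-+ _ _ f g l)))
      (lemma (Γ k f l) (Γ k g l) (prism (c k) (u k) f l) (prism (c k) (u k) g l)
             (prism (c (suc k)) (u k) f l) (prism (c (suc k)) (u k) g l))
      where
      lemma : ∀ a b x y z w → (a + b) + ((x + y) - (z + w)) ≡ (a + (x - z)) + (b + (y - w))
      lemma = solve-∀

    Γ-*ˡ : ∀ k a f l → Γ k (λ l′ → a * f l′) l ≡ a * Γ k f l
    Γ-*ˡ zero a f l = sym (*-zeroʳ a)
    Γ-*ˡ (suc k) a f l = trans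
      (cong₂ _+_ (Γ-*ˡ k a f l) (cong₂ _-_ (prism-*ˡ _ _ a f l) (prism-*ˡ _ _ a f l)))
      (lemma a (Γ k f l) (prism (c k) (u k) f l) (prism (c (suc k)) (u k) f l))
      where
      lemma : ∀ a x y z → a * x + (a * y - a * z) ≡ a * (x + (y - z))
      lemma = solve-∀

    -- `prism-δ` telescopes: the terms of `u s` cancel within a stage, those of the inner `c s`
    -- between stages.
    Γ-δ : ∀ k f l → Γ k (δ f) l ≡ (f (map (c k) l) - f (map (c 0) l)) - δ (Γ k f) l
    Γ-δ zero f l = trans (lemma (f (map (c 0) l))) (cong (_-_ (f (map (c 0) l) - f (map (c 0) l))) (sym (δ-zero l)))
      where
      lemma : ∀ a → 0ℤ ≡ (a - a) - 0ℤ
      lemma = solve-∀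
      δ-zero : ∀ l → δ (λ _ → 0ℤ) l ≡ 0ℤ
      δ-zero [] = refl
      δ-zero (x ∷ l) = cong (_-_ 0ℤ) (δ-zero l)
    Γ-δ (suc k) f l = begin
      Γ k (δ f) l + (prism (c k) (u k) (δ f) l - prism (c (suc k)) (u k) (δ f) l)
        ≡⟨ cong₂ _+_ (Γ-δ k f l) (cong₂ _-_ (prism-δ _ _ f l) (prism-δ _ _ f l)) ⟩
      ((ck - c0) - dΓ) + (((fu - ck) - d1) - ((fu - ck′) - d2))
        ≡⟨ lemma ck c0 dΓ fu d1 ck′ d2 ⟩
      (ck′ - c0) - (dΓ + (d1 - d2))
        ≡⟨ cong (λ z → (ck′ - c0) - (dΓ + z)) (sym (δ-- (prism (c k) (u k) f) (prism (c (suc k)) (u k) f) l)) ⟩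
      (ck′ - c0) - (dΓ + δ (λ l′ → prism (c k) (u k) f l′ - prism (c (suc k)) (u k) f l′) l)
        ≡⟨ cong (_-_ (ck′ - c0)) (sym (δ-+ (Γ k f) (λ l′ → prism (c k) (u k) f l′ - prism (c (suc k)) (u k) f l′) l)) ⟩
      (ck′ - c0) - δ (Γ (suc k) f) l ∎
      where
      open ≡-Reasoning
      ck = f (map (c k) l)
      c0 = f (map (c 0) l)
      ck′ = f (map (c (suc k)) l)
      fu = f (map (u k) l)
      dΓ = δ (Γ k f) l
      d1 = δ (prism (c k) (u k) f) l
      d2 = δ (prism (c (suc k)) (u k) f) l
      lemma : ∀ ck c0 dΓ fu d1 ck′ d2 → ((ck - c0) - dΓ) + (((fu - ck) - d1) - ((fu - ck′) - d2)) ≡ (ck′ - c0) - (dΓ + (d1 - d2))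
      lemma = solve-∀

    Γ-cong : ∀ k {f g} l
      → (∀ s l′ → PrismFace (c s) (u s) l l′ → f l′ ≡ g l′)
      → (∀ s l′ → PrismFace (c (suc s)) (u s) l l′ → f l′ ≡ g l′)
      → Γ k f l ≡ Γ k g l
    Γ-cong zero l e e′ = refl
    Γ-cong (suc k) l e e′ = cong₂ _+_ (Γ-cong k l e e′)
      (cong₂ _-_ (prism-cong _ _ l (e k)) (prism-cong _ _ l (e′ k)))

    Agree : ℕ → Cochain → Cochain → Set
    Agree j f g = ∀ l → Good j l → length l ≡ suc j → f l ≡ g l

    PrismFace-length : ∀ {v w : P → P} {l l′} → PrismFace v w l l′ → length l′ ≡ suc (length l)
    PrismFace-length {w = w} (here {l = l}) = cong (suc ∘ suc) (length-map w l)
    PrismFace-length (there m) = cong suc (PrismFace-length m)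

    Γ-agree : ∀ {j f g} → Agree (suc j) f g → Agree j (Γ n f) (Γ n g)
    Γ-agree e l gl len = Γ-cong n l
      (λ s l′ m → e l′ (Good-here s gl m) (trans (PrismFace-length m) (cong suc len)))
      (λ s l′ m → e l′ (Good-there s gl m) (trans (PrismFace-length m) (cong suc len)))

    -- A `j`-chain, represented by integration against it: `agree` expresses that it is supported on
    -- good simplices, and `add` and `scale` replace formal integral combinations.
    record Functional (j : ℕ) : Set where
      field
        ⟪_⟫   : Cochain → ℤ
        agree : ∀ {f g} → Agree j f g → ⟪_⟫ f ≡ ⟪_⟫ g
        add   : ∀ f g → ⟪_⟫ (λ l → f l + g l) ≡ ⟪_⟫ f + ⟪_⟫ g
        scale : ∀ a f → ⟪_⟫ (λ l → a * f l) ≡ a * ⟪_⟫ f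

      ext : ∀ {f g} → (∀ l → f l ≡ g l) → ⟪_⟫ f ≡ ⟪_⟫ g
      ext e = agree (λ l _ _ → e l)

      sub : ∀ f g → ⟪_⟫ (λ l → f l - g l) ≡ ⟪_⟫ f - ⟪_⟫ g
      sub f g = begin
        ⟪_⟫ (λ l → f l - g l) ≡⟨ ext (λ l → lemma (f l) (g l)) ⟩
        ⟪_⟫ (λ l → f l + -1ℤ * g l) ≡⟨ add f _ ⟩
        ⟪_⟫ f + ⟪_⟫ (λ l → -1ℤ * g l) ≡⟨ cong (_+_ (⟪_⟫ f)) (scale -1ℤ g) ⟩
        ⟪_⟫ f + -1ℤ * ⟪_⟫ g ≡⟨ sym (lemma (⟪_⟫ f) (⟪_⟫ g)) ⟩
        ⟪_⟫ f - ⟪_⟫ g ∎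
        where
        open ≡-Reasoning
        lemma : ∀ a b → a - b ≡ a + -1ℤ * b
        lemma = solve-∀

      zeroF : ⟪_⟫ (λ _ → 0ℤ) ≡ 0ℤ
      zeroF = scale 0ℤ (λ _ → 0ℤ)

      sum : ∀ k (f : ℕ → Cochain) → ⟪_⟫ (λ l → Σ< k (λ i → f i l)) ≡ Σ< k (λ i → ⟪_⟫ (f i))
      sum zero f = zeroF
      sum (suc k) f = trans (add _ (f k)) (cong (_+ ⟪_⟫ (f k)) (sum k f))

    open Functional public

    evaluation : Functional 0
    evaluation = record
      { ⟪_⟫ = λ f → f (o ∷ [])
      ; agree = λ e → e (o ∷ []) Good-o refl
      ; add = λ _ _ → refl
      ; scale = λ _ _ → refl
      }

    rot : ℕ → Cochain → Cochain
    rot i f l = f (map (iter A i) l)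

    Good-iter : ∀ i {k l} → Good k l → Good k (map (iter A i) l)
    Good-iter zero {k} {l} gl rewrite map-id l = gl
    Good-iter (suc i) {k} {l} gl rewrite map-∘ {g = iter A i} {f = A} l = Good-iter i (Good-A gl)

    rotΓ : ∀ {j} → ℕ → Functional j → Functional (suc j)
    rotΓ i F = record
      { ⟪_⟫ = λ f → ⟪ F ⟫ (rot i (Γ n f))
      ; agree = λ e → agree F (λ l gl len → Γ-agree e _ (Good-iter i gl) (trans (length-map _ l) len))
      ; add = λ f g → trans (ext F (λ l → Γ-+ n f g _)) (add F _ _)
      ; scale = λ a f → trans (ext F (λ l → Γ-*ˡ n a f _)) (scale F a _)
      }

    _⊝_ : ∀ {j} → Functional j → Functional j → Functional j
    F ⊝ G = record
      { ⟪_⟫ = λ f → ⟪ F ⟫ f - ⟪ G ⟫ f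
      ; agree = λ e → cong₂ _-_ (agree F e) (agree G e)
      ; add = λ f g → trans (cong₂ _-_ (add F f g) (add G f g)) (lemma₁ (⟪ F ⟫ f) (⟪ F ⟫ g) (⟪ G ⟫ f) (⟪ G ⟫ g))
      ; scale = λ a f → trans (cong₂ _-_ (scale F a f) (scale G a f)) (lemma₂ a (⟪ F ⟫ f) (⟪ G ⟫ f))
      }
      where
      lemma₁ : ∀ a b c d → (a + b) - (c + d) ≡ (a - c) + (b - d)
      lemma₁ = solve-∀
      lemma₂ : ∀ a b c → a * b - a * c ≡ a * (b - c)
      lemma₂ = solve-∀

    −Σ : ∀ {j} → ℕ → (ℕ → Functional j) → Functional j
    −Σ k F = record
      { ⟪_⟫ = λ f → - Σ< k (λ i → ⟪ F i ⟫ f)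
      ; agree = λ e → cong -_ (Σ<-cong k (λ i → agree (F i) e))
      ; add = λ f g → trans (cong -_ (trans (Σ<-cong k (λ i → add (F i) f g)) (Σ<-+ k _ _)))
                            (lemma₁ (Σ< k (λ i → ⟪ F i ⟫ f)) (Σ< k (λ i → ⟪ F i ⟫ g)))
      ; scale = λ a f → trans (cong -_ (trans (Σ<-cong k (λ i → scale (F i) a f)) (Σ<-*ˡ k a _)))
                              (lemma₂ a (Σ< k (λ i → ⟪ F i ⟫ f)))
      }
      where
      lemma₁ : ∀ a b → - (a + b) ≡ - a + - b
      lemma₁ = solve-∀
      lemma₂ : ∀ a b → - (a * b) ≡ a * - b
      lemma₂ = solve-∀

    -- even d and odd d evaluate cochains on chains h₂d and h₂d₊₁ with ∂h₂d₊₁ = (A - 1) h₂d and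
    -- ∂h₂d₊₂ = (1 + A + ⋯ + A^(q-1)) h₂d₊₁, obtained by coning off with the contraction Γ.
    even : ∀ d → Functional (dbl d)
    odd  : ∀ d → Functional (suc (dbl d))
    even zero = evaluation
    even (suc d) = −Σ q (λ i → rotΓ i (odd d))
    odd d = rotΓ 0 (even d) ⊝ rotΓ 1 (even d)

    rot-zero : ∀ f l → rot 0 f l ≡ f l
    rot-zero f l = cong f (map-id l)

    rot-suc : ∀ i f l → rot 1 (rot i f) l ≡ rot (suc i) f l
    rot-suc i f l = cong f (sym (map-∘ l))

    rot-q : ∀ f l → rot q f l ≡ f l
    rot-q f l = cong f (trans (map-cong A-cyclic l) (map-id l))

    LengthOnly : Cochain → Set
    LengthOnly f = ∀ l l′ → length l ≡ length l′ → f l ≡ f l′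

    prism-lengthOnly : ∀ v w {f} → LengthOnly f → LengthOnly (prism v w f)
    prism-lengthOnly v w e [] [] len = refl
    prism-lengthOnly v w e (x ∷ l) (y ∷ l′) len = cong₂ _-_
      (e _ _ (cong suc (trans (cong suc (length-map w l)) (trans len (cong suc (sym (length-map w l′)))))))
      (trans (prism-cong v w l (λ m _ → e (v x ∷ m) (v y ∷ m) refl))
             (prism-lengthOnly v w (λ m m′ len′ → e _ _ (cong suc len′)) l l′ (suc-inj len)))
      where
      suc-inj : ∀ {a b} → suc a ≡ suc b → a ≡ b
      suc-inj refl = refl

    Γ-lengthOnly : ∀ k {f} → LengthOnly f → LengthOnly (Γ k f)
    Γ-lengthOnly zero e l l′ len = refl
    Γ-lengthOnly (suc k) e l l′ len = cong₂ _+_ (Γ-lengthOnly k e l l′ len)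
      (cong₂ _-_ (prism-lengthOnly _ _ e l l′ len) (prism-lengthOnly _ _ e l l′ len))

    -- `odd d` is a difference of two rotates, and rotation preserves lengths. This removes the term
    -- of the constant map that the contraction leaves behind.
    odd-lengthOnly : ∀ d {f} → LengthOnly f → ⟪ odd d ⟫ f ≡ 0ℤ
    odd-lengthOnly d {f} e = trans
      (cong (_- ⟪ even d ⟫ (rot 1 (Γ n f)))
        (ext (even d) (λ l → Γ-lengthOnly n e _ _ (trans (length-map _ l) (sym (length-map _ l))))))
      (+-inverseʳ (⟪ even d ⟫ (rot 1 (Γ n f))))

    const : Cochain → Cochain
    const f l = f (map (c n) l)

    const-lengthOnly : ∀ f → LengthOnly (const f)
    const-lengthOnly f l l′ len = cong f (go l l′ len)
      where
      go : ∀ l l′ → length l ≡ length l′ → map (c n) l ≡ map (c n) l′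
      go [] [] len = refl
      go (x ∷ l) (y ∷ l′) len = cong₂ _∷_ (c-const x y) (go l l′ (cong Data.Nat.pred len))

    Γδ : ∀ f l → Γ n (δ f) l ≡ (const f l - f l) - δ (Γ n f) l
    Γδ f l = trans (Γ-δ n f l)
      (cong (λ z → (const f l - f z) - δ (Γ n f) l) (trans (map-cong c-zero l) (map-id l)))

    rotΓδ : ∀ {j} (F : Functional j) i f →
      ⟪ F ⟫ (rot i (Γ n (δ f))) ≡ (⟪ F ⟫ (rot i (const f)) - ⟪ F ⟫ (rot i f)) - ⟪ F ⟫ (rot i (δ (Γ n f)))
    rotΓδ F i f = begin
      ⟪ F ⟫ (rot i (Γ n (δ f)))
        ≡⟨ ext F (λ l → Γδ f _) ⟩
      ⟪ F ⟫ (λ l → (rot i (const f) l - rot i f l) - rot i (δ (Γ n f)) l)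
        ≡⟨ sub F _ _ ⟩
      ⟪ F ⟫ (λ l → rot i (const f) l - rot i f l) - ⟪ F ⟫ (rot i (δ (Γ n f)))
        ≡⟨ cong (_- ⟪ F ⟫ (rot i (δ (Γ n f)))) (sub F _ _) ⟩
      (⟪ F ⟫ (rot i (const f)) - ⟪ F ⟫ (rot i f)) - ⟪ F ⟫ (rot i (δ (Γ n f))) ∎
      where open ≡-Reasoning

    -- The three facts feed each other: `odd-δ` holds because the boundary of `even d` is
    -- rotation-invariant, `even-δ` uses `odd-δ`, and the invariance one level up holds because that
    -- boundary is then a full orbit sum.
    even-δ-rot : ∀ d f → ⟪ even d ⟫ (rot 1 (δ f)) ≡ ⟪ even d ⟫ (δ f)
    odd-δ  : ∀ d f → ⟪ odd d ⟫ (δ f) ≡ ⟪ even d ⟫ (rot 1 f) - ⟪ even d ⟫ f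
    even-δ : ∀ d f → ⟪ even (suc d) ⟫ (δ f) ≡ Σ< q (λ i → ⟪ odd d ⟫ (rot i f))

    even-δ-rot zero f = refl
    even-δ-rot (suc d) f = begin
      ⟪ even (suc d) ⟫ (rot 1 (δ f)) ≡⟨ ext (even (suc d)) (λ l → sym (δ-map _ f l)) ⟩
      ⟪ even (suc d) ⟫ (δ (rot 1 f)) ≡⟨ even-δ d (rot 1 f) ⟩
      Σ< q (λ i → ⟪ odd d ⟫ (rot i (rot 1 f))) ≡⟨ Σ<-cong q (λ i → ext (odd d) (λ l → cong f (comm i l))) ⟩
      Σ< q (λ i → ⟪ odd d ⟫ (rot (suc i) f)) ≡⟨ Σ<-cycle q (λ i → ⟪ odd d ⟫ (rot i f))
                                                         (ext (odd d) (λ l → trans (rot-q f l) (sym (rot-zero f l)))) ⟩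
      Σ< q (λ i → ⟪ odd d ⟫ (rot i f)) ≡⟨ sym (even-δ d f) ⟩
      ⟪ even (suc d) ⟫ (δ f) ∎
      where
      open ≡-Reasoning
      comm : ∀ i l → map (iter A 1) (map (iter A i) l) ≡ map (iter A (suc i)) l
      comm i l = trans (sym (map-∘ l)) (map-cong (λ x → sym (iter-comm A i x)) l)

    odd-δ d f = begin
      ⟪ even d ⟫ (rot 0 (Γ n (δ f))) - ⟪ even d ⟫ (rot 1 (Γ n (δ f)))
        ≡⟨ cong₂ _-_ (rotΓδ (even d) 0 f) (rotΓδ (even d) 1 f) ⟩
      ((c₀ - f₀) - g₀) - ((c₁ - f₁) - g₁)
        ≡⟨ cong₂ (λ x y → ((x - f₀) - y) - ((c₁ - f₁) - g₁)) c₀≡c₁ g₀≡g₁ ⟩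
      ((c₁ - f₀) - g₁) - ((c₁ - f₁) - g₁)
        ≡⟨ lemma c₁ f₀ f₁ g₁ ⟩
      f₁ - f₀
        ≡⟨ cong (_-_ f₁) (ext (even d) (rot-zero f)) ⟩
      f₁ - ⟪ even d ⟫ f ∎
      where
      open ≡-Reasoning
      c₀ = ⟪ even d ⟫ (rot 0 (const f))
      c₁ = ⟪ even d ⟫ (rot 1 (const f))
      f₀ = ⟪ even d ⟫ (rot 0 f)
      f₁ = ⟪ even d ⟫ (rot 1 f)
      g₀ = ⟪ even d ⟫ (rot 0 (δ (Γ n f)))
      g₁ = ⟪ even d ⟫ (rot 1 (δ (Γ n f)))
      c₀≡c₁ : c₀ ≡ c₁
      c₀≡c₁ = ext (even d) (λ l → const-lengthOnly f _ _ (trans (length-map _ l) (sym (length-map _ l))))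
      g₀≡g₁ : g₀ ≡ g₁
      g₀≡g₁ = trans (ext (even d) (rot-zero (δ (Γ n f)))) (sym (even-δ-rot d (Γ n f)))
      lemma : ∀ c f₀ f₁ g → ((c - f₀) - g) - ((c - f₁) - g) ≡ f₁ - f₀
      lemma = solve-∀

    even-δ d f = begin
      - Σ< q (λ i → ⟪ odd d ⟫ (rot i (Γ n (δ f))))
        ≡⟨ cong -_ (Σ<-cong q step) ⟩
      - Σ< q (λ i → -1ℤ * ⟪ odd d ⟫ (rot i f) + -1ℤ * (h (suc i) - h i))
        ≡⟨ cong -_ (Σ<-+ q _ _) ⟩
      - (Σ< q (λ i → -1ℤ * ⟪ odd d ⟫ (rot i f)) + Σ< q (λ i → -1ℤ * (h (suc i) - h i)))
        ≡⟨ cong₂ (λ x y → - (x + y)) (Σ<-*ˡ q -1ℤ _) (Σ<-*ˡ q -1ℤ _) ⟩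
      - (-1ℤ * S + -1ℤ * Σ< q (λ i → h (suc i) - h i))
        -- By `odd-δ` the unwanted terms are consecutive differences along an orbit, so they
        -- telescope to zero after `q` rotations.
        ≡⟨ cong (λ x → - (-1ℤ * S + -1ℤ * x)) (trans (Σ<-telescope q h) (trans (cong (_- h 0) hq≡h0) (+-inverseʳ (h 0)))) ⟩
      - (-1ℤ * S + -1ℤ * 0ℤ)
        ≡⟨ lemma S ⟩
      S ∎
      where
      open ≡-Reasoning
      S = Σ< q (λ i → ⟪ odd d ⟫ (rot i f))
      h : ℕ → ℤ
      h i = ⟪ even d ⟫ (rot i (Γ n f))
      hq≡h0 : h q ≡ h 0
      hq≡h0 = ext (even d) (λ l → trans (rot-q (Γ n f) l) (sym (rot-zero (Γ n f) l)))
      lemma : ∀ s → - (-1ℤ * s + -1ℤ * 0ℤ) ≡ s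
      lemma = solve-∀
      lemma′ : ∀ x y → (0ℤ - x) - y ≡ -1ℤ * x + -1ℤ * y
      lemma′ = solve-∀
      step : ∀ i → ⟪ odd d ⟫ (rot i (Γ n (δ f))) ≡ -1ℤ * ⟪ odd d ⟫ (rot i f) + -1ℤ * (h (suc i) - h i)
      step i = begin
        ⟪ odd d ⟫ (rot i (Γ n (δ f)))
          ≡⟨ rotΓδ (odd d) i f ⟩
        (⟪ odd d ⟫ (rot i (const f)) - ⟪ odd d ⟫ (rot i f)) - ⟪ odd d ⟫ (rot i (δ (Γ n f)))
          ≡⟨ cong (λ z → (z - ⟪ odd d ⟫ (rot i f)) - ⟪ odd d ⟫ (rot i (δ (Γ n f))))
               (odd-lengthOnly d {rot i (const f)} (λ l l′ len → const-lengthOnly f _ _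
                 (trans (length-map _ l) (trans len (sym (length-map _ l′)))))) ⟩
        (0ℤ - ⟪ odd d ⟫ (rot i f)) - ⟪ odd d ⟫ (rot i (δ (Γ n f)))
          ≡⟨ cong (_-_ (0ℤ - ⟪ odd d ⟫ (rot i f))) (trans (ext (odd d) (λ l → sym (δ-map _ (Γ n f) l))) (odd-δ d (rot i (Γ n f)))) ⟩
        (0ℤ - ⟪ odd d ⟫ (rot i f)) - (⟪ even d ⟫ (rot 1 (rot i (Γ n f))) - h i)
          ≡⟨ cong (λ z → (0ℤ - ⟪ odd d ⟫ (rot i f)) - (z - h i)) (ext (even d) (rot-suc i (Γ n f))) ⟩
        (0ℤ - ⟪ odd d ⟫ (rot i f)) - (h (suc i) - h i)
          ≡⟨ lemma′ (⟪ odd d ⟫ (rot i f)) (h (suc i) - h i) ⟩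
        -1ℤ * ⟪ odd d ⟫ (rot i f) + -1ℤ * (h (suc i) - h i) ∎

    infixr 7 _∪₀_ _∪₁_

    _∪₀_ : (P → ℤ) → Cochain → Cochain
    (g ∪₀ Y) [] = 0ℤ
    (g ∪₀ Y) (x ∷ l) = g x * Y (x ∷ l)

    _∪₁_ : (P → P → ℤ) → Cochain → Cochain
    (b ∪₁ Y) [] = 0ℤ
    (b ∪₁ Y) (x ∷ []) = 0ℤ
    (b ∪₁ Y) (x ∷ y ∷ l) = b x y * Y (y ∷ l)

    -- The Leibniz rule, whose second term drops since `Y` is closed: closedness identifies the
    -- alternating sum over the faces through `x` with `Y (y ∷ l)`.
    δ-∪₀ : ∀ g Y → (∀ l → δ Y l ≡ 0ℤ) → ∀ x y l → δ (g ∪₀ Y) (x ∷ y ∷ l) ≡ (g y - g x) * Y (y ∷ l)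
    δ-∪₀ g Y closed x y l = begin
      g y * Y (y ∷ l) - δ (λ l′ → g x * Y (x ∷ l′)) (y ∷ l) ≡⟨ cong (_-_ (g y * Y (y ∷ l))) (δ-*ˡ (g x) (λ l′ → Y (x ∷ l′)) (y ∷ l)) ⟩
      g y * Y (y ∷ l) - g x * D ≡⟨ lemma (g y) (g x) (Y (y ∷ l)) D ⟩
      (g y - g x) * Y (y ∷ l) + g x * (Y (y ∷ l) - D) ≡⟨ cong (λ z → (g y - g x) * Y (y ∷ l) + g x * z) (closed (x ∷ y ∷ l)) ⟩
      (g y - g x) * Y (y ∷ l) + g x * 0ℤ ≡⟨ lemma′ ((g y - g x) * Y (y ∷ l)) (g x) ⟩
      (g y - g x) * Y (y ∷ l) ∎
      where
      open ≡-Reasoning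
      D = δ (λ l′ → Y (x ∷ l′)) (y ∷ l)
      lemma : ∀ a b y d → a * y - b * d ≡ (a - b) * y + b * (y - d)
      lemma = solve-∀
      lemma′ : ∀ a b → a + b * 0ℤ ≡ a
      lemma′ = solve-∀

    δ-∪₁ : ∀ b Y → (∀ l → δ Y l ≡ 0ℤ) → ∀ x y z l →
      δ (b ∪₁ Y) (x ∷ y ∷ z ∷ l) ≡ ((b x y + b y z) - b x z) * Y (z ∷ l)
    δ-∪₁ b Y closed x y z l = begin
      b y z * Yz - (b x z * Yz - δ (λ l′ → b x y * Y (y ∷ l′)) (z ∷ l))
        ≡⟨ cong (λ t → b y z * Yz - (b x z * Yz - t)) (δ-*ˡ (b x y) (λ l′ → Y (y ∷ l′)) (z ∷ l)) ⟩
      b y z * Yz - (b x z * Yz - b x y * D)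
        ≡⟨ lemma (b x y) (b y z) (b x z) Yz D ⟩
      ((b x y + b y z) - b x z) * Yz - b x y * (Yz - D)
        ≡⟨ cong (λ t → ((b x y + b y z) - b x z) * Yz - b x y * t) (closed (y ∷ z ∷ l)) ⟩
      ((b x y + b y z) - b x z) * Yz - b x y * 0ℤ
        ≡⟨ lemma′ (((b x y + b y z) - b x z) * Yz) (b x y) ⟩
      ((b x y + b y z) - b x z) * Yz ∎
      where
      open ≡-Reasoning
      Yz = Y (z ∷ l)
      D = δ (λ l′ → Y (y ∷ l′)) (z ∷ l)
      lemma : ∀ p r s y d → r * y - (s * y - p * d) ≡ ((p + r) - s) * y - p * (y - d)
      lemma = solve-∀
      lemma′ : ∀ a b → a - b * 0ℤ ≡ a
      lemma′ = solve-∀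

    module CupPower (b : P → P → ℤ) where

      unit : Cochain
      unit [] = 1ℤ
      unit (_ ∷ _) = 0ℤ

      -- δ unit is the constant 0-cochain 1; for the wrap-around cochain b of a ℤ_q-valued label,
      -- power d represents the d-th cup power of the Bockstein of the label.
      power : ℕ → Cochain
      power zero = δ unit
      power (suc d) = δ (b ∪₁ power d)

      power-closed : ∀ d l → δ (power d) l ≡ 0ℤ
      power-closed zero = δδ≡0 unit
      power-closed (suc d) = δδ≡0 (b ∪₁ power d)

      power-suc : ∀ d x y z l → power (suc d) (x ∷ y ∷ z ∷ l) ≡ ((b x y + b y z) - b x z) * power d (z ∷ l)
      power-suc d = δ-∪₁ b (power d) (power-closed d)

      module Value .{{_ : NonZero q}} (m : ℕ) (Small : P → Set) (Small-A : ∀ {x} → Small x → Small (A x))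
        (Good-small : ∀ {j l} → j ≤ m → Good j l → All Small l)
        (g w : P → ℤ)
        (g-A : ∀ {x} → Small x → g (A x) ≡ (g x + 1ℤ) - + q * w x)
        (b-A : ∀ {x y} → Small x → Small y → b (A x) (A y) ≡ b x y + (w y - w x))
        (g-sum : ∀ {x y} → Small x → Small y → Σ< q (λ i → g (iter A i x)) ≡ Σ< q (λ i → g (iter A i y)))
        where

        -- `(g y - g x) + q * b x y` does not change when both points are rotated. Over an orbit its
        -- `g` parts cancel by `g-sum`, so `q` times the sum of `b` is `q` times this invariant, and
        -- `q` cancels over the integers.
        b-sum : ∀ {x y} → Small x → Small y →
          Σ< q (λ i → b (iter A i x) (iter A i y)) ≡ (g y - g x) + + q * b x y
        b-sum {x} {y} sx sy = *-cancelˡ-≡ (+ q) _ _ (begin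
          + q * Σ< q (λ i → bᵢ i)
            ≡⟨ sym (Σ<-*ˡ q (+ q) _) ⟩
          Σ< q (λ i → + q * bᵢ i)
            ≡⟨ Σ<-cong q (λ i → trans (lemma (gx i) (gy i) (+ q * bᵢ i)) (cong (_+ (gx i - gy i)) (invariant i sx sy))) ⟩
          Σ< q (λ i → d + (gx i - gy i))
            ≡⟨ Σ<-+ q _ _ ⟩
          Σ< q (λ i → d) + Σ< q (λ i → gx i - gy i)
            ≡⟨ cong₂ _+_ (Σ<-const q d) (trans (Σ<-cong q (λ i → lemma₂ (gx i) (gy i))) (trans (Σ<-+ q _ _) (cong (_+_ (Σ< q gx)) (Σ<-*ˡ q -1ℤ _)))) ⟩
          + q * d + (Σ< q gx + -1ℤ * Σ< q gy)
            ≡⟨ cong (λ z → + q * d + (z + -1ℤ * Σ< q gy)) (g-sum sx sy) ⟩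
          + q * d + (Σ< q gy + -1ℤ * Σ< q gy)
            ≡⟨ lemma₃ (+ q * d) (Σ< q gy) ⟩
          + q * d ∎)
          where
          open ≡-Reasoning
          gx gy bᵢ : ℕ → ℤ
          gx i = g (iter A i x)
          gy i = g (iter A i y)
          bᵢ i = b (iter A i x) (iter A i y)
          d = (g y - g x) + + q * b x y
          lemma : ∀ u v w → w ≡ ((v - u) + w) + (u - v)
          lemma = solve-∀
          lemma₂ : ∀ u v → u - v ≡ u + -1ℤ * v
          lemma₂ = solve-∀
          lemma₃ : ∀ u v → u + (v + -1ℤ * v) ≡ u
          lemma₃ = solve-∀
          lemma₄ : ∀ gx gy wx wy b q → (((gy + 1ℤ) - q * wy) - ((gx + 1ℤ) - q * wx)) + q * (b + (wy - wx)) ≡ (gy - gx) + q * b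
          lemma₄ = solve-∀
          invariant : ∀ i {x y} → Small x → Small y →
            (g (iter A i y) - g (iter A i x)) + + q * b (iter A i x) (iter A i y) ≡ (g y - g x) + + q * b x y
          invariant zero _ _ = refl
          invariant (suc i) {x} {y} sx sy = begin
            _ ≡⟨ invariant i (Small-A sx) (Small-A sy) ⟩
            (g (A y) - g (A x)) + + q * b (A x) (A y)
              ≡⟨ cong₂ _+_ (cong₂ _-_ (g-A sy) (g-A sx)) (cong (_*_ (+ q)) (b-A sx sy)) ⟩
            (((g y + 1ℤ) - + q * w y) - ((g x + 1ℤ) - + q * w x)) + + q * (b x y + (w y - w x))
              ≡⟨ lemma₄ (g x) (g y) (w x) (w y) (b x y) (+ q) ⟩
            (g y - g x) + + q * b x y ∎

        -- Rotation changes `b` by the coboundary of `w`, which `δ b` does not see.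
        power-A : ∀ d {l} → All Small l → power d (map A l) ≡ power d l
        power-A zero {l} _ = trans (sym (δ-map A unit l)) (δ-cong unit-map l)
          where
          unit-map : ∀ l → unit (map A l) ≡ unit l
          unit-map [] = refl
          unit-map (_ ∷ _) = refl
        power-A (suc d) [] = refl
        power-A (suc d) (_ ∷ []) = refl
        power-A (suc d) (_ ∷ _ ∷ []) = refl
        power-A (suc d) {x ∷ y ∷ z ∷ l} (sx ∷ sy ∷ sz ∷ sl) = begin
          power (suc d) (A x ∷ A y ∷ A z ∷ map A l)
            ≡⟨ power-suc d _ _ _ _ ⟩
          ((b (A x) (A y) + b (A y) (A z)) - b (A x) (A z)) * power d (map A (z ∷ l))
            ≡⟨ cong₂ _*_ (trans (cong₂ _-_ (cong₂ _+_ (b-A sx sy) (b-A sy sz)) (b-A sx sz))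
                                (lemma (b x y) (b y z) (b x z) (w x) (w y) (w z)))
                         (power-A d (sz ∷ sl)) ⟩
          ((b x y + b y z) - b x z) * power d (z ∷ l)
            ≡⟨ sym (power-suc d x y z l) ⟩
          power (suc d) (x ∷ y ∷ z ∷ l) ∎
          where
          open ≡-Reasoning
          lemma : ∀ p r s x y z → ((p + (y - x)) + (r + (z - y))) - (s + (z - x)) ≡ (p + r) - s
          lemma = solve-∀

        power-iter : ∀ d i {l} → All Small l → power d (map (iter A i) l) ≡ power d l
        power-iter d zero {l} _ = cong (power d) (map-id l)
        power-iter d (suc i) {l} s = trans (cong (power d) (map-∘ l))
          (trans (power-iter d i (All.map⁺ (All′.map Small-A s))) (power-A d s))

        -- Moving `δ` across to the chain turns the top factor into the orbit sum of `b` on `odd d`,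
        -- which is `δ g` modulo `q`. Moving that `δ` across leaves on `even d` the difference
        -- between `g` and its rotate, which is 1 modulo `q`; so the value modulo `q` passes
        -- unchanged from degree to degree.
        power-value : ∀ d → dbl d ≤ m → ∃ λ z → ⟪ even d ⟫ (power d) ≡ 1ℤ + + q * z
        power-value zero _ = 0ℤ , sym (trans (cong (_+_ 1ℤ) (*-zeroʳ (+ q))) refl)
        power-value (suc d) le with power-value d (≤-trans (n≤1+n _) (≤-trans (n≤1+n _) le))
        ... | z , e = (z - ⟪ even d ⟫ (w ∪₀ Y)) + ⟪ odd d ⟫ (b ∪₁ Y) , (begin
          ⟪ even (suc d) ⟫ (δ (b ∪₁ Y))
            ≡⟨ even-δ d (b ∪₁ Y) ⟩
          Σ< q (λ i → ⟪ odd d ⟫ (rot i (b ∪₁ Y)))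
            ≡⟨ sym (sum (odd d) q (λ i → rot i (b ∪₁ Y))) ⟩
          ⟪ odd d ⟫ (λ l → Σ< q (λ i → rot i (b ∪₁ Y) l))
            ≡⟨ agree (odd d) orbit-sum ⟩
          ⟪ odd d ⟫ (λ l → δ (g ∪₀ Y) l + + q * (b ∪₁ Y) l)
            ≡⟨ trans (add (odd d) _ _) (cong₂ _+_ (odd-δ d (g ∪₀ Y)) (scale (odd d) (+ q) _)) ⟩
          (⟪ even d ⟫ (rot 1 (g ∪₀ Y)) - ⟪ even d ⟫ (g ∪₀ Y)) + + q * B
            ≡⟨ cong (λ t → (t - ⟪ even d ⟫ (g ∪₀ Y)) + + q * B) (agree (even d) shift) ⟩
          (⟪ even d ⟫ (λ l → ((g ∪₀ Y) l + Y l) - + q * (w ∪₀ Y) l) - ⟪ even d ⟫ (g ∪₀ Y)) + + q * B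
            ≡⟨ cong (λ t → (t - ⟪ even d ⟫ (g ∪₀ Y)) + + q * B)
                 (trans (sub (even d) _ _) (cong₂ _-_ (add (even d) _ _) (scale (even d) (+ q) _))) ⟩
          (((⟪ even d ⟫ (g ∪₀ Y) + ⟪ even d ⟫ Y) - + q * C) - ⟪ even d ⟫ (g ∪₀ Y)) + + q * B
            ≡⟨ cong (λ t → (((⟪ even d ⟫ (g ∪₀ Y) + t) - + q * C) - ⟪ even d ⟫ (g ∪₀ Y)) + + q * B) e ⟩
          (((⟪ even d ⟫ (g ∪₀ Y) + (1ℤ + + q * z)) - + q * C) - ⟪ even d ⟫ (g ∪₀ Y)) + + q * B
            ≡⟨ lemma (⟪ even d ⟫ (g ∪₀ Y)) z (+ q) C B ⟩
          1ℤ + + q * ((z - C) + B) ∎)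
          where
          open ≡-Reasoning
          Y = power d
          B = ⟪ odd d ⟫ (b ∪₁ Y)
          C = ⟪ even d ⟫ (w ∪₀ Y)
          lemma : ∀ G z q C B → (((G + (1ℤ + q * z)) - q * C) - G) + q * B ≡ 1ℤ + q * ((z - C) + B)
          lemma = solve-∀
          shift : Agree (dbl d) (rot 1 (g ∪₀ Y)) (λ l → ((g ∪₀ Y) l + Y l) - + q * (w ∪₀ Y) l)
          shift (x ∷ l) gl _ with Good-small (≤-trans (n≤1+n _) (≤-trans (n≤1+n _) le)) gl
          ... | s@(sx ∷ _) = trans (cong₂ _*_ (g-A sx) (power-A d s)) (lemma′ (g x) (w x) (Y (x ∷ l)) (+ q))
            where
            lemma′ : ∀ g w y q → ((g + 1ℤ) - q * w) * y ≡ (g * y + y) - q * (w * y)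
            lemma′ = solve-∀
          orbit-sum : Agree (suc (dbl d)) (λ l → Σ< q (λ i → rot i (b ∪₁ Y) l)) (λ l → δ (g ∪₀ Y) l + + q * (b ∪₁ Y) l)
          orbit-sum (x ∷ y ∷ l) gl _ with Good-small (≤-trans (n≤1+n _) le) gl
          ... | sx ∷ s@(sy ∷ _) = begin
            Σ< q (λ i → b (iter A i x) (iter A i y) * Y (map (iter A i) (y ∷ l)))
              ≡⟨ Σ<-cong q (λ i → cong (_*_ (b (iter A i x) (iter A i y))) (power-iter d i s)) ⟩
            Σ< q (λ i → b (iter A i x) (iter A i y) * Y (y ∷ l))
              ≡⟨ trans (Σ<-*ʳ q _ _) (cong (_* Y (y ∷ l)) (b-sum sx sy)) ⟩
            ((g y - g x) + + q * b x y) * Y (y ∷ l)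
              ≡⟨ lemma″ (g y - g x) (+ q) (b x y) (Y (y ∷ l)) ⟩
            (g y - g x) * Y (y ∷ l) + + q * (b x y * Y (y ∷ l))
              ≡⟨ cong (_+ + q * (b x y * Y (y ∷ l))) (sym (δ-∪₀ g Y (power-closed d) x y l)) ⟩
            δ (g ∪₀ Y) (x ∷ y ∷ l) + + q * (b x y * Y (y ∷ l)) ∎
            where
            lemma″ : ∀ d q b y → (d + q * b) * y ≡ d * y + q * (b * y)
            lemma″ = solve-∀

-- Sums of naturals, and the cochains attached to a label modulo `q`.

module Cyclic-Labels where

  open import Data.Nat using (ℕ; zero; suc; _+_; _*_; _≤_; _<_; z≤n; s≤s; NonZero; _%_; _≟_; _<?_)
  open import Data.Nat.Properties
  open import Data.Nat.DivMod using (m<n⇒m%n≡m; n%n≡0; [m+n]%n≡m%n; %-distribˡ-+; m%n%n≡m%n)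
  open import Data.Nat.Tactic.RingSolver using (solve-∀)
  open import Data.Integer using (ℤ; +_; 1ℤ)
  import Data.Integer as ℤ
  import Data.Integer.Properties as ℤ
  open Cochain-Calculus

  suc-% : ∀ a q .{{_ : NonZero q}} → suc (a % q) % q ≡ suc a % q
  suc-% a q = begin
    suc (a % q) % q ≡⟨ %-distribˡ-+ 1 (a % q) q ⟩
    (1 % q + a % q % q) % q ≡⟨ cong (λ z → (1 % q + z) % q) (m%n%n≡m%n a q) ⟩
    (1 % q + a % q) % q ≡⟨ sym (%-distribˡ-+ 1 a q) ⟩
    suc a % q ∎
    where open ≡-Reasoning

  %-suc-cases : ∀ {a} q .{{_ : NonZero q}} → a < q → (suc a < q × suc a % q ≡ suc a) ⊎ (suc a ≡ q × suc a % q ≡ 0)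
  %-suc-cases {a} q a<q with suc a ≟ q
  ... | yes refl = inj₂ (refl , n%n≡0 (suc a))
  ... | no ≢q = inj₁ (≤∧≢⇒< a<q ≢q , m<n⇒m%n≡m (≤∧≢⇒< a<q ≢q))

  indicator : ∀ {P : Set} → Dec P → ℕ
  indicator (yes _) = 1
  indicator (no _) = 0

  indicator-yes : ∀ {P : Set} (d : Dec P) → P → indicator d ≡ 1
  indicator-yes (yes _) p = refl
  indicator-yes (no ¬p) p = contradiction p ¬p

  indicator-no : ∀ {P : Set} (d : Dec P) → ¬ P → indicator d ≡ 0
  indicator-no (yes p) ¬p = contradiction p ¬p
  indicator-no (no _) ¬p = refl

  indicator-mono : ∀ {P Q : Set} (d : Dec P) (e : Dec Q) → (P → Q) → indicator d ≤ indicator e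
  indicator-mono (no _) e f = z≤n
  indicator-mono (yes p) e f = ≤-reflexive (sym (indicator-yes e (f p)))

  indicator≤1 : ∀ {P : Set} (d : Dec P) → indicator d ≤ 1
  indicator≤1 (yes _) = ≤-refl
  indicator≤1 (no _) = z≤n

  Σℕ : ℕ → (ℕ → ℕ) → ℕ
  Σℕ zero h = 0
  Σℕ (suc k) h = Σℕ k h + h k

  Σℕ-cong : ∀ k {g h : ℕ → ℕ} → (∀ {i} → i < k → g i ≡ h i) → Σℕ k g ≡ Σℕ k h
  Σℕ-cong zero e = refl
  Σℕ-cong (suc k) e = cong₂ _+_ (Σℕ-cong k (λ lt → e (m<n⇒m<1+n lt))) (e ≤-refl)

  Σℕ-mono : ∀ k {g h : ℕ → ℕ} → (∀ i → g i ≤ h i) → Σℕ k g ≤ Σℕ k h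
  Σℕ-mono zero e = z≤n
  Σℕ-mono (suc k) e = +-mono-≤ (Σℕ-mono k e) (e k)

  +-tight : ∀ {a b c d} → a ≤ c → b ≤ d → a + b ≡ c + d → a ≡ c × b ≡ d
  +-tight {a} {b} {c} {d} a≤c b≤d e = a≡c , +-cancelˡ-≡ a b d (trans e (cong (_+ d) (sym a≡c)))
    where
    a≡c : a ≡ c
    a≡c = ≤-antisym a≤c (+-cancelʳ-≤ d c a (subst (_≤ a + d) e (+-monoʳ-≤ a b≤d)))

  Σℕ-tight : ∀ k {g h : ℕ → ℕ} → (∀ i → g i ≤ h i) → Σℕ k g ≡ Σℕ k h → ∀ {i} → i < k → g i ≡ h i
  Σℕ-tight (suc k) le e {i} i<1+k with +-tight (Σℕ-mono k le) (le k) e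
  ... | e₁ , e₂ with m<1+n⇒m<n∨m≡n i<1+k
  ... | inj₁ i<k = Σℕ-tight k le e₁ i<k
  ... | inj₂ refl = e₂

  Σℕ-shift : ∀ k (h : ℕ → ℕ) → Σℕ k (h ∘ suc) + h 0 ≡ Σℕ k h + h k
  Σℕ-shift zero h = refl
  Σℕ-shift (suc k) h = begin
    Σℕ k (h ∘ suc) + h (suc k) + h 0 ≡⟨ lemma (Σℕ k (h ∘ suc)) (h (suc k)) (h 0) ⟩
    (Σℕ k (h ∘ suc) + h 0) + h (suc k) ≡⟨ cong (_+ h (suc k)) (Σℕ-shift k h) ⟩
    Σℕ k h + h k + h (suc k) ∎
    where
    open ≡-Reasoning
    lemma : ∀ a b c → a + b + c ≡ (a + c) + b
    lemma = solve-∀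

  Σℕ-cycle : ∀ k (h : ℕ → ℕ) → h k ≡ h 0 → Σℕ k (h ∘ suc) ≡ Σℕ k h
  Σℕ-cycle k h e = +-cancelʳ-≡ (h 0) _ _ (trans (Σℕ-shift k h) (cong (_+_ (Σℕ k h)) e))

  Σℕ-+ : ∀ k (g h : ℕ → ℕ) → Σℕ k (λ i → g i + h i) ≡ Σℕ k g + Σℕ k h
  Σℕ-+ zero g h = refl
  Σℕ-+ (suc k) g h = trans (cong (_+ (g k + h k)) (Σℕ-+ k g h)) (lemma (Σℕ k g) (Σℕ k h) (g k) (h k))
    where
    lemma : ∀ a b x y → (a + b) + (x + y) ≡ (a + x) + (b + y)
    lemma = solve-∀

  Σℕ-bound : ∀ k b (h : ℕ → ℕ) → (∀ i → h i ≤ b) → Σℕ k h ≤ k * b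
  Σℕ-bound zero b h e = z≤n
  Σℕ-bound (suc k) b h e = ≤-trans (+-mono-≤ (Σℕ-bound k b h e) (e k)) (≤-reflexive (+-comm (k * b) b))

  Σℕ-term : ∀ k (h : ℕ → ℕ) {i} → i < k → h i ≤ Σℕ k h
  Σℕ-term (suc k) h {i} i<1+k with m<1+n⇒m<n∨m≡n i<1+k
  ... | inj₁ i<k = ≤-trans (Σℕ-term k h i<k) (m≤m+n _ _)
  ... | inj₂ refl = m≤n+m _ _

  Σℕ-gap : ∀ k (h : ℕ → ℕ) → (∀ i → h i ≤ 1) → ∀ {i} → i < k → h i ≡ 0 → Σℕ k h < k
  Σℕ-gap (suc k) h le {i} i<1+k e with m<1+n⇒m<n∨m≡n i<1+k
  ... | inj₁ i<k = subst (suc (Σℕ k h + h k) ≤_) (+-comm k 1) (+-mono-≤ (Σℕ-gap k h le i<k e) (le k))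
  ... | inj₂ refl rewrite e | +-identityʳ (Σℕ k h) = s≤s (≤-trans (Σℕ-bound k 1 h le) (≤-reflexive (*-identityʳ k)))

  module CyclicLabel {P : Set} (A : P → P) (q : ℕ) .{{_ : NonZero q}} (Small : P → Set)
    (Small-A : ∀ {x} → Small x → Small (A x))
    (label : P → ℕ) (label<q : ∀ x → label x < q)
    (label-A : ∀ {x} → Small x → label (A x) ≡ suc (label x) % q) where

    -- g lifts the label to {0,…,q-1}, w marks where rotating wraps around, and b x y marks where
    -- walking up from the label of x to that of y wraps around.
    g w : P → ℤ
    g x = + label x
    w x = + indicator (suc (label x) ≟ q)

    b : P → P → ℤ
    b x y = + indicator (label y <? label x)

    g-A : ∀ {x} → Small x → g (A x) ≡ (g x ℤ.+ 1ℤ) ℤ.- + q ℤ.* w x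
    g-A {x} s with %-suc-cases q (label<q x) | suc (label x) ≟ q
    ... | inj₁ (lt , e) | yes refl = contradiction lt (<-irrefl refl)
    ... | inj₁ (lt , e) | no _ rewrite label-A s | e | ℤ.*-zeroʳ (+ q) | ℤ.+-identityʳ (+ (label x + 1)) = cong +_ (+-comm 1 (label x))
    ... | inj₂ (eq , e) | yes _ rewrite label-A s | e | ℤ.*-identityʳ (+ q) | +-comm (label x) 1 | eq = sym (ℤ.+-inverseʳ (+ q))
    ... | inj₂ (eq , e) | no ≢q = contradiction eq ≢q

    -- The cases are which of the two labels wraps to 0. The order of the labels flips exactly when
    -- one of them wraps and the other does not.
    b-A : ∀ {x y} → Small x → Small y → b (A x) (A y) ≡ b x y ℤ.+ (w y ℤ.- w x)
    b-A {x} {y} sx sy with %-suc-cases q (label<q x) | %-suc-cases q (label<q y)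
    ... | inj₁ (ltx , ex) | inj₁ (lty , ey)
      rewrite label-A sx | label-A sy | ex | ey
            | indicator-no (suc (label x) ≟ q) (<⇒≢ ltx) | indicator-no (suc (label y) ≟ q) (<⇒≢ lty)
            | ℤ.+-identityʳ (b x y)
      = cong +_ (≤-antisym (indicator-mono (suc (label y) <? suc (label x)) (label y <? label x) (λ { (s≤s lt) → lt }))
                           (indicator-mono (label y <? label x) (suc (label y) <? suc (label x)) s≤s))
    ... | inj₁ (ltx , ex) | inj₂ (eqy , ey)
      rewrite label-A sx | label-A sy | ex | ey
            | indicator-no (suc (label x) ≟ q) (<⇒≢ ltx) | indicator-yes (suc (label y) ≟ q) eqy
            | indicator-yes (0 <? suc (label x)) (s≤s z≤n)
            | indicator-no (label y <? label x) (λ lt → <-irrefl refl (<-≤-trans (s≤s lt) (subst (suc (label x) ≤_) (sym eqy) (<⇒≤ ltx))))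
      = refl
    ... | inj₂ (eqx , ex) | inj₁ (lty , ey)
      rewrite label-A sx | label-A sy | ex
            | indicator-yes (suc (label x) ≟ q) eqx | indicator-no (suc (label y) ≟ q) (<⇒≢ lty)
            | indicator-yes (label y <? label x) (≤-pred (subst (suc (suc (label y)) ≤_) (sym eqx) lty))
      = refl
    ... | inj₂ (eqx , ex) | inj₂ (eqy , ey)
      rewrite label-A sx | label-A sy | ex
            | indicator-yes (suc (label x) ≟ q) eqx | indicator-yes (suc (label y) ≟ q) eqy
            | indicator-no (label y <? label x) (<-irrefl (suc-injective (trans eqy (sym eqx))))
      = refl

    label-iter : ∀ i {x} → Small x → label (iter A i x) ≡ (label x + i) % q
    label-iter zero {x} s rewrite +-identityʳ (label x) = sym (m<n⇒m%n≡m (label<q x))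
    label-iter (suc i) {x} s = begin
      label (iter A i (A x)) ≡⟨ cong label (iter-comm A i x) ⟩
      label (A (iter A i x)) ≡⟨ label-A (small-iter i s) ⟩
      suc (label (iter A i x)) % q ≡⟨ cong (λ z → suc z % q) (label-iter i s) ⟩
      suc ((label x + i) % q) % q ≡⟨ suc-% (label x + i) q ⟩
      suc (label x + i) % q ≡⟨ cong (_% q) (sym (+-suc (label x) i)) ⟩
      (label x + suc i) % q ∎
      where
      open ≡-Reasoning
      small-iter : ∀ i {x} → Small x → Small (iter A i x)
      small-iter zero s = s
      small-iter (suc i) s = small-iter i (Small-A s)

    residue-sum : ∀ a → Σ< q (λ i → + ((a + i) % q)) ≡ Σ< q (λ i → + (i % q))
    residue-sum zero = refl
    residue-sum (suc a) = trans (Σ<-cong q (λ i → cong (λ z → + (z % q)) (sym (+-suc a i))))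
      (trans (Σ<-cycle q (λ i → + ((a + i) % q)) (cong +_ (trans ([m+n]%n≡m%n a q) (cong (_% q) (sym (+-identityʳ a))))))
             (residue-sum a))

    -- Along an orbit the label meets every residue once.
    g-sum : ∀ {x y} → Small x → Small y → Σ< q (λ i → g (iter A i x)) ≡ Σ< q (λ i → g (iter A i y))
    g-sum {x} {y} sx sy = trans (value sx) (sym (value sy))
      where
      value : ∀ {x} → Small x → Σ< q (λ i → g (iter A i x)) ≡ Σ< q (λ i → + (i % q))
      value {x} s = trans (Σ<-cong q (λ i → cong +_ (label-iter i s))) (residue-sum (label x))

-- Faces of the `q`-ary cube, their rotation and a coordinatewise contraction.

module Cube-Faces where

  open import Data.Nat using (ℕ; zero; suc; _+_; _≤_; _∸_; z≤n; s≤s; NonZero; _%_)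
  open import Data.Nat.Properties
  open import Data.Nat.DivMod using (_mod_; m%n<n; m<n⇒m%n≡m; [m+n]%n≡m%n)
  open import Data.Maybe using (Maybe; just; nothing)
  import Data.Maybe as Maybe
  import Data.Vec as Vec
  open import Data.List using (List; []; _∷_)
  import Data.List as List
  open import Data.List.Relation.Unary.All as All using (All; []; _∷_)
  import Data.List.Relation.Unary.All.Properties as All
  open import Data.List.Relation.Unary.AllPairs as AllPairs using (AllPairs; []; _∷_)
  import Data.List.Relation.Unary.AllPairs.Properties as AllPairs
  open Cochain-Calculus
  open Cyclic-Labels

  rotate : ∀ {q} .{{_ : NonZero q}} → Fin q → Fin q
  rotate {q} a = suc (toℕ a) mod q

  toℕ-mod : ∀ m q .{{_ : NonZero q}} → toℕ (m mod q) ≡ m % q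
  toℕ-mod m q = toℕ-fromℕ< (m%n<n m q)

  toℕ-rotate-iter : ∀ {q} .{{_ : NonZero q}} i (a : Fin q) → toℕ (iter rotate i a) ≡ (toℕ a + i) % q
  toℕ-rotate-iter {q} zero a = sym (trans (cong (_% q) (+-identityʳ (toℕ a))) (m<n⇒m%n≡m (toℕ<n a)))
  toℕ-rotate-iter {q} (suc i) a = begin
    toℕ (iter rotate i (rotate a)) ≡⟨ cong toℕ (iter-comm rotate i a) ⟩
    toℕ (rotate (iter rotate i a)) ≡⟨ toℕ-mod (suc (toℕ (iter rotate i a))) q ⟩
    suc (toℕ (iter rotate i a)) % q ≡⟨ cong (λ z → suc z % q) (toℕ-rotate-iter i a) ⟩
    suc ((toℕ a + i) % q) % q ≡⟨ suc-% (toℕ a + i) q ⟩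
    suc (toℕ a + i) % q ≡⟨ cong (_% q) (sym (+-suc (toℕ a) i)) ⟩
    (toℕ a + suc i) % q ∎
    where open ≡-Reasoning

  rotate-cyclic : ∀ {q} .{{_ : NonZero q}} (a : Fin q) → iter rotate q a ≡ a
  rotate-cyclic {q} a = toℕ-injective (trans (toℕ-rotate-iter q a)
    (trans ([m+n]%n≡m%n (toℕ a) q) (m<n⇒m%n≡m (toℕ<n a))))

  errors : ∀ {q n} .{{_ : NonZero q}} → Vec (Fin q) n → Vec (Fin q) n → ℕ
  errors [] [] = 0
  errors (a ∷ x) (b ∷ y) = (1 ∸ indicator (b F.≟ rotate a)) + errors x y

  -- `just a` is a fixed coordinate; `nothing` is a free one, ranging over all `q` letters.
  Face : ℕ → ℕ → Set
  Face q n = Vec (Maybe (Fin q)) n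

  module _ {q : ℕ} .{{_ : NonZero q}} where

    shift : ∀ {n} → Face q n → Face q n
    shift = Vec.map (Maybe.map rotate)

    shift-cyclic : ∀ {n} (x : Face q n) → iter shift q x ≡ x
    shift-cyclic x = trans (iter-map q x) (fixed x)
      where
      iter-map : ∀ {n} i (x : Face q n) → iter shift i x ≡ Vec.map (Maybe.map (iter rotate i)) x
      iter-map zero [] = refl
      iter-map zero (just a ∷ x) = cong (just a ∷_) (iter-map zero x)
      iter-map zero (nothing ∷ x) = cong (nothing ∷_) (iter-map zero x)
      iter-map (suc i) x = trans (iter-map i (shift x)) (compose x)
        where
        compose : ∀ {n} (x : Face q n) → Vec.map (Maybe.map (iter rotate i)) (shift x) ≡ Vec.map (Maybe.map (iter rotate (suc i))) x
        compose [] = refl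
        compose (just a ∷ x) = cong (_ ∷_) (compose x)
        compose (nothing ∷ x) = cong (_ ∷_) (compose x)
      fixed : ∀ {n} (x : Face q n) → Vec.map (Maybe.map (iter rotate q)) x ≡ x
      fixed [] = refl
      fixed (just a ∷ x) = cong₂ _∷_ (cong just (rotate-cyclic a)) (fixed x)
      fixed (nothing ∷ x) = cong (_ ∷_) (fixed x)

    data _⊑_ : ∀ {n} → Face q n → Face q n → Set where
      []   : [] ⊑ []
      same : ∀ {n a} {x y : Face q n} → x ⊑ y → (a ∷ x) ⊑ (a ∷ y)
      star : ∀ {n a} {x y : Face q n} → x ⊑ y → (a ∷ x) ⊑ (nothing ∷ y)

    ⊑-refl : ∀ {n} {x : Face q n} → x ⊑ x
    ⊑-refl {x = []} = []
    ⊑-refl {x = a ∷ x} = same ⊑-refl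

    ⊑-trans : ∀ {n} {x y z : Face q n} → x ⊑ y → y ⊑ z → x ⊑ z
    ⊑-trans [] [] = []
    ⊑-trans (same p) (same r) = same (⊑-trans p r)
    ⊑-trans (same p) (star r) = star (⊑-trans p r)
    ⊑-trans (star p) (same r) = star (⊑-trans p r)
    ⊑-trans (star p) (star r) = star (⊑-trans p r)

    shift-mono : ∀ {n} {x y : Face q n} → x ⊑ y → shift x ⊑ shift y
    shift-mono [] = []
    shift-mono (same p) = same (shift-mono p)
    shift-mono (star p) = star (shift-mono p)

    iter-mono : ∀ {n} i {x y : Face q n} → x ⊑ y → iter shift i x ⊑ iter shift i y
    iter-mono zero p = p
    iter-mono (suc i) p = iter-mono i (shift-mono p)

    stars : ∀ {n} → Face q n → ℕ
    stars [] = 0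
    stars (just _ ∷ x) = stars x
    stars (nothing ∷ x) = suc (stars x)

    stars-shift : ∀ {n} (x : Face q n) → stars (shift x) ≡ stars x
    stars-shift [] = refl
    stars-shift (just _ ∷ x) = stars-shift x
    stars-shift (nothing ∷ x) = cong suc (stars-shift x)

    -- Together with `open-up` this is the contracting zigzag: coordinate `s` is first freed and
    -- then fixed at 0, so that at most one free coordinate is added at any time.
    collapse : ∀ {n} → ℕ → Face q n → Face q n
    collapse zero x = x
    collapse (suc s) [] = []
    collapse (suc s) (_ ∷ x) = just (0 mod q) ∷ collapse s x

    open-up : ∀ {n} → ℕ → Face q n → Face q n
    open-up s [] = []
    open-up zero (_ ∷ x) = nothing ∷ x
    open-up (suc s) (_ ∷ x) = just (0 mod q) ∷ open-up s x

    collapse-const : ∀ {n} (x y : Face q n) → collapse n x ≡ collapse n y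
    collapse-const [] [] = refl
    collapse-const (_ ∷ x) (_ ∷ y) = cong (_ ∷_) (collapse-const x y)

    collapse-mono : ∀ {n} s {x y : Face q n} → x ⊑ y → collapse s x ⊑ collapse s y
    collapse-mono zero p = p
    collapse-mono (suc s) [] = []
    collapse-mono (suc s) (same p) = same (collapse-mono s p)
    collapse-mono (suc s) (star p) = same (collapse-mono s p)

    open-up-mono : ∀ {n} s {x y : Face q n} → x ⊑ y → open-up s x ⊑ open-up s y
    open-up-mono s [] = []
    open-up-mono zero (same p) = same p
    open-up-mono zero (star p) = same p
    open-up-mono (suc s) (same p) = same (open-up-mono s p)
    open-up-mono (suc s) (star p) = same (open-up-mono s p)

    collapse⊑open-up : ∀ {n} s (x : Face q n) → collapse s x ⊑ open-up s x
    collapse⊑open-up zero [] = []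
    collapse⊑open-up (suc s) [] = []
    collapse⊑open-up zero (a ∷ x) = star ⊑-refl
    collapse⊑open-up (suc s) (a ∷ x) = same (collapse⊑open-up s x)

    collapse-suc⊑open-up : ∀ {n} s (x : Face q n) → collapse (suc s) x ⊑ open-up s x
    collapse-suc⊑open-up s [] = []
    collapse-suc⊑open-up zero (a ∷ x) = star ⊑-refl
    collapse-suc⊑open-up (suc s) (a ∷ x) = same (collapse-suc⊑open-up s x)

    stars≤ : ∀ {n} a (x : Face q n) → stars x ≤ stars (a ∷ x)
    stars≤ (just _) x = ≤-refl
    stars≤ nothing x = n≤1+n _

    stars-collapse : ∀ {n} s (x : Face q n) → stars (collapse s x) ≤ suc (stars x)
    stars-collapse zero x = n≤1+n _
    stars-collapse (suc s) [] = z≤n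
    stars-collapse (suc s) (a ∷ x) = ≤-trans (stars-collapse s x) (s≤s (stars≤ a x))

    stars-open-up : ∀ {n} s (x : Face q n) → stars (open-up s x) ≤ suc (stars x)
    stars-open-up s [] = z≤n
    stars-open-up zero (a ∷ x) = s≤s (stars≤ a x)
    stars-open-up (suc s) (a ∷ x) = ≤-trans (stars-open-up s x) (s≤s (stars≤ a x))

    Flag : ∀ {n} → ℕ → List (Face q n) → Set
    Flag k l = All (λ x → stars x ≤ k) l × AllPairs _⊑_ l

    Flag-shift : ∀ {n k} {l : List (Face q n)} → Flag k l → Flag k (List.map shift l)
    Flag-shift (s , p) = All.map⁺ (All.map (λ {x} le → subst (_≤ _) (sym (stars-shift x)) le) s)
                       , AllPairs.map⁺ (AllPairs.map shift-mono p)

    module _ {n} {v w : Face q n → Face q n} (v-mono : ∀ {x y} → x ⊑ y → v x ⊑ v y) (w-mono : ∀ {x y} → x ⊑ y → w x ⊑ w y)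
      (v⊑w : ∀ x → v x ⊑ w x) (v-stars : ∀ x → stars (v x) ≤ suc (stars x)) (w-stars : ∀ x → stars (w x) ≤ suc (stars x)) where

      open Cochains {Face q n} using (PrismFace; here; there)

      Flag-prism-stars : ∀ {k l l′} → All (λ x → stars x ≤ k) l → PrismFace v w l l′ → All (λ x → stars x ≤ suc k) l′
      Flag-prism-stars (s ∷ ss) here = ≤-trans (v-stars _) (s≤s s) ∷ ≤-trans (w-stars _) (s≤s s)
        ∷ All.map⁺ (All.map (λ le → ≤-trans (w-stars _) (s≤s le)) ss)
      Flag-prism-stars (s ∷ ss) (there f) = ≤-trans (v-stars _) (s≤s s) ∷ Flag-prism-stars ss f

      prism-above : ∀ {x l l′} → All (x ⊑_) l → PrismFace v w l l′ → All (v x ⊑_) l′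
      prism-above (p ∷ ps) here = v-mono p ∷ ⊑-trans (v-mono p) (v⊑w _) ∷ All.map⁺ (All.map (λ r → ⊑-trans (v-mono r) (v⊑w _)) ps)
      prism-above (p ∷ ps) (there f) = v-mono p ∷ prism-above ps f

      Flag-prism-chain : ∀ {l l′} → AllPairs _⊑_ l → PrismFace v w l l′ → AllPairs _⊑_ l′
      Flag-prism-chain (p ∷ ps) here = (v⊑w _ ∷ All.map⁺ (All.map (λ r → ⊑-trans (v⊑w _) (w-mono r)) p))
        ∷ All.map⁺ (All.map w-mono p) ∷ AllPairs.map⁺ (AllPairs.map w-mono ps)
      Flag-prism-chain (p ∷ ps) (there f) = prism-above p f ∷ Flag-prism-chain ps f

      Flag-prism : ∀ {k l l′} → Flag k l → PrismFace v w l l′ → Flag (suc k) l′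
      Flag-prism (s , p) f = Flag-prism-stars s f , Flag-prism-chain p f

    vertex : ∀ {n} → Vec (Fin q) n → Face q n
    vertex = Vec.map just

    stars-vertex : ∀ {n} (z : Vec (Fin q) n) → stars (vertex z) ≡ 0
    stars-vertex [] = refl
    stars-vertex (a ∷ z) = stars-vertex z

    some-vertex : ∀ {n} (x : Face q n) → ∃ λ z → vertex z ⊑ x
    some-vertex [] = [] , []
    some-vertex (just a ∷ x) with some-vertex x
    ... | z , p = a ∷ z , same p
    some-vertex (nothing ∷ x) with some-vertex x
    ... | z , p = 0 mod q ∷ z , star p

    any-vertex? : ∀ {n} (Q : Vec (Fin q) n → Set) → (∀ z → Dec (Q z)) → ∀ x → Dec (∃ λ z → vertex z ⊑ x × Q z)
    any-vertex? Q Q? [] with Q? []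
    ... | yes p = yes ([] , [] , p)
    ... | no ¬p = no λ { ([] , [] , p) → ¬p p }
    any-vertex? Q Q? (just a ∷ x) with any-vertex? (Q ∘ (a ∷_)) (λ z → Q? (a ∷ z)) x
    ... | yes (z , le , p) = yes (a ∷ z , same le , p)
    ... | no ¬p = no λ { (b ∷ z , same le , p) → ¬p (z , le , p) }
    any-vertex? Q Q? (nothing ∷ x) with any? (λ a → any-vertex? (Q ∘ (a ∷_)) (λ z → Q? (a ∷ z)) x)
    ... | yes (a , z , le , p) = yes (a ∷ z , star le , p)
    ... | no ¬p = no λ { (b ∷ z , star le , p) → ¬p (b , z , le , p) }

    -- At the fixed coordinates of `x` the two vertices are exactly one rotation apart, so only free
    -- coordinates can cost an error.
    errors-shift : ∀ {n} {x : Face q n} {z z′} → vertex z ⊑ x → vertex z′ ⊑ shift x → errors z z′ ≤ stars x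
    errors-shift {x = []} {[]} {[]} p r = z≤n
    errors-shift {x = just a ∷ x} {_ ∷ z} {b ∷ z′} (same p) (same r)
      rewrite indicator-yes (rotate a F.≟ rotate a) refl = errors-shift p r
    errors-shift {x = nothing ∷ x} {a ∷ z} {b ∷ z′} (star p) (star r) =
      +-mono-≤ (m∸n≤m 1 (indicator (b F.≟ rotate a))) (errors-shift p r)

-- Equivariant labels of faces obtained from a colouring.

module Colour-Labels where

  open import Data.Nat using (ℕ; zero; suc; _+_; _*_; _≤_; _<_; _∸_; z≤n; s≤s; NonZero; _%_; _≟_)
  open import Data.Nat.Properties
  open import Data.Nat.DivMod using (m%n<n; [m+kn]%n≡m%n)
  open import Data.Nat.Coprimality using (prime⇒coprime; coprime-Bézout; Coprime)
  import Data.Nat.Coprimality as Coprimality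
  open import Data.Nat.GCD using (module Bézout)
  open import Data.Nat.Primality using (Prime; prime⇒nonZero; prime⇒nonTrivial)
  open import Data.Nat.Tactic.RingSolver using (solve-∀)
  open Cochain-Calculus
  open Cyclic-Labels
  open Cube-Faces
  open import Algebra.Properties.Semiring.Sum +-*-semiring using (sum)

  sum-mono : ∀ {k} {f g : Fin k → ℕ} → (∀ i → f i ≤ g i) → sum f ≤ sum g
  sum-mono {zero} le = z≤n
  sum-mono {suc k} le = +-mono-≤ (le F.zero) (sum-mono (le ∘ F.suc))

  sum-tight : ∀ {k} {f g : Fin k → ℕ} → (∀ i → f i ≤ g i) → sum f ≡ sum g → ∀ i → f i ≡ g i
  sum-tight {suc k} le e i with +-tight (le F.zero) (sum-mono (le ∘ F.suc)) e
  sum-tight {suc k} le e F.zero | e₁ , _ = e₁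
  sum-tight {suc k} le e (F.suc i) | _ , e₂ = sum-tight (le ∘ F.suc) e₂ i

  sum-bound : ∀ {k} b {f : Fin k → ℕ} → (∀ i → f i ≤ b) → sum f ≤ k * b
  sum-bound {zero} b le = z≤n
  sum-bound {suc k} b le = +-mono-≤ (le F.zero) (sum-bound b (le ∘ F.suc))

  module Labels (q : ℕ) (q-prime : Prime q) where

    instance
      q≢0 : NonZero q
      q≢0 = prime⇒nonZero q-prime

    1<q : 1 < q
    1<q = Data.Nat.nonTrivial⇒n>1 q {{prime⇒nonTrivial q-prime}}

    -- An inverse of -N modulo q, with junk value 0 when N is not coprime to q.
    negInv : ℕ → ℕ
    negInv N with Coprimality.coprime? q N
    ... | no _ = 0
    ... | yes c with coprime-Bézout {q} {N} (λ {d} → c {d})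
    ... | Bézout.+- x y eq = y
    ... | Bézout.-+ x y eq = y * (q ∸ 1)

    negInv-spec : ∀ N → Coprime q N → ∃ λ z → suc (N * negInv N) ≡ z * q
    negInv-spec N c with Coprimality.coprime? q N
    ... | no ¬c = ⊥-elim (¬c (λ {d} → c {d}))
    ... | yes c′ with coprime-Bézout {q} {N} (λ {d} → c′ {d})
    ... | Bézout.+- x y eq = x , trans (cong suc (*-comm N y)) eq
    -- In this case `y` inverts `N` itself, and the factor `q ∸ 1` supplies the sign.
    ... | Bézout.-+ x y eq = 1 + x * (q ∸ 1) , (begin
      suc (N * (y * (q ∸ 1))) ≡⟨ cong suc (sym (*-assoc N y (q ∸ 1))) ⟩
      suc (N * y * (q ∸ 1)) ≡⟨ cong (λ t → suc (t * (q ∸ 1))) (trans (*-comm N y) (sym eq)) ⟩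
      suc ((1 + x * q) * (q ∸ 1)) ≡⟨ lemma x q (q ∸ 1) ⟩
      suc (q ∸ 1) + x * (q ∸ 1) * q ≡⟨ cong (_+ x * (q ∸ 1) * q) (m+[n∸m]≡n (<⇒≤ 1<q)) ⟩
      q + x * (q ∸ 1) * q ∎)
      where
      open ≡-Reasoning
      lemma : ∀ x q r → suc ((1 + x * q) * r) ≡ suc r + x * r * q
      lemma = solve-∀

    -- Minus the mean position, modulo q, of the first colour that occurs at all: N counts the positions
    -- of each colour and S adds them up, so that a rotation by one changes the phase by one.
    phase : ∀ {k} → (Fin k → ℕ) → (Fin k → ℕ) → ℕ
    phase {zero} N S = 0
    phase {suc k} N S with N F.zero ≟ 0
    ... | yes _ = phase (N ∘ F.suc) (S ∘ F.suc)
    ... | no _ = (S F.zero * negInv (N F.zero)) % q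

    phase<q : ∀ {k} (N S : Fin k → ℕ) → phase N S < q
    phase<q {zero} N S = <-trans (s≤s z≤n) 1<q
    phase<q {suc k} N S with N F.zero ≟ 0
    ... | yes _ = phase<q (N ∘ F.suc) (S ∘ F.suc)
    ... | no _ = m%n<n _ q

    phase-cong : ∀ {k} {N N′ S S′ : Fin k → ℕ} → (∀ v → N v ≡ N′ v) → (∀ v → S v ≡ S′ v) → phase N S ≡ phase N′ S′
    phase-cong {zero} e e′ = refl
    phase-cong {suc k} {N} {N′} e e′ with N F.zero ≟ 0 | N′ F.zero ≟ 0
    ... | yes _ | yes _ = phase-cong (e ∘ F.suc) (e′ ∘ F.suc)
    ... | yes p | no ¬p = contradiction (trans (sym (e F.zero)) p) ¬p
    ... | no ¬p | yes p = contradiction (trans (e F.zero) p) ¬p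
    ... | no _ | no _ = cong₂ (λ s t → (s * negInv t) % q) (e′ F.zero) (e F.zero)

    -- Modulo `q` the hypotheses say `S′ = S - N`, whence `- S′ / N = - S / N + 1`; the first colour
    -- that occurs is the same on both sides.
    phase-shift : ∀ {k} {N N′ S S′ H : Fin k → ℕ} → (∀ v → N′ v ≡ N v) → (∀ v → S′ v + N v ≡ S v + q * H v)
      → (∀ v → N v ≢ 0 → Coprime q (N v)) → (∃ λ v → N v ≢ 0) → phase N′ S′ ≡ suc (phase N S) % q
    phase-shift {zero} _ _ _ (() , _)
    phase-shift {suc k} {N} {N′} {S} {S′} {H} e e′ cop (v , Nv≢0) with N F.zero ≟ 0 | N′ F.zero ≟ 0
    ... | yes p | no ¬p = contradiction (trans (e F.zero) p) ¬p
    ... | no ¬p | yes p = contradiction (trans (sym (e F.zero)) p) ¬p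
    phase-shift {suc k} e e′ cop (F.zero , Nv≢0) | yes p | yes _ = contradiction p Nv≢0
    phase-shift {suc k} e e′ cop (F.suc v , Nv≢0) | yes p | yes _ =
      phase-shift (e ∘ F.suc) (e′ ∘ F.suc) (cop ∘ F.suc) (v , Nv≢0)
    phase-shift {suc k} {N} {N′} {S} {S′} {H} e e′ cop _ | no ¬p | no _ rewrite e F.zero
      with negInv-spec (N F.zero) (cop F.zero ¬p)
    ... | z , eq = begin
      (s′ * i) % q ≡⟨ sym ([m+kn]%n≡m%n (s′ * i) z q) ⟩
      (s′ * i + z * q) % q ≡⟨ cong (λ t → (s′ * i + t) % q) (sym eq) ⟩
      (s′ * i + suc (N₀ * i)) % q ≡⟨ cong (_% q) (lemma s′ N₀ i) ⟩
      suc ((s′ + N₀) * i) % q ≡⟨ cong (λ t → suc (t * i) % q) (e′ F.zero) ⟩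
      suc ((s + q * H F.zero) * i) % q ≡⟨ cong (_% q) (lemma′ s q (H F.zero) i) ⟩
      (suc (s * i) + H F.zero * i * q) % q ≡⟨ [m+kn]%n≡m%n (suc (s * i)) (H F.zero * i) q ⟩
      suc (s * i) % q ≡⟨ sym (suc-% (s * i) q) ⟩
      suc ((s * i) % q) % q ∎
      where
      open ≡-Reasoning
      s = S F.zero
      s′ = S′ F.zero
      N₀ = N F.zero
      i = negInv N₀
      lemma : ∀ s n i → s * i + suc (n * i) ≡ suc ((s + n) * i)
      lemma = solve-∀
      lemma′ : ∀ s q h i → suc ((s + q * h) * i) ≡ suc (s * i) + h * i * q
      lemma′ = solve-∀

    module _ {n M : ℕ} (κ : Vec (Fin q) n → Fin M) where

      present? : ∀ v (x : Face q n) → Dec (∃ λ z → vertex z ⊑ x × κ z ≡ v)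
      present? v = any-vertex? (λ z → κ z ≡ v) (λ z → κ z F.≟ v)

      present : Fin M → Face q n → ℕ
      present v x = indicator (present? v x)

      present-mono : ∀ v {x y : Face q n} → x ⊑ y → present v x ≤ present v y
      present-mono v p = indicator-mono (present? v _) (present? v _) (λ { (z , r , e) → z , ⊑-trans r p , e })

      multiplicity moment : Fin M → Face q n → ℕ
      multiplicity v x = Σℕ q (λ j → present v (iter shift j x))
      moment v x = Σℕ q (λ j → j * present v (iter shift j x))

      label : Face q n → ℕ
      label x = phase (λ v → multiplicity v x) (λ v → moment v x)

      rank : Face q n → ℕ
      rank x = sum (λ v → multiplicity v x)

      multiplicity-mono : ∀ v {x y : Face q n} → x ⊑ y → multiplicity v x ≤ multiplicity v y
      multiplicity-mono v p = Σℕ-mono q (λ j → present-mono v (iter-mono j p))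

      rank-mono : ∀ {x y : Face q n} → x ⊑ y → rank x ≤ rank y
      rank-mono p = sum-mono (λ v → multiplicity-mono v p)

      rank-bound : ∀ x → rank x ≤ M * q
      rank-bound x = sum-bound q (λ v → ≤-trans (Σℕ-bound q 1 _ (λ j → indicator≤1 (present? v _))) (≤-reflexive (*-identityʳ q)))

      -- The rank counts the pairs of a colour and a rotate of the face on which it occurs. For
      -- nested faces these sets of pairs are nested, so equal rank means equal sets, and the label
      -- depends on the set alone. As the rank is monotone and bounded, labels change boundedly
      -- often along a flag.
      rank-label : ∀ {x y : Face q n} → x ⊑ y → rank x ≡ rank y → label x ≡ label y
      rank-label {x} {y} p e = phase-cong mult
        (λ v → Σℕ-cong q (λ {j} j<q → cong (j *_) (Σℕ-tight q (λ j → present-mono v (iter-mono j p)) (mult v) j<q)))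
        where
        mult : ∀ v → multiplicity v x ≡ multiplicity v y
        mult = sum-tight (λ v → multiplicity-mono v p) e

      multiplicity-shift : ∀ v x → multiplicity v (shift x) ≡ multiplicity v x
      multiplicity-shift v x = Σℕ-cycle q (λ j → present v (iter shift j x)) (cong (present v) (shift-cyclic x))

      -- Rotating the face lowers every position by one, except that position 0 becomes `q - 1`; the
      -- last term corrects for this.
      moment-shift : ∀ v x → moment v (shift x) + multiplicity v x ≡ moment v x + q * present v x
      moment-shift v x = begin
        Σℕ q (λ j → j * P (suc j)) + Σℕ q P ≡⟨ cong (_+_ (Σℕ q (λ j → j * P (suc j)))) (sym (multiplicity-shift v x)) ⟩
        Σℕ q (λ j → j * P (suc j)) + Σℕ q (P ∘ suc) ≡⟨ sym (Σℕ-+ q _ _) ⟩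
        Σℕ q (λ j → j * P (suc j) + P (suc j)) ≡⟨ Σℕ-cong q (λ {j} _ → +-comm (j * P (suc j)) (P (suc j))) ⟩
        Σℕ q (λ j → suc j * P (suc j)) ≡⟨ sym (+-identityʳ _) ⟩
        Σℕ q (λ j → suc j * P (suc j)) + 0 * P 0 ≡⟨ Σℕ-shift q (λ j → j * P j) ⟩
        Σℕ q (λ j → j * P j) + q * P q ≡⟨ cong (λ t → Σℕ q (λ j → j * P j) + q * present v t) (shift-cyclic x) ⟩
        Σℕ q (λ j → j * P j) + q * present v x ∎
        where
        open ≡-Reasoning
        P : ℕ → ℕ
        P j = present v (iter shift j x)

      module _ (m : ℕ) (proper : ∀ (x y : Vec (Fin q) n) → errors x y ≤ m → κ x ≢ κ y) where

        Small : Face q n → Set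
        Small x = stars x ≤ m

        Small-shift : ∀ {x} → Small x → Small (shift x)
        Small-shift {x} s = subst (_≤ m) (sym (stars-shift x)) s

        -- If `v` occurred both on the face and on its first rotate, two vertices of colour `v`
        -- would be a rotation apart up to `m` errors. So one of these two positions is missing, and
        -- a nonzero multiplicity is coprime to `q`.
        multiplicity<q : ∀ v {x} → Small x → multiplicity v x < q
        multiplicity<q v {x} s with present? v x in eq
        ... | no ¬p = Σℕ-gap q _ (λ j → indicator≤1 (present? v _)) (<-trans (s≤s z≤n) 1<q) (indicator-no (present? v x) ¬p)
        ... | yes (z , p , e) = Σℕ-gap q _ (λ j → indicator≤1 (present? v _)) 1<q
          (indicator-no (present? v (shift x)) λ { (z′ , p′ , e′) → proper z z′ (≤-trans (errors-shift p p′) s) (trans e (sym e′)) })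

        label-shift : ∀ {x} → Small x → label (shift x) ≡ suc (label x) % q
        label-shift {x} s = phase-shift (λ v → multiplicity-shift v x) (λ v → moment-shift v x) coprime (κ z , nonzero)
          where
          z = proj₁ (some-vertex x)
          nonzero : multiplicity (κ z) x ≢ 0
          nonzero e = 1+n≰n (subst (1 ≤_) e (subst (_≤ multiplicity (κ z) x)
            (indicator-yes (present? (κ z) x) (z , proj₂ (some-vertex x) , refl))
            (Σℕ-term q _ (<-trans (s≤s z≤n) 1<q))))
          coprime : ∀ v → multiplicity v x ≢ 0 → Coprime q (multiplicity v x)
          coprime v ≢0 = prime⇒coprime q-prime {{Data.Nat.≢-nonZero ≢0}} (multiplicity<q v s)

-- Cup powers vanish on flags although their value is 1 modulo `q`.

module Index-Obstruction where

  open import Data.Nat using (ℕ; zero; suc; _+_; _≤_; _<_; NonZero; _%_; _≟_; _<?_)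
  open import Data.Nat.Properties
  open import Data.Integer using (ℤ; +_; 0ℤ; 1ℤ; -1ℤ)
  import Data.Integer as ℤ
  import Data.Integer.Properties as ℤ
  open import Data.List using (List; []; _∷_; length)
  import Data.List as List
  open import Data.List.Relation.Unary.All using (All; []; _∷_)
  open import Data.List.Relation.Unary.AllPairs using (AllPairs; []; _∷_)
  open Cochain-Calculus
  open Equivariant-Functionals
  open Cyclic-Labels
  import Data.Integer.Tactic.RingSolver as ℤSolver

  1+qz≢0 : ∀ {q} → 1 < q → ∀ z → 1ℤ ℤ.+ + q ℤ.* z ≢ 0ℤ
  1+qz≢0 {q} 1<q z e = <-irrefl (sym q≡1) 1<q
    where
    lemma : ∀ a → a ≡ (1ℤ ℤ.+ a) ℤ.- 1ℤ
    lemma = ℤSolver.solve-∀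
    qz≡-1 : + q ℤ.* z ≡ -1ℤ
    qz≡-1 = trans (lemma (+ q ℤ.* z)) (cong (ℤ._- 1ℤ) e)
    q≡1 : q ≡ 1
    q≡1 = m*n≡1⇒m≡1 q ℤ.∣ z ∣ (trans (sym (ℤ.abs-* (+ q) z)) (cong ℤ.∣_∣ qz≡-1))

  module Obstruction {P : Set} (A : P → P) (q : ℕ) .{{_ : NonZero q}} (1<q : 1 < q) (A-cyclic : ∀ x → iter A q x ≡ x)
    (n : ℕ) (c u : ℕ → P → P) (c-zero : ∀ x → c 0 x ≡ x) (c-const : ∀ x y → c n x ≡ c n y) (o : P)
    (Good : ℕ → List P → Set)
    (Good-A : ∀ {k l} → Good k l → Good k (List.map A l))
    (Good-here : ∀ {k l l′} s → Good k l → Cochains.PrismFace (c s) (u s) l l′ → Good (suc k) l′)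
    (Good-there : ∀ {k l l′} s → Good k l → Cochains.PrismFace (c (suc s)) (u s) l l′ → Good (suc k) l′)
    (Good-o : Good 0 (o ∷ []))
    (m : ℕ) (Small : P → Set) (Small-A : ∀ {x} → Small x → Small (A x))
    (Good-small : ∀ {j l} → j ≤ m → Good j l → All Small l)
    (label : P → ℕ) (label<q : ∀ x → label x < q) (label-A : ∀ {x} → Small x → label (A x) ≡ suc (label x) % q)
    (_≼_ : P → P → Set) (Good-chain : ∀ {j l} → Good j l → AllPairs _≼_ l)
    (rank : P → ℕ) (bound : ℕ) (rank≤ : ∀ x → rank x ≤ bound)
    (rank-mono : ∀ {x y} → x ≼ y → rank x ≤ rank y)
    (rank-label : ∀ {x y} → x ≼ y → rank x ≡ rank y → label x ≡ label y)
    (dim≤m : dbl (suc bound) ≤ m)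
    where

    open Equivariant A q A-cyclic n c u c-zero c-const o Good Good-A Good-here Good-there Good-o
    open CyclicLabel A q Small Small-A label label<q label-A
    open CupPower b
    open Value m Small Small-A Good-small g w g-A b-A g-sum

    b-cong : ∀ {x y} z → label x ≡ label y → b x z ≡ b y z
    b-cong z e = cong (λ t → + indicator (label z <? t)) e

    b-equal : ∀ {x y} → label x ≡ label y → b x y ≡ 0ℤ
    b-equal {x} {y} e = cong +_ (indicator-no (label y <? label x) (<-irrefl (sym e)))

    -- Each factor uses two steps of the flag. If the rank stays the same from `x` to `y`, their
    -- labels agree and `δ b` is 0 on `x, y, z`; otherwise the rank has grown by at least one, which
    -- can happen at most `bound` times.
    power-vanishes : ∀ d {x l} → AllPairs _≼_ (x ∷ l) → length l ≡ dbl d → bound < rank x + d → power d (x ∷ l) ≡ 0ℤ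
    power-vanishes zero {x} _ _ lt = contradiction (subst (bound <_) (+-identityʳ (rank x)) lt) (≤⇒≯ (rank≤ x))
    power-vanishes (suc d) {x} {y ∷ z ∷ l} ((x≼y ∷ _) ∷ (y≼z ∷ _) ∷ chain) len lt =
      trans (power-suc d x y z l) (factor (rank x ≟ rank y))
      where
      cancel : ∀ a → (0ℤ ℤ.+ a) ℤ.- a ≡ 0ℤ
      cancel = ℤSolver.solve-∀
      factor : Dec (rank x ≡ rank y) → ((b x y ℤ.+ b y z) ℤ.- b x z) ℤ.* power d (z ∷ l) ≡ 0ℤ
      factor (yes e) = cong (ℤ._* power d (z ∷ l)) (trans
        (cong₂ (λ s t → (s ℤ.+ b y z) ℤ.- t) (b-equal (rank-label x≼y e)) (b-cong z (rank-label x≼y e)))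
        (cancel (b y z)))
      factor (no ≢) = trans
        (cong (ℤ._*_ ((b x y ℤ.+ b y z) ℤ.- b x z)) (power-vanishes d {z} {l} chain (suc-injective (suc-injective len))
          (<-≤-trans lt (≤-trans (≤-reflexive (+-suc (rank x) d))
            (+-monoˡ-≤ d (≤-trans (≤∧≢⇒< (rank-mono x≼y) ≢) (rank-mono y≼z)))))))
        (ℤ.*-zeroʳ ((b x y ℤ.+ b y z) ℤ.- b x z))

    value≡0 : ⟪ even (suc bound) ⟫ (power (suc bound)) ≡ 0ℤ
    value≡0 = trans (agree (even (suc bound)) {power (suc bound)} {λ _ → 0ℤ}
      λ { (x ∷ l) good len → power-vanishes (suc bound) (Good-chain good) (suc-injective len) (m≤n+m (suc bound) (rank x)) })
      (zeroF (even (suc bound)))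

    impossible : ⊥
    impossible = 1+qz≢0 1<q (proj₁ value) (trans (sym (proj₂ value)) value≡0)
      where
      value : ∃ λ z → ⟪ even (suc bound) ⟫ (power (suc bound)) ≡ 1ℤ ℤ.+ + q ℤ.* z
      value = power-value (suc bound) dim≤m

-- No colouring of words separates all approximate rotations.

module Near-Antipodal-Colourings where

  open import Data.Nat using (ℕ; suc; _*_; _≤_)
  open import Data.Nat.Properties
  open import Data.Nat.DivMod using (_mod_)
  open import Data.Nat.Primality using (Prime)
  open import Data.List using ([]; _∷_)
  open import Data.List.Relation.Unary.All as All using ([]; _∷_)
  open import Data.List.Relation.Unary.AllPairs using ([]; _∷_)
  open Cochain-Calculus
  open Cube-Faces
  open Colour-Labels
  open Index-Obstruction

  module _ (q : ℕ) (q-prime : Prime q) {n M : ℕ} (κ : Vec (Fin q) n → Fin M) where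

    open Labels q q-prime

    -- The contradiction arises in dimension `2 * (bound + 1)` for the rank bound `M * q`; faces in
    -- its flags have up to that many free coordinates, each of which may cost one error.
    tolerance : ℕ
    tolerance = dbl (suc (M * q))

    not-proper : ¬ (∀ (x y : Vec (Fin q) n) → errors x y ≤ tolerance → κ x ≢ κ y)
    not-proper proper = Obstruction.impossible shift q 1<q shift-cyclic n collapse open-up (λ _ → refl) collapse-const
      (vertex (replicate n (0 mod q))) Flag Flag-shift
      (λ s → Flag-prism (collapse-mono s) (open-up-mono s) (collapse⊑open-up s) (stars-collapse s) (stars-open-up s))
      (λ s → Flag-prism (collapse-mono (suc s)) (open-up-mono s) (collapse-suc⊑open-up s) (stars-collapse (suc s)) (stars-open-up s))
      ((≤-reflexive (stars-vertex (replicate n (0 mod q))) ∷ []) , ([] ∷ []))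
      tolerance (Small κ tolerance proper) (λ {x} → Small-shift κ tolerance proper {x})
      (λ le fl → All.map (λ s → ≤-trans s le) (proj₁ fl))
      (label κ) (λ x → phase<q (λ v → multiplicity κ v x) (λ v → moment κ v x)) (λ {x} → label-shift κ tolerance proper {x})
      _⊑_ proj₂ (rank κ) (M * q) (rank-bound κ) (rank-mono κ) (rank-label κ) ≤-refl

-- Words in which the letter 0 leads by a margin.

module Leading-Letters where

  open import Data.Nat using (ℕ; zero; suc; _+_; _*_; _^_; _≤_; _∸_; ∣_-_∣; z≤n; s≤s; NonZero; _≤?_)
  open import Data.Nat.Properties
  open import Data.Nat.Tactic.RingSolver using (solve-∀)
  import Data.Fin.Permutation as Perm
  open Perm using (Permutation′; _⟨$⟩ʳ_; _⟨$⟩ˡ_)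
  import Data.Vec as Vec
  open import Algebra.Properties.Semiring.Sum +-*-semiring using (sum; sum-cong-≗; ∑-distrib-+; ∑-comm; sum-permute; *-distribˡ-sum)
  open Cyclic-Labels
  open Colour-Labels using (sum-mono; sum-bound)

  sum-const : ∀ k a → sum {k} (λ _ → a) ≡ k * a
  sum-const zero a = refl
  sum-const (suc k) a = cong (_+_ a) (sum-const k a)

  argmax : ∀ {k} (f : Fin (suc k) → ℕ) → ∃ λ v → ∀ s → f s ≤ f v
  argmax {zero} f = F.zero , λ { F.zero → ≤-refl }
  argmax {suc k} f with argmax (f ∘ F.suc)
  ... | v , max with ≤-total (f F.zero) (f (F.suc v))
  ... | inj₁ le = F.suc v , λ { F.zero → le ; (F.suc s) → max s }
  ... | inj₂ ge = F.zero , λ { F.zero → ≤-refl ; (F.suc s) → ≤-trans (max s) ge }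

  sum-term : ∀ {k} (f : Fin k → ℕ) i → f i ≤ sum f
  sum-term f F.zero = m≤m+n _ _
  sum-term f (F.suc i) = ≤-trans (sum-term (f ∘ F.suc) i) (m≤n+m _ _)

  module Words (r : ℕ) where

    q : ℕ
    q = suc r

    Word : ℕ → Set
    Word = Vec (Fin q)

    𝕊 : (n : ℕ) → (Word n → ℕ) → ℕ
    𝕊 zero f = f []
    𝕊 (suc n) f = sum (λ a → 𝕊 n (λ x → f (a ∷ x)))

    𝕊-cong : ∀ n {f g : Word n → ℕ} → (∀ x → f x ≡ g x) → 𝕊 n f ≡ 𝕊 n g
    𝕊-cong zero e = e []
    𝕊-cong (suc n) e = sum-cong-≗ (λ a → 𝕊-cong n (λ x → e (a ∷ x)))

    𝕊-mono : ∀ n {f g : Word n → ℕ} → (∀ x → f x ≤ g x) → 𝕊 n f ≤ 𝕊 n g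
    𝕊-mono zero e = e []
    𝕊-mono (suc n) e = sum-mono (λ a → 𝕊-mono n (λ x → e (a ∷ x)))

    𝕊-+ : ∀ n (f g : Word n → ℕ) → 𝕊 n (λ x → f x + g x) ≡ 𝕊 n f + 𝕊 n g
    𝕊-+ zero f g = refl
    𝕊-+ (suc n) f g = trans
      (sum-cong-≗ {q} (λ a → 𝕊-+ n (λ x → f (a ∷ x)) (λ x → g (a ∷ x))))
      (∑-distrib-+ {q} (λ a → 𝕊 n (λ x → f (a ∷ x))) (λ a → 𝕊 n (λ x → g (a ∷ x))))

    𝕊-*ˡ : ∀ n k (f : Word n → ℕ) → 𝕊 n (λ x → k * f x) ≡ k * 𝕊 n f
    𝕊-*ˡ zero k f = refl
    𝕊-*ˡ (suc n) k f = trans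
      (sum-cong-≗ {q} (λ a → 𝕊-*ˡ n k (λ x → f (a ∷ x))))
      (sym (*-distribˡ-sum {q} k (λ a → 𝕊 n (λ x → f (a ∷ x)))))

    𝕊-const : ∀ n k → 𝕊 n (λ _ → k) ≡ q ^ n * k
    𝕊-const zero k = sym (+-identityʳ k)
    𝕊-const (suc n) k = trans (sum-cong-≗ {q} (λ a → 𝕊-const n k)) (trans (sum-const q (q ^ n * k)) (sym (*-assoc q (q ^ n) k)))

    𝕊-sum : ∀ n {k} (f : Fin k → Word n → ℕ) → 𝕊 n (λ x → sum (λ i → f i x)) ≡ sum (λ i → 𝕊 n (f i))
    𝕊-sum zero f = refl
    𝕊-sum (suc n) f = trans
      (sum-cong-≗ {q} (λ a → 𝕊-sum n (λ i x → f i (a ∷ x))))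
      (∑-comm {q} (λ a i → 𝕊 n (λ x → f i (a ∷ x))))

    𝕊-permute : ∀ n (π : Permutation′ q) (f : Word n → ℕ) → 𝕊 n (f ∘ Vec.map (π ⟨$⟩ʳ_)) ≡ 𝕊 n f
    𝕊-permute zero π f = refl
    𝕊-permute (suc n) π f = trans
      (sum-cong-≗ (λ a → 𝕊-permute n π (λ x → f ((π ⟨$⟩ʳ a) ∷ x))))
      (sym (sum-permute (λ a → 𝕊 n (λ x → f (a ∷ x))) π))

    count : ∀ {n} → Fin q → Word n → ℕ
    count v [] = 0
    count v (a ∷ x) = indicator (a F.≟ v) + count v x

    count-permute : ∀ {n} (π : Permutation′ q) s (x : Word n) → count s (Vec.map (π ⟨$⟩ʳ_) x) ≡ count (π ⟨$⟩ˡ s) x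
    count-permute π s [] = refl
    count-permute π s (a ∷ x) = cong₂ _+_
      (≤-antisym (indicator-mono ((π ⟨$⟩ʳ a) F.≟ s) (a F.≟ (π ⟨$⟩ˡ s)) (λ { refl → sym (Perm.inverseˡ π) }))
                 (indicator-mono (a F.≟ (π ⟨$⟩ˡ s)) ((π ⟨$⟩ʳ a) F.≟ s) (λ { refl → Perm.inverseʳ π })))
      (count-permute π s x)

    Lead : ∀ {n} → ℕ → Word n → Set
    Lead j x = ∀ s → count (F.suc s) x + j ≤ count F.zero x

    lead? : ∀ {n} j (x : Word n) → Dec (Lead j x)
    lead? j x = all? (λ s → count (F.suc s) x + j ≤? count F.zero x)

    lead : ∀ {n} → ℕ → Word n → ℕ
    lead j x = indicator (lead? j x)

    μ : ℕ → ℕ → ℕ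
    μ n j = 𝕊 n (lead j)

    plurality? : ∀ {n} v (x : Word n) → Dec (∀ s → count s x ≤ count v x)
    plurality? v x = all? (λ s → count s x ≤? count v x)

    transposition : (v : Fin q) → Σ (Permutation′ q) λ π → π ⟨$⟩ˡ F.zero ≡ v
    transposition v = Perm.transpose v F.zero , helper
      where
      helper : Perm.transpose v F.zero ⟨$⟩ˡ F.zero ≡ v
      helper with F.zero F.≟ v
      ... | yes refl = refl
      ... | no _ = refl

    plurality-count : ∀ n v → 𝕊 n (λ x → indicator (plurality? v x)) ≤ μ n 0
    plurality-count n v with transposition v
    ... | π , π0≡v = ≤-trans (𝕊-mono n (λ x → indicator-mono (plurality? v x) (lead? 0 (Vec.map (π ⟨$⟩ʳ_) x)) (leads x)))
                             (≤-reflexive (𝕊-permute n π (lead 0)))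
      where
      leads : ∀ {n} (x : Word n) → (∀ s → count s x ≤ count v x) → Lead 0 (Vec.map (π ⟨$⟩ʳ_) x)
      leads x max s rewrite count-permute π (F.suc s) x | count-permute π F.zero x | π0≡v
        | +-identityʳ (count (π ⟨$⟩ˡ F.suc s) x) = max _

    -- Every word has a letter of largest count, and a transposition carries the words led by any
    -- given letter into words led by 0.
    words≤qμ₀ : ∀ n → q ^ n ≤ q * μ n 0
    words≤qμ₀ n = begin
      q ^ n ≡⟨ sym (trans (𝕊-const n 1) (*-identityʳ _)) ⟩
      𝕊 n (λ _ → 1) ≤⟨ 𝕊-mono n some ⟩
      𝕊 n (λ x → sum (λ v → indicator (plurality? v x))) ≡⟨ 𝕊-sum n (λ v x → indicator (plurality? v x)) ⟩
      sum (λ v → 𝕊 n (λ x → indicator (plurality? v x))) ≤⟨ sum-bound (μ n 0) (plurality-count n) ⟩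
      q * μ n 0 ∎
      where
      open ≤-Reasoning
      some : ∀ {n} (x : Word n) → 1 ≤ sum (λ v → indicator (plurality? v x))
      some x with argmax (λ v → count v x)
      ... | v , max = ≤-trans (≤-reflexive (sym (indicator-yes (plurality? v x) max)))
                              (sum-term (λ v → indicator (plurality? v x)) v)

    isZero nonZero : ∀ {n} → Fin n → Word n → ℕ
    isZero i x = indicator (lookup x i F.≟ F.zero)
    nonZero i x = 1 ∸ isZero i x

    count-sum : ∀ {n} v (x : Word n) → sum (λ i → indicator (lookup x i F.≟ v)) ≡ count v x
    count-sum v [] = refl
    count-sum v (a ∷ x) = cong (_+_ (indicator (a F.≟ v))) (count-sum v x)

    sum-nonZero : ∀ {n} (x : Word n) → sum (λ i → nonZero i x) + count F.zero x ≡ n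
    sum-nonZero {n} x = begin
      sum (λ i → nonZero i x) + count F.zero x ≡⟨ cong (_+_ (sum (λ i → nonZero i x))) (sym (count-sum F.zero x)) ⟩
      sum (λ i → nonZero i x) + sum (λ i → isZero i x) ≡⟨ sym (∑-distrib-+ (λ i → nonZero i x) (λ i → isZero i x)) ⟩
      sum (λ i → nonZero i x + isZero i x) ≡⟨ sum-cong-≗ (λ i → m∸n+n≡m (indicator≤1 (lookup x i F.≟ F.zero))) ⟩
      sum {n} (λ i → 1) ≡⟨ trans (sum-const n 1) (*-identityʳ n) ⟩
      n ∎
      where open ≡-Reasoning

    -- Each word with 0 at position `i` is the reset of exactly `r` words with another letter there.
    𝕊-reset : ∀ n i (G : Word n → ℕ) → 𝕊 n (λ x → G (x [ i ]≔ F.zero) * nonZero i x) ≡ r * 𝕊 n (λ x → G x * isZero i x)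
    𝕊-reset (suc n) F.zero G = begin
      𝕊 n (λ x → G₀ x * 0) + sum {r} (λ s → 𝕊 n (λ x → G₀ x * 1))
        ≡⟨ cong₂ _+_ (zeros G₀) (sum-const r (𝕊 n (λ x → G₀ x * 1))) ⟩
      r * 𝕊 n (λ x → G₀ x * 1)
        ≡⟨ cong (_*_ r) (sym (+-identityʳ _)) ⟩
      r * (𝕊 n (λ x → G₀ x * 1) + 0)
        ≡⟨ cong (λ t → r * (𝕊 n (λ x → G₀ x * 1) + t))
             (sym (trans (sum-cong-≗ {r} (λ s → zeros (λ x → G (F.suc s ∷ x)))) (trans (sum-const r 0) (*-zeroʳ r)))) ⟩
      r * (𝕊 n (λ x → G₀ x * 1) + sum {r} (λ s → 𝕊 n (λ x → G (F.suc s ∷ x) * 0))) ∎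
      where
      open ≡-Reasoning
      G₀ : Word n → ℕ
      G₀ x = G (F.zero ∷ x)
      zeros : (f : Word n → ℕ) → 𝕊 n (λ x → f x * 0) ≡ 0
      zeros f = trans (𝕊-cong n (λ x → *-zeroʳ (f x))) (trans (𝕊-const n 0) (*-zeroʳ (q ^ n)))
    𝕊-reset (suc n) (F.suc i) G = trans
      (sum-cong-≗ (λ a → 𝕊-reset n i (λ x → G (a ∷ x))))
      (sym (*-distribˡ-sum r (λ a → 𝕊 n (λ x → G (a ∷ x) * isZero i x))))

    count-reset-suc : ∀ {n} (x : Word n) i s → count (F.suc s) (x [ i ]≔ F.zero) ≤ count (F.suc s) x
    count-reset-suc (a ∷ x) F.zero s = m≤n+m _ _
    count-reset-suc (a ∷ x) (F.suc i) s = +-monoʳ-≤ (indicator (a F.≟ F.suc s)) (count-reset-suc x i s)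

    count-reset-zero : ∀ {n} (x : Word n) i → lookup x i ≢ F.zero → count F.zero (x [ i ]≔ F.zero) ≡ suc (count F.zero x)
    count-reset-zero (a ∷ x) F.zero ≢0 rewrite indicator-no (a F.≟ F.zero) ≢0 = refl
    count-reset-zero (a ∷ x) (F.suc i) ≢0 = trans (cong (_+_ (indicator (a F.≟ F.zero))) (count-reset-zero x i ≢0))
      (+-suc _ _)

    lead-reset : ∀ {n} j (x : Word n) i → lead j x * nonZero i x ≤ lead (suc j) (x [ i ]≔ F.zero) * nonZero i x
    lead-reset j x i with lookup x i F.≟ F.zero
    ... | yes _ = ≤-trans (≤-reflexive (*-zeroʳ (lead j x))) z≤n
    ... | no ≢0 = *-monoˡ-≤ 1 (indicator-mono (lead? j x) (lead? (suc j) (x [ i ]≔ F.zero))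
      (λ L s → ≤-trans (+-monoˡ-≤ (suc j) (count-reset-suc x i s))
        (≤-trans (≤-reflexive (+-suc (count (F.suc s) x) j))
          (≤-trans (s≤s (L s)) (≤-reflexive (sym (count-reset-zero x i ≢0)))))))

    ν : ℕ → ℕ → ℕ
    ν n j = 𝕊 n (λ x → lead j x * count F.zero x)

    -- Turning a nonzero letter into 0 raises the lead by at least one: count the pairs (word, position) on both sides.
    lead-exchange : ∀ n j → n * μ n j ≤ ν n j + r * ν n (suc j)
    lead-exchange n j = begin
      n * 𝕊 n (lead j)
        ≡⟨ sym (𝕊-*ˡ n n (lead j)) ⟩
      𝕊 n (λ x → n * lead j x)
        ≡⟨ 𝕊-cong n (λ x → trans (cong (_* lead j x) (sym (sum-nonZero x))) (split (sum (λ i → nonZero i x)) (count F.zero x) (lead j x))) ⟩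
      𝕊 n (λ x → lead j x * count F.zero x + lead j x * sum (λ i → nonZero i x))
        ≡⟨ 𝕊-+ n _ _ ⟩
      ν n j + 𝕊 n (λ x → lead j x * sum (λ i → nonZero i x))
        ≡⟨ cong (_+_ (ν n j)) (trans (𝕊-cong n (λ x → *-distribˡ-sum (lead j x) (λ i → nonZero i x))) (𝕊-sum n (λ i x → lead j x * nonZero i x))) ⟩
      ν n j + sum (λ i → 𝕊 n (λ x → lead j x * nonZero i x))
        ≤⟨ +-monoʳ-≤ (ν n j) (sum-mono (λ i → 𝕊-mono n (λ x → lead-reset j x i))) ⟩
      ν n j + sum (λ i → 𝕊 n (λ x → lead (suc j) (x [ i ]≔ F.zero) * nonZero i x))
        ≡⟨ cong (_+_ (ν n j)) (sum-cong-≗ (λ i → 𝕊-reset n i (lead (suc j)))) ⟩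
      ν n j + sum (λ i → r * 𝕊 n (λ x → lead (suc j) x * isZero i x))
        ≡⟨ cong (_+_ (ν n j)) (sym (*-distribˡ-sum r (λ i → 𝕊 n (λ x → lead (suc j) x * isZero i x)))) ⟩
      ν n j + r * sum (λ i → 𝕊 n (λ x → lead (suc j) x * isZero i x))
        ≡⟨ cong (λ t → ν n j + r * t) (trans (sym (𝕊-sum n (λ i x → lead (suc j) x * isZero i x)))
             (𝕊-cong n (λ x → trans (sym (*-distribˡ-sum (lead (suc j) x) (λ i → isZero i x))) (cong (_*_ (lead (suc j) x)) (count-sum F.zero x))))) ⟩
      ν n j + r * ν n (suc j) ∎
      where
      open ≤-Reasoning
      split : ∀ a c l → (a + c) * l ≡ l * c + l * a
      split = solve-∀

    first-moment : ∀ n → q * 𝕊 n (count F.zero) ≡ n * q ^ n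
    first-moment zero = *-zeroʳ q
    first-moment (suc n) = begin
      q * (𝕊 n (λ x → 1 + count F.zero x) + sum {r} (λ _ → M)) ≡⟨ cong₂ (λ s t → q * (s + t)) (trans (𝕊-+ n (λ _ → 1) _) (cong (_+ M) (𝕊-const n 1))) (sum-const r M) ⟩
      q * (q ^ n * 1 + M + r * M) ≡⟨ lemma r (q ^ n) M ⟩
      q * (q * M) + q * q ^ n ≡⟨ cong (λ t → q * t + q * q ^ n) (first-moment n) ⟩
      q * (n * q ^ n) + q * q ^ n ≡⟨ lemma′ q n (q ^ n) ⟩
      suc n * (q * q ^ n) ∎
      where
      open ≡-Reasoning
      M = 𝕊 n (count F.zero)
      lemma : ∀ r Q M → suc r * (Q * 1 + M + r * M) ≡ suc r * (suc r * M) + suc r * Q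
      lemma = solve-∀
      lemma′ : ∀ q n Q → q * (n * Q) + q * Q ≡ suc n * (q * Q)
      lemma′ = solve-∀

    second-moment : ∀ n → q * q * 𝕊 n (λ x → count F.zero x * count F.zero x) ≡ (n * n + n * r) * q ^ n
    second-moment zero = *-zeroʳ (q * q)
    second-moment (suc n) = begin
      q * q * (𝕊 n (λ x → (1 + count F.zero x) * (1 + count F.zero x)) + sum {r} (λ _ → M₂))
        ≡⟨ cong₂ (λ s t → q * q * (s + t)) expand (sum-const r M₂) ⟩
      q * q * ((q ^ n * 1 + 2 * M₁ + M₂) + r * M₂)
        ≡⟨ lemma r (q ^ n) M₁ M₂ ⟩
      q * (q * q * M₂) + 2 * (q * (q * M₁)) + q * q * q ^ n
        ≡⟨ cong₂ (λ s t → q * s + 2 * (q * t) + q * q * q ^ n) (second-moment n) (first-moment n) ⟩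
      q * ((n * n + n * r) * q ^ n) + 2 * (q * (n * q ^ n)) + q * q * q ^ n
        ≡⟨ lemma′ r n (q ^ n) ⟩
      (suc n * suc n + suc n * r) * (q * q ^ n) ∎
      where
      open ≡-Reasoning
      M₁ = 𝕊 n (count F.zero)
      M₂ = 𝕊 n (λ x → count F.zero x * count F.zero x)
      square : ∀ c → (1 + c) * (1 + c) ≡ (1 + 2 * c) + c * c
      square = solve-∀
      expand : 𝕊 n (λ x → (1 + count F.zero x) * (1 + count F.zero x)) ≡ q ^ n * 1 + 2 * M₁ + M₂
      expand = trans (𝕊-cong n (λ x → square (count F.zero x))) (trans (𝕊-+ n _ _)
        (cong (_+ M₂) (trans (𝕊-+ n (λ _ → 1) _) (cong₂ _+_ (𝕊-const n 1) (𝕊-*ˡ n 2 _)))))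
      lemma : ∀ r Q M N → suc r * suc r * ((Q * 1 + 2 * M + N) + r * N)
        ≡ suc r * (suc r * suc r * N) + 2 * (suc r * (suc r * M)) + suc r * suc r * Q
      lemma = solve-∀
      lemma′ : ∀ r n Q → suc r * ((n * n + n * r) * Q) + 2 * (suc r * (n * Q)) + suc r * suc r * Q
        ≡ (suc n * suc n + suc n * r) * (suc r * Q)
      lemma′ = solve-∀

    deviation : ∀ {n} → Word n → ℕ
    deviation {n} x = ∣ q * count F.zero x - n ∣ * ∣ q * count F.zero x - n ∣

    square-difference : ∀ a n → ∣ a - n ∣ * ∣ a - n ∣ + 2 * (a * n) ≡ a * a + n * n
    square-difference zero n = trans (+-identityʳ (n * n)) refl
    square-difference (suc a) zero = trans (cong (λ t → suc a * suc a + 2 * t) (*-zeroʳ (suc a))) refl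
    square-difference (suc a) (suc n) = trans (lemma ∣ a - n ∣ a n)
      (trans (cong (_+ 2 * (a + n + 1)) (square-difference a n)) (lemma′ a n))
      where
      lemma : ∀ d a n → d * d + 2 * (suc a * suc n) ≡ d * d + 2 * (a * n) + 2 * (a + n + 1)
      lemma = solve-∀
      lemma′ : ∀ a n → a * a + n * n + 2 * (a + n + 1) ≡ suc a * suc a + suc n * suc n
      lemma′ = solve-∀

    twice-product : ∀ a b → 2 * (a * b) ≤ a * a + b * b
    twice-product a b = ≤-trans (m≤n+m (2 * (a * b)) (∣ a - b ∣ * ∣ a - b ∣)) (≤-reflexive (square-difference a b))

    -- The count of 0 is binomial with parameters `n` and `1/q`; its variance `n * r / q²` appears
    -- here multiplied by `q²` and by the number of words.
    total-deviation : ∀ n → 𝕊 n deviation ≡ n * r * q ^ n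
    total-deviation n = +-cancelʳ-≡ (2 * (n * n * q ^ n)) _ _ (begin
      𝕊 n deviation + 2 * (n * n * q ^ n)
        ≡⟨ cong (λ t → 𝕊 n deviation + 2 * t) (trans (*-assoc n n (q ^ n)) (cong (_*_ n) (sym (first-moment n)))) ⟩
      𝕊 n deviation + 2 * (n * (q * M₁))
        ≡⟨ cong (_+_ (𝕊 n deviation)) (trans (lemma n q M₁) (sym (𝕊-*ˡ n (2 * (n * q)) _))) ⟩
      𝕊 n deviation + 𝕊 n (λ x → 2 * (n * q) * count F.zero x)
        ≡⟨ sym (𝕊-+ n _ _) ⟩
      𝕊 n (λ x → deviation x + 2 * (n * q) * count F.zero x)
        ≡⟨ 𝕊-cong n (λ x → trans (cong (_+_ (deviation x)) (lemma₂ n q (count F.zero x)))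
              (trans (square-difference (q * count F.zero x) n) (cong (_+ n * n) (lemma₃ q (count F.zero x))))) ⟩
      𝕊 n (λ x → q * q * (count F.zero x * count F.zero x) + n * n)
        ≡⟨ trans (𝕊-+ n _ _) (cong₂ _+_ (𝕊-*ˡ n (q * q) _) (𝕊-const n (n * n))) ⟩
      q * q * M₂ + q ^ n * (n * n)
        ≡⟨ cong (_+ q ^ n * (n * n)) (second-moment n) ⟩
      (n * n + n * r) * q ^ n + q ^ n * (n * n)
        ≡⟨ lemma₄ n r (q ^ n) ⟩
      n * r * q ^ n + 2 * (n * n * q ^ n) ∎)
      where
      open ≡-Reasoning
      M₁ = 𝕊 n (count F.zero)
      M₂ = 𝕊 n (λ x → count F.zero x * count F.zero x)
      lemma : ∀ n q M → 2 * (n * (q * M)) ≡ 2 * (n * q) * M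
      lemma = solve-∀
      lemma₂ : ∀ n q c → 2 * (n * q) * c ≡ 2 * (q * c * n)
      lemma₂ = solve-∀
      lemma₃ : ∀ q c → q * c * (q * c) ≡ q * q * (c * c)
      lemma₃ = solve-∀
      lemma₄ : ∀ n r Q → (n * n + n * r) * Q + Q * (n * n) ≡ n * r * Q + 2 * (n * n * Q)
      lemma₄ = solve-∀

    -- Young's inequality stands in for Cauchy-Schwarz and keeps square roots out; the free
    -- parameter `λ′` is fixed later so as to balance the two error terms.
    count-deviation : ∀ {n} λ′ (x : Word n) → 2 * λ′ * (q * count F.zero x) ≤ 2 * λ′ * n + (λ′ * λ′ + deviation x)
    count-deviation {n} λ′ x = begin
      2 * λ′ * a ≤⟨ *-monoʳ-≤ (2 * λ′) (a≤n+∣a-n∣ a n) ⟩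
      2 * λ′ * (n + ∣ a - n ∣) ≡⟨ lemma λ′ n ∣ a - n ∣ ⟩
      2 * λ′ * n + 2 * (λ′ * ∣ a - n ∣) ≤⟨ +-monoʳ-≤ (2 * λ′ * n) (twice-product λ′ ∣ a - n ∣) ⟩
      2 * λ′ * n + (λ′ * λ′ + deviation x) ∎
      where
      open ≤-Reasoning
      a = q * count F.zero x
      lemma : ∀ l n d → 2 * l * (n + d) ≡ 2 * l * n + 2 * (l * d)
      lemma = solve-∀
      a≤n+∣a-n∣ : ∀ a n → a ≤ n + ∣ a - n ∣
      a≤n+∣a-n∣ zero n = z≤n
      a≤n+∣a-n∣ (suc a) zero = ≤-refl
      a≤n+∣a-n∣ (suc a) (suc n) = s≤s (a≤n+∣a-n∣ a n)

    -- The pointwise bound is summed over the leading words and its error over all words: up to a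
    -- variance term, `ν n j` is at most `n / q` times `μ n j`.
    ν-bound : ∀ n λ′ j → 2 * λ′ * (q * ν n j) ≤ 2 * λ′ * (n * μ n j) + (λ′ * λ′ + n * r) * q ^ n
    ν-bound n λ′ j = begin
      2 * λ′ * (q * ν n j)
        ≡⟨ trans (sym (*-assoc (2 * λ′) q (ν n j))) (sym (𝕊-*ˡ n (2 * λ′ * q) _)) ⟩
      𝕊 n (λ x → 2 * λ′ * q * (lead j x * count F.zero x))
        ≤⟨ 𝕊-mono n (λ x → pointwise x (lead? j x)) ⟩
      𝕊 n (λ x → 2 * λ′ * n * lead j x + (λ′ * λ′ + deviation x))
        ≡⟨ trans (𝕊-+ n _ _) (cong₂ _+_ (𝕊-*ˡ n (2 * λ′ * n) _) (trans (𝕊-+ n (λ _ → λ′ * λ′) _) (cong₂ _+_ (𝕊-const n (λ′ * λ′)) (total-deviation n)))) ⟩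
      2 * λ′ * n * μ n j + (q ^ n * (λ′ * λ′) + n * r * q ^ n)
        ≡⟨ lemma λ′ n r (μ n j) (q ^ n) ⟩
      2 * λ′ * (n * μ n j) + (λ′ * λ′ + n * r) * q ^ n ∎
      where
      open ≤-Reasoning
      lemma : ∀ l n r m Q → 2 * l * n * m + (Q * (l * l) + n * r * Q) ≡ 2 * l * (n * m) + (l * l + n * r) * Q
      lemma = solve-∀
      pointwise : ∀ x (d : Dec (Lead j x)) → 2 * λ′ * q * (indicator d * count F.zero x) ≤ 2 * λ′ * n * indicator d + (λ′ * λ′ + deviation x)
      pointwise x (no _) rewrite *-zeroʳ (2 * λ′ * q) = z≤n
      pointwise x (yes _) rewrite +-identityʳ (count F.zero x) | *-identityʳ (2 * λ′ * n) | *-assoc (2 * λ′) q (count F.zero x) = count-deviation λ′ x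

    -- With this word length, λ′ = r * l makes the two terms λ′² and n * r of ν-bound equal.
    length-for : ℕ → ℕ
    length-for l = r * (l * l)

    module _ .{{_ : NonZero r}} where

      -- With `n * μ / q` in place of `ν`, `lead-exchange` would reduce to `μ n j ≤ μ n (suc j)`.
      -- The error in `ν-bound` costs a share `2 / l` of all words, of order `1 / √n`.
      μ-decrease : ∀ l .{{_ : NonZero l}} j → let n = length-for l in l * μ n j ≤ l * μ n (suc j) + 2 * q ^ n
      μ-decrease l j = *-cancelˡ-≤ (2 * (r * r * r * (l * l))) {{nz}} (begin
        2 * (r * r * r * (l * l)) * (l * m)
          ≡⟨ lemma₁ r l m ⟩
        2 * λ′ * r * (n * m)
          ≤⟨ +-cancelˡ-≤ (2 * λ′ * (n * m)) _ _ core ⟩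
        r * (2 * λ′ * (n * m′)) + q * X
          ≡⟨ lemma₂ r l m′ (q ^ n) ⟩
        2 * (r * r * r * (l * l)) * (l * m′) + 2 * (r * r * (l * l)) * (suc r * q ^ n)
          -- Here `1 ≤ r` gives `q ≤ 2 * r`, the source of the constant 2 in the loss.
          ≤⟨ +-monoʳ-≤ (2 * (r * r * r * (l * l)) * (l * m′)) (*-monoʳ-≤ (2 * (r * r * (l * l))) (*-monoˡ-≤ (q ^ n) (+-monoˡ-≤ r (≢-nonZero⁻¹′ r)))) ⟩
        2 * (r * r * r * (l * l)) * (l * m′) + 2 * (r * r * (l * l)) * ((r + r) * q ^ n)
          ≡⟨ lemma₃ r l m′ (q ^ n) ⟩
        2 * (r * r * r * (l * l)) * (l * m′ + 2 * q ^ n) ∎)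
        where
        open ≤-Reasoning
        n = length-for l
        m = μ n j
        m′ = μ n (suc j)
        λ′ = r * l
        X = (λ′ * λ′ + n * r) * q ^ n
        ≢-nonZero⁻¹′ : ∀ r .{{_ : NonZero r}} → 1 ≤ r
        ≢-nonZero⁻¹′ (suc r) = s≤s z≤n
        nz : NonZero (2 * (r * r * r * (l * l)))
        nz = m*n≢0 2 (r * r * r * (l * l)) {{_}} {{m*n≢0 (r * r * r) (l * l) {{m*n≢0 (r * r) r {{m*n≢0 r r}}}} {{m*n≢0 l l}}}}
        lemma₁ : ∀ r l m → 2 * (r * r * r * (l * l)) * (l * m) ≡ 2 * (r * l) * r * (r * (l * l) * m)
        lemma₁ = solve-∀
        lemma₂ : ∀ r l m Q → r * (2 * (r * l) * (r * (l * l) * m)) + suc r * ((r * l * (r * l) + r * (l * l) * r) * Q)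
          ≡ 2 * (r * r * r * (l * l)) * (l * m) + 2 * (r * r * (l * l)) * (suc r * Q)
        lemma₂ = solve-∀
        lemma₃ : ∀ r l m Q → 2 * (r * r * r * (l * l)) * (l * m) + 2 * (r * r * (l * l)) * ((r + r) * Q)
          ≡ 2 * (r * r * r * (l * l)) * (l * m + 2 * Q)
        lemma₃ = solve-∀
        lemma₄ : ∀ a r b → 2 * a * b + 2 * a * r * b ≡ 2 * a * suc r * b
        lemma₄ = solve-∀
        lemma₅ : ∀ a q b r c → 2 * a * q * (b + r * c) ≡ 2 * a * (q * b) + r * (2 * a * (q * c))
        lemma₅ = solve-∀
        lemma₆ : ∀ a X r b → (a + X) + r * (b + X) ≡ a + (r * b + suc r * X)
        lemma₆ = solve-∀
        core : 2 * λ′ * (n * m) + 2 * λ′ * r * (n * m) ≤ 2 * λ′ * (n * m) + (r * (2 * λ′ * (n * m′)) + q * X)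
        core = begin
          2 * λ′ * (n * m) + 2 * λ′ * r * (n * m)
            ≡⟨ lemma₄ λ′ r (n * m) ⟩
          2 * λ′ * q * (n * m)
            ≤⟨ *-monoʳ-≤ (2 * λ′ * q) (lead-exchange n j) ⟩
          2 * λ′ * q * (ν n j + r * ν n (suc j))
            ≡⟨ lemma₅ λ′ q (ν n j) r (ν n (suc j)) ⟩
          2 * λ′ * (q * ν n j) + r * (2 * λ′ * (q * ν n (suc j)))
            ≤⟨ +-mono-≤ (ν-bound n λ′ j) (*-monoʳ-≤ r (ν-bound n λ′ (suc j))) ⟩
          (2 * λ′ * (n * m) + X) + r * (2 * λ′ * (n * m′) + X)
            ≡⟨ lemma₆ (2 * λ′ * (n * m)) X r (2 * λ′ * (n * m′)) ⟩
          2 * λ′ * (n * m) + (r * (2 * λ′ * (n * m′)) + q * X) ∎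

      μ-decreases : ∀ l .{{_ : NonZero l}} T → let n = length-for l in l * μ n 0 ≤ l * μ n T + T * (2 * q ^ n)
      μ-decreases l zero = m≤m+n _ _
      μ-decreases l (suc T) = begin
        l * μ n 0 ≤⟨ μ-decreases l T ⟩
        l * μ n T + T * (2 * q ^ n) ≤⟨ +-monoˡ-≤ (T * (2 * q ^ n)) (μ-decrease l T) ⟩
        l * μ n (suc T) + 2 * q ^ n + T * (2 * q ^ n) ≡⟨ +-assoc (l * μ n (suc T)) (2 * q ^ n) _ ⟩
        l * μ n (suc T) + suc T * (2 * q ^ n) ∎
        where
        open ≤-Reasoning
        n = length-for l

      -- With `l = 4 * q * T`, the `T` losses of a share `2 / l` amount to half of the share `1 / q`
      -- that `words≤qμ₀` provides.
      lead-density : ∀ T .{{_ : NonZero T}} → let n = length-for (4 * q * T) in q ^ n ≤ 2 * q * μ n T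
      lead-density T = *-cancelˡ-≤ l (+-cancelʳ-≤ (l * q ^ n) _ _ (begin
        l * q ^ n + l * q ^ n
          ≡⟨ lemma₁ l (q ^ n) ⟩
        2 * (l * q ^ n)
          ≤⟨ *-monoʳ-≤ 2 (*-monoʳ-≤ l (words≤qμ₀ n)) ⟩
        2 * (l * (q * μ n 0))
          ≡⟨ lemma₂ l q (μ n 0) ⟩
        2 * q * (l * μ n 0)
          ≤⟨ *-monoʳ-≤ (2 * q) (μ-decreases l T) ⟩
        2 * q * (l * μ n T + T * (2 * q ^ n))
          ≡⟨ lemma₃ q T (μ n T) (q ^ n) ⟩
        l * (2 * q * μ n T) + l * q ^ n ∎))
        where
        open ≤-Reasoning
        l = 4 * q * T
        instance
          l≢0 : NonZero l
          l≢0 = m*n≢0 (4 * q) T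
        n = length-for l
        lemma₁ : ∀ l Q → l * Q + l * Q ≡ 2 * (l * Q)
        lemma₁ = solve-∀
        lemma₂ : ∀ l q m → 2 * (l * (q * m)) ≡ 2 * q * (l * m)
        lemma₂ = solve-∀
        lemma₃ : ∀ q T m Q → 2 * q * (4 * q * T * m + T * (2 * Q)) ≡ 4 * q * T * (2 * q * m) + 4 * q * T * Q
        lemma₃ = solve-∀

-- Counting integers by the intervals that contain their digits.

module Digit-Expansions where

  open import Data.Nat using (ℕ; zero; suc; _+_; _*_; _^_; _≤_; _<_; NonZero; _≤?_; _<?_; _/_; _%_)
  open import Data.Nat.Properties
  open import Data.Nat.DivMod
  open import Data.Nat.Divisibility using (divides-refl)
  open import Data.Nat.Tactic.RingSolver using (solve-∀)
  open import Data.Unit using (⊤; tt)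
  open import Algebra.Properties.Semiring.Sum +-*-semiring using (sum; sum-cong-≗; ∑-distrib-+; *-distribˡ-sum)
  open Cyclic-Labels
  open Cube-Faces using (toℕ-mod)
  open Leading-Letters

  indicator-× : ∀ {P Q : Set} (d : Dec P) (e : Dec Q) → indicator (d ×-dec e) ≡ indicator d * indicator e
  indicator-× (yes _) (yes _) = refl
  indicator-× (yes _) (no _) = refl
  indicator-× (no _) _ = refl

  Σℕ-*ˡ : ∀ k a (h : ℕ → ℕ) → Σℕ k (λ i → a * h i) ≡ a * Σℕ k h
  Σℕ-*ˡ zero a h = sym (*-zeroʳ a)
  Σℕ-*ˡ (suc k) a h = trans (cong (_+ a * h k) (Σℕ-*ˡ k a h)) (sym (*-distribˡ-+ a (Σℕ k h) (h k)))

  Σℕ-split : ∀ a b (h : ℕ → ℕ) → Σℕ (a + b) h ≡ Σℕ a h + Σℕ b (λ i → h (a + i))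
  Σℕ-split a zero h = trans (cong (λ t → Σℕ t h) (+-identityʳ a)) (sym (+-identityʳ _))
  Σℕ-split a (suc b) h = trans (cong (λ t → Σℕ t h) (+-suc a b))
    (trans (cong (_+ h (a + b)) (Σℕ-split a b h)) (+-assoc (Σℕ a h) _ _))

  Σℕ-product : ∀ M N (h : ℕ → ℕ) → Σℕ (M * N) h ≡ Σℕ M (λ i → Σℕ N (λ j → h (i * N + j)))
  Σℕ-product zero N h = refl
  Σℕ-product (suc M) N h = trans (cong (λ t → Σℕ t h) (+-comm N (M * N)))
    (trans (Σℕ-split (M * N) N h) (cong (_+ Σℕ N (λ j → h (M * N + j))) (Σℕ-product M N h)))

  Σℕ-sum : ∀ k (h : ℕ → ℕ) → Σℕ k h ≡ sum {k} (h ∘ toℕ)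
  Σℕ-sum zero h = refl
  Σℕ-sum (suc k) h = trans (sym (Σℕ-shift k h)) (trans (+-comm _ (h 0)) (cong (_+_ (h 0)) (Σℕ-sum k (h ∘ suc))))

  Σℕ-sum-comm : ∀ k {l} (h : ℕ → Fin l → ℕ) → Σℕ k (λ i → sum (h i)) ≡ sum (λ j → Σℕ k (λ i → h i j))
  Σℕ-sum-comm zero {l} h = sym (trans (sum-const l 0) (*-zeroʳ l))
  Σℕ-sum-comm (suc k) h = trans (cong (_+ sum (h k)) (Σℕ-sum-comm k h)) (sym (∑-distrib-+ _ (h k)))

  Σℕ-periodic : ∀ P (h : ℕ → ℕ) → (∀ i → h (i + P) ≡ h i) → ∀ u → Σℕ P (λ i → h (u + i)) ≡ Σℕ P h
  Σℕ-periodic P h per zero = refl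
  Σℕ-periodic P h per (suc u) = trans (Σℕ-cong P (λ {i} _ → cong h (sym (+-suc u i))))
    (trans (Σℕ-cycle P (λ i → h (u + i)) (trans (per u) (cong h (sym (+-identityʳ u))))) (Σℕ-periodic P h per u))

  [m*n+r]/n : ∀ m n {r} .{{_ : NonZero n}} → r < n → (m * n + r) / n ≡ m
  [m*n+r]/n m n {r} r<n = trans (+-distrib-/-∣ˡ r (divides-refl m))
    (trans (cong₂ _+_ (m*n/n≡m m n) (m<n⇒m/n≡0 r<n)) (+-identityʳ m))

  [m*n+r]%n : ∀ m n {r} .{{_ : NonZero n}} → r < n → (m * n + r) % n ≡ r
  [m*n+r]%n m n {r} r<n = trans (cong (_% n) (+-comm (m * n) r)) (trans ([m+kn]%n≡m%n r m n) (m<n⇒m%n≡m r<n))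

  -- Bernoulli's inequality `(u / W) ^ n ≥ 1 - n * v / W` with `W = u + v`, cleared of denominators
  -- and subtraction.
  bernoulli : ∀ u v n → (u + v) * (u + v) ^ n ≤ (u + v) * u ^ n + n * v * (u + v) ^ n
  bernoulli u v zero = m≤m+n _ _
  bernoulli u v (suc n) = begin
    W * (W * W ^ n) ≤⟨ *-monoʳ-≤ W (bernoulli u v n) ⟩
    W * (W * u ^ n + n * v * W ^ n) ≡⟨ lemma u v (u ^ n) n (W ^ n) ⟩
    W * (u * u ^ n) + n * v * (W * W ^ n) + v * (W * u ^ n) ≤⟨ +-monoʳ-≤ _ (*-monoʳ-≤ v (*-monoʳ-≤ W (^-monoˡ-≤ n (m≤m+n u v)))) ⟩
    W * (u * u ^ n) + n * v * (W * W ^ n) + v * (W * W ^ n) ≡⟨ lemma′ (W * (u * u ^ n)) n v (W * W ^ n) ⟩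
    W * (u * u ^ n) + suc n * v * (W * W ^ n) ∎
    where
    open ≤-Reasoning
    W = u + v
    lemma : ∀ u v x n y → (u + v) * ((u + v) * x + n * v * y) ≡ (u + v) * (u * x) + n * v * ((u + v) * y) + v * ((u + v) * x)
    lemma = solve-∀
    lemma′ : ∀ a n v y → a + n * v * y + v * y ≡ a + suc n * v * y
    lemma′ = solve-∀

  power-half : ∀ u v n .{{_ : NonZero (u + v)}} → u + v ≡ 2 * (n * v) → (u + v) ^ n ≤ 2 * u ^ n
  power-half u v n e = *-cancelˡ-≤ W (+-cancelʳ-≤ (W * W ^ n) _ _ (begin
    W * W ^ n + W * W ^ n ≡⟨ lemma (W * W ^ n) ⟩
    2 * (W * W ^ n) ≤⟨ *-monoʳ-≤ 2 (bernoulli u v n) ⟩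
    2 * (W * u ^ n + n * v * W ^ n) ≡⟨ lemma′ W (u ^ n) (n * v) (W ^ n) ⟩
    W * (2 * u ^ n) + 2 * (n * v) * W ^ n ≡⟨ cong (λ t → W * (2 * u ^ n) + t * W ^ n) (sym e) ⟩
    W * (2 * u ^ n) + W * W ^ n ∎))
    where
    open ≤-Reasoning
    W = u + v
    lemma : ∀ a → a + a ≡ 2 * a
    lemma = solve-∀
    lemma′ : ∀ W x a y → 2 * (W * x + a * y) ≡ W * (2 * x) + 2 * a * y
    lemma′ = solve-∀

  module Expansion (r W E : ℕ) .{{_ : NonZero W}} where

    open Words r public

    Q : ℕ
    Q = q * W

    instance
      Q≢0 : NonZero Q
      Q≢0 = m*n≢0 q W

    -- The base-Q digits of a, least significant first, each replaced by the index of the length-W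
    -- interval that contains it; a digit is safe if it keeps distance E from the ends of its interval.
    block : ∀ n → ℕ → Word n
    block zero a = []
    block (suc n) a = (a / W) mod q ∷ block n (a / Q)

    SafeDigit : ℕ → Set
    SafeDigit o = E ≤ o × o + E < W

    safeDigit? : ∀ o → Dec (SafeDigit o)
    safeDigit? o = (E ≤? o) ×-dec (o + E <? W)

    Safe : ℕ → ℕ → Set
    Safe zero a = ⊤
    Safe (suc n) a = SafeDigit (a % W) × Safe n (a / Q)

    safe? : ∀ n a → Dec (Safe n a)
    safe? zero a = yes tt
    safe? (suc n) a = safeDigit? (a % W) ×-dec safe? n (a / Q)

    digitCount : ℕ
    digitCount = Σℕ W (λ o → indicator (safeDigit? o))

    -- Over a full period the digits are independent, and within any prescribed interval a digit has
    -- `digitCount` safe values; so safe numbers hit every word equally often.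
    safe-count : ∀ n (f : Word n → ℕ) → Σℕ (Q ^ n) (λ a → indicator (safe? n a) * f (block n a)) ≡ digitCount ^ n * 𝕊 n f
    safe-count zero f = refl
    safe-count (suc n) f = begin
      Σℕ (Q * Q ^ n) h
        ≡⟨ cong (λ t → Σℕ t h) (*-comm Q (Q ^ n)) ⟩
      Σℕ (Q ^ n * Q) h
        ≡⟨ Σℕ-product (Q ^ n) Q h ⟩
      Σℕ (Q ^ n) (λ a → Σℕ (q * W) (λ d → h (a * Q + d)))
        ≡⟨ Σℕ-cong (Q ^ n) (λ {a} _ → Σℕ-product q W (λ d → h (a * Q + d))) ⟩
      Σℕ (Q ^ n) (λ a → Σℕ q (λ b → Σℕ W (λ o → h (a * Q + (b * W + o)))))
        ≡⟨ Σℕ-cong (Q ^ n) (λ {a} _ → Σℕ-sum q _) ⟩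
      Σℕ (Q ^ n) (λ a → sum {q} (λ b → Σℕ W (λ o → h (a * Q + (toℕ b * W + o)))))
        ≡⟨ Σℕ-cong (Q ^ n) (λ {a} _ → sum-cong-≗ {q} (λ b → Σℕ-cong W (λ {o} o<W → digits a b o<W))) ⟩
      Σℕ (Q ^ n) (λ a → sum {q} (λ b → Σℕ W (λ o → G a b * D o)))
        ≡⟨ Σℕ-cong (Q ^ n) (λ {a} _ → sum-cong-≗ {q} (λ b → trans (Σℕ-*ˡ W (G a b) D) (*-comm (G a b) digitCount))) ⟩
      Σℕ (Q ^ n) (λ a → sum {q} (λ b → digitCount * G a b))
        ≡⟨ Σℕ-sum-comm (Q ^ n) {q} (λ a b → digitCount * G a b) ⟩
      sum {q} (λ b → Σℕ (Q ^ n) (λ a → digitCount * G a b))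
        ≡⟨ sum-cong-≗ {q} (λ b → trans (Σℕ-*ˡ (Q ^ n) digitCount (λ a → G a b)) (cong (_*_ digitCount) (safe-count n (λ x → f (b ∷ x))))) ⟩
      sum {q} (λ b → digitCount * (digitCount ^ n * 𝕊 n (λ x → f (b ∷ x))))
        ≡⟨ sum-cong-≗ {q} (λ b → sym (*-assoc digitCount (digitCount ^ n) (𝕊 n (λ x → f (b ∷ x))))) ⟩
      sum {q} (λ b → digitCount ^ suc n * 𝕊 n (λ x → f (b ∷ x)))
        ≡⟨ sym (*-distribˡ-sum (digitCount ^ suc n) (λ b → 𝕊 n (λ x → f (b ∷ x)))) ⟩
      digitCount ^ suc n * 𝕊 (suc n) f ∎
      where
      open ≡-Reasoning
      h : ℕ → ℕ
      h a = indicator (safe? (suc n) a) * f (block (suc n) a)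
      D : ℕ → ℕ
      D o = indicator (safeDigit? o)
      G : ℕ → Fin q → ℕ
      G a b = indicator (safe? n a) * f (b ∷ block n a)
      rearrange : ∀ a q b W o → a * (q * W) + (b * W + o) ≡ (a * q + b) * W + o
      rearrange = solve-∀
      swap : ∀ x y z → x * y * z ≡ y * z * x
      swap = solve-∀
      digits : ∀ a (b : Fin q) {o} → o < W → h (a * Q + (toℕ b * W + o)) ≡ G a b * D o
      digits a b {o} o<W = begin
        indicator (safeDigit? (N % W) ×-dec safe? n (N / Q)) * f ((N / W) mod q ∷ block n (N / Q))
          ≡⟨ cong (_* f ((N / W) mod q ∷ block n (N / Q))) (indicator-× (safeDigit? (N % W)) (safe? n (N / Q))) ⟩
        D (N % W) * indicator (safe? n (N / Q)) * f ((N / W) mod q ∷ block n (N / Q))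
          ≡⟨ cong (λ t → D t * indicator (safe? n (N / Q)) * f ((N / W) mod q ∷ block n (N / Q))) N%W ⟩
        D o * indicator (safe? n (N / Q)) * f ((N / W) mod q ∷ block n (N / Q))
          ≡⟨ cong₂ (λ s t → D o * indicator (safe? n s) * f (t ∷ block n s)) N/Q N/W ⟩
        D o * indicator (safe? n a) * f (b ∷ block n a)
          ≡⟨ swap (D o) (indicator (safe? n a)) (f (b ∷ block n a)) ⟩
        G a b * D o ∎
        where
        N = a * Q + (toℕ b * W + o)
        N≡ : N ≡ (a * q + toℕ b) * W + o
        N≡ = rearrange a q (toℕ b) W o
        N%W : N % W ≡ o
        N%W = trans (cong (_% W) N≡) ([m*n+r]%n (a * q + toℕ b) W o<W)
        N/Q : N / Q ≡ a
        N/Q = [m*n+r]/n a Q (<-≤-trans (+-monoʳ-< (toℕ b * W) o<W)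
          (≤-trans (≤-reflexive (+-comm (toℕ b * W) W)) (*-monoˡ-≤ W (toℕ<n b))))
        N/W : (N / W) mod q ≡ b
        N/W = toℕ-injective (trans (toℕ-mod (N / W) q)
          (trans (cong (_% q) (trans (cong (_/ W) N≡) ([m*n+r]/n (a * q + toℕ b) W o<W))) ([m*n+r]%n a q (toℕ<n b))))

    digitCount-bound : ∀ u → E + u + E ≡ W → u ≤ digitCount
    digitCount-bound u e = begin
      u ≡⟨ sym (trans (trans (Σℕ-sum u (λ _ → 1)) (sum-const u 1)) (*-identityʳ u)) ⟩
      Σℕ u (λ _ → 1) ≡⟨ Σℕ-cong u (λ {i} i<u → sym (indicator-yes (safeDigit? (E + i))
                                                          (m≤m+n E i , subst (E + i + E <_) e (+-monoˡ-< E (+-monoʳ-< E i<u))))) ⟩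
      Σℕ u (λ i → D (E + i)) ≤⟨ m≤n+m _ _ ⟩
      Σℕ E D + Σℕ u (λ i → D (E + i)) ≡⟨ sym (Σℕ-split E u D) ⟩
      Σℕ (E + u) D ≤⟨ m≤m+n _ _ ⟩
      Σℕ (E + u) D + Σℕ E (λ i → D (E + u + i)) ≡⟨ sym (Σℕ-split (E + u) E D) ⟩
      Σℕ (E + u + E) D ≡⟨ cong (λ t → Σℕ t D) e ⟩
      digitCount ∎
      where
      open ≤-Reasoning
      D : ℕ → ℕ
      D o = indicator (safeDigit? o)

    Core : ℕ → ℕ → ℕ → Set
    Core n T a = Safe n a × Lead T (block n a)

    core? : ∀ n T a → Dec (Core n T a)
    core? n T a = safe? n a ×-dec lead? T (block n a)

    core-count : ∀ n T → Σℕ (Q ^ n) (λ a → indicator (core? n T a)) ≡ digitCount ^ n * μ n T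
    core-count n T = trans (Σℕ-cong (Q ^ n) (λ {a} _ → indicator-× (safe? n a) (lead? T (block n a)))) (safe-count n (lead T))

    block-periodic : ∀ n a k → block n (a + k * Q ^ n) ≡ block n a
    safe-periodic : ∀ n a k → Safe n (a + k * Q ^ n) ≡ Safe n a

    private
      shift-W : ∀ n a k → a + k * (q * W * Q ^ n) ≡ a + k * Q ^ n * q * W
      shift-W n a k = cong (_+_ a) (lemma k q W (Q ^ n))
        where
        lemma : ∀ k q W P → k * (q * W * P) ≡ k * P * q * W
        lemma = solve-∀
      [m+kn]/n : ∀ m k n .{{_ : NonZero n}} → (m + k * n) / n ≡ m / n + k
      [m+kn]/n m k n = trans (+-distrib-/-∣ʳ m (divides-refl k)) (cong (_+_ (m / n)) (m*n/n≡m k n))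
      /Q : ∀ n a k → (a + k * (Q * Q ^ n)) / Q ≡ a / Q + k * Q ^ n
      /Q n a k = trans (cong (λ t → (a + t) / Q) (trans (cong (_*_ k) (*-comm Q (Q ^ n))) (sym (*-assoc k (Q ^ n) Q)))) ([m+kn]/n a (k * Q ^ n) Q)

    block-periodic zero a k = refl
    block-periodic (suc n) a k = cong₂ _∷_
      (toℕ-injective (trans (toℕ-mod ((a + k * Q ^ suc n) / W) q) (trans (trans (cong (_% q) (trans (cong (_/ W) (shift-W n a k)) ([m+kn]/n a (k * Q ^ n * q) W)))
        ([m+kn]%n≡m%n (a / W) (k * Q ^ n) q)) (sym (toℕ-mod (a / W) q)))))
      (trans (cong (block n) (/Q n a k)) (block-periodic n (a / Q) k))

    safe-periodic zero a k = refl
    safe-periodic (suc n) a k = cong₂ (λ s t → SafeDigit s × t)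
      (trans (cong (_% W) (shift-W n a k)) ([m+kn]%n≡m%n a (k * Q ^ n * q) W))
      (trans (cong (Safe n) (/Q n a k)) (safe-periodic n (a / Q) k))

    core-periodic : ∀ n T a → indicator (core? n T (a + Q ^ n)) ≡ indicator (core? n T a)
    core-periodic n T a = ≤-antisym
      (indicator-mono (core? n T (a + Q ^ n)) (core? n T a) (subst (λ X → X) same))
      (indicator-mono (core? n T a) (core? n T (a + Q ^ n)) (subst (λ X → X) (sym same)))
      where
      same : Core n T (a + Q ^ n) ≡ Core n T a
      same rewrite sym (*-identityˡ (Q ^ n)) = cong₂ (λ X w → X × Lead T w) (safe-periodic n a 1) (block-periodic n a 1)

    -- The core condition sees only the `n` lowest digits and is therefore periodic; a window of
    -- length `w`, wherever it starts, contains `w / Q ^ n` disjoint full periods.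
    core-interval : ∀ n T u w .{{_ : NonZero (Q ^ n)}} →
      w / Q ^ n * (digitCount ^ n * μ n T) ≤ Σℕ w (λ i → indicator (core? n T (u + i)))
    core-interval n T u w = begin
      w / P * (digitCount ^ n * μ n T) ≡⟨ cong (_*_ (w / P)) (sym (core-count n T)) ⟩
      w / P * Σℕ P C ≡⟨ sym (trans (Σℕ-sum (w / P) (λ _ → Σℕ P C)) (sum-const (w / P) (Σℕ P C))) ⟩
      Σℕ (w / P) (λ _ → Σℕ P C) ≡⟨ Σℕ-cong (w / P) (λ {j} _ → sym (trans
                                                      (Σℕ-cong P (λ {i} _ → cong C (sym (+-assoc u (j * P) i))))
                                                      (Σℕ-periodic P C (core-periodic n T) (u + j * P)))) ⟩
      Σℕ (w / P) (λ j → Σℕ P (λ i → C (u + (j * P + i)))) ≡⟨ sym (Σℕ-product (w / P) P (λ i → C (u + i))) ⟩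
      Σℕ (w / P * P) (λ i → C (u + i)) ≤⟨ m≤m+n _ _ ⟩
      Σℕ (w / P * P) (λ i → C (u + i)) + Σℕ (w % P) (λ i → C (u + (w / P * P + i))) ≡⟨ sym (Σℕ-split (w / P * P) (w % P) (λ i → C (u + i))) ⟩
      Σℕ (w / P * P + w % P) (λ i → C (u + i)) ≡⟨ cong (λ t → Σℕ t (λ i → C (u + i))) (trans (+-comm (w / P * P) (w % P)) (sym (m≡m%n+[m/n]*n w P))) ⟩
      Σℕ w (λ i → C (u + i)) ∎
      where
      open ≤-Reasoning
      P = Q ^ n
      C : ℕ → ℕ
      C a = indicator (core? n T a)

-- How addition moves digits from interval to interval.

module Block-Shifts where

  open import Data.Nat using (ℕ; zero; suc; _≤_; _<_; _∸_; _^_; z≤n; s≤s; NonZero)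
  import Data.Nat as ℕ
  open import Data.Nat.DivMod using (m≡m%n+[m/n]*n; m%n<n; _mod_)
  import Data.Nat.Properties as ℕ
  import Data.Nat.Tactic.RingSolver as ℕSolver
  open import Data.Integer using (ℤ; +_; -[1+_]; _+_; _-_; _*_; -_; ∣_∣; 0ℤ; 1ℤ; -1ℤ)
  open import Data.Integer.Properties
  open import Data.Integer.DivMod using (_%ℕ_; _/ℕ_; a≡a%ℕn+[a/ℕn]*n; n%ℕd<d)
  open import Data.Integer.Tactic.RingSolver using (solve-∀)
  open import Algebra.Properties.Semiring.Sum ℕ.+-*-semiring using (sum; ∑-distrib-+)
  open import Defs using (∑)
  open Cyclic-Labels
  open Cube-Faces using (rotate; toℕ-mod; errors)
  open Colour-Labels using (sum-mono)
  open Digit-Expansions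

  multiple-small : ∀ {U x y} d → x < U → y < U → d * + U ≡ + x - + y → d ≡ 0ℤ
  multiple-small {U} {x} {y} d x<U y<U e = ∣i∣≡0⇒i≡0 (small ∣ d ∣ (subst (_< U) (sym abs) (bound x y x<U y<U)))
    where
    abs : ∣ d ∣ ℕ.* U ≡ ∣ + x - + y ∣
    abs = trans (sym (abs-* d (+ U))) (cong ∣_∣ e)
    bound : ∀ x y → x < U → y < U → ∣ + x - + y ∣ < U
    bound x y x<U y<U = subst (_< U) (cong ∣_∣ (sym (m-n≡m⊖n x y))) (ℕ.≤-<-trans (∣m⊝n∣≤m⊔n x y) (ℕ.⊔-lub x<U y<U))
    small : ∀ k → k ℕ.* U < U → k ≡ 0
    small zero _ = refl
    small (suc k) lt = contradiction lt (ℕ.≤⇒≯ (ℕ.m≤m+n U (k ℕ.* U)))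

  division-unique : ∀ {U x y} m m′ → x < U → y < U → m * + U + + x ≡ m′ * + U + + y → m ≡ m′ × x ≡ y
  division-unique {U} {x} {y} m m′ x<U y<U e = i-j≡0⇒i≡j m m′ d≡0 , sym (+-injective (i-j≡0⇒i≡j (+ y) (+ x) (trans (sym eq) (cong (_* + U) d≡0))))
    where
    lemma₁ : ∀ m m′ U x → (m - m′) * U ≡ (m * U + x) - (m′ * U + x)
    lemma₁ = solve-∀
    lemma₂ : ∀ m U x y → (m * U + y) - (m * U + x) ≡ y - x
    lemma₂ = solve-∀
    eq : (m - m′) * + U ≡ + y - + x
    eq = trans (lemma₁ m m′ (+ U) (+ x)) (trans (cong (_- (m′ * + U + + x)) e) (lemma₂ m′ (+ U) (+ x) (+ y)))
    d≡0 : m - m′ ≡ 0ℤ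
    d≡0 = multiple-small (m - m′) y<U x<U eq

  pos-division : ∀ B q .{{_ : NonZero q}} → + B ≡ + (B ℕ./ q) * + q + + (B ℕ.% q)
  pos-division B q = begin
    + B ≡⟨ cong +_ (m≡m%n+[m/n]*n B q) ⟩
    + (B ℕ.% q) + + (B ℕ./ q ℕ.* q) ≡⟨ +-comm (+ (B ℕ.% q)) (+ (B ℕ./ q ℕ.* q)) ⟩
    + (B ℕ./ q ℕ.* q) + + (B ℕ.% q) ≡⟨ cong (_+ + (B ℕ.% q)) (pos-* (B ℕ./ q) q) ⟩
    + (B ℕ./ q) * + q + + (B ℕ.% q) ∎
    where open ≡-Reasoning

  residue-unique : ∀ {q x} B j .{{_ : NonZero q}} → x < q → + B ≡ j * + q + + x → B ℕ.% q ≡ x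
  residue-unique {q} B j x<q e = proj₂ (division-unique (+ (B ℕ./ q)) j (m%n<n B q) x<q (trans (sym (pos-division B q)) e))

  offset : ∀ t ε → ∣ ε ∣ ≤ t → ∃ λ x → + t + ε ≡ + x × x ≤ t ℕ.+ ∣ ε ∣
  offset t (+ k) le = t ℕ.+ k , refl , ℕ.≤-refl
  offset t -[1+ k ] le = t ∸ suc k , ⊖-≥ le , ℕ.≤-trans (ℕ.m∸n≤m t (suc k)) (ℕ.m≤m+n t (suc k))

  module Shifts (r W E : ℕ) .{{_ : NonZero W}} where

    open Expansion r W E public

    -- Adding z moves the i-th digit by ρ intervals, up to e units and a carry-in.
    record Near (i : ℕ) (ρ : ℤ) (e : ℕ) (z : ℤ) : Set where
      constructor near
      field
        turns  : ℤ
        error  : ℤ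
        split  : z ≡ (ρ + turns * + q) * + (W ℕ.* Q ^ i) + error
        small  : ∣ error ∣ ≤ e ℕ.* Q ^ i

    near-zero : ∀ {i} → Near i 0ℤ 0 0ℤ
    near-zero = near 0ℤ 0ℤ refl z≤n

    near-weaken : ∀ {i ρ e e′ z} → e ≤ e′ → Near i ρ e z → Near i ρ e′ z
    near-weaken {i} le (near j ε s b) = near j ε s (ℕ.≤-trans b (ℕ.*-monoˡ-≤ (Q ^ i) le))

    near-+ : ∀ {i ρ ρ′ e e′ z z′} → Near i ρ e z → Near i ρ′ e′ z′ → Near i (ρ + ρ′) (e ℕ.+ e′) (z + z′)
    near-+ {i} {ρ} {ρ′} {e} {e′} (near j ε s b) (near j′ ε′ s′ b′) = near (j + j′) (ε + ε′)
      (trans (cong₂ _+_ s s′) (lemma ρ ρ′ j j′ (+ q) (+ (W ℕ.* Q ^ i)) ε ε′))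
      (ℕ.≤-trans (∣i+j∣≤∣i∣+∣j∣ ε ε′) (ℕ.≤-trans (ℕ.+-mono-≤ b b′) (ℕ.≤-reflexive (sym (ℕ.*-distribʳ-+ (Q ^ i) e e′)))))
      where
      lemma : ∀ ρ ρ′ j j′ q U ε ε′ → ((ρ + j * q) * U + ε) + ((ρ′ + j′ * q) * U + ε′) ≡ ((ρ + ρ′) + (j + j′) * q) * U + (ε + ε′)
      lemma = solve-∀

    near-* : ∀ {i ρ e z} d → Near i ρ e z → Near i (d * ρ) (∣ d ∣ ℕ.* e) (d * z)
    near-* {i} {ρ} {e} d (near j ε s b) = near (d * j) (d * ε)
      (trans (cong (_*_ d) s) (lemma d ρ j (+ q) (+ (W ℕ.* Q ^ i)) ε))
      (ℕ.≤-trans (ℕ.≤-reflexive (abs-* d ε)) (ℕ.≤-trans (ℕ.*-monoʳ-≤ ∣ d ∣ b) (ℕ.≤-reflexive (sym (ℕ.*-assoc ∣ d ∣ e (Q ^ i))))))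
      where
      lemma : ∀ d ρ j q U ε → d * ((ρ + j * q) * U + ε) ≡ (d * ρ + d * j * q) * U + d * ε
      lemma = solve-∀

    near-∑ : ∀ {k i} (d ρ s : Fin k → ℤ) → (∀ l → Near i (ρ l) 1 (s l)) →
      Near i (∑ (λ l → d l * ρ l)) (sum (λ l → ∣ d l ∣)) (∑ (λ l → d l * s l))
    near-∑ {zero} d ρ s nr = near-zero
    near-∑ {suc k} d ρ s nr = near-+ (near-weaken (ℕ.≤-reflexive (ℕ.*-identityʳ ∣ d F.zero ∣)) (near-* (d F.zero) (nr F.zero)))
      (near-∑ (d ∘ F.suc) (ρ ∘ F.suc) (s ∘ F.suc) (nr ∘ F.suc))

    near-neg : ∀ {i ρ e z} → Near i ρ e z → Near i (- ρ) e (- z)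
    near-neg {i} {ρ} {e} {z} nr rewrite sym (-1*i≡-i ρ) | sym (-1*i≡-i z) = near-weaken (ℕ.≤-reflexive (ℕ.*-identityˡ e)) (near-* -1ℤ nr)

    high : ℕ → ℕ → ℕ
    high zero a = a
    high (suc i) a = high i (a ℕ./ Q)

    lookup-block : ∀ {n} a (i : Fin n) → lookup (block n a) i ≡ (high (toℕ i) a ℕ./ W) mod q
    lookup-block a F.zero = refl
    lookup-block a (F.suc i) = lookup-block (a ℕ./ Q) i

    safe-high : ∀ {n} a (i : Fin n) → Safe n a → SafeDigit (high (toℕ i) a ℕ.% W)
    safe-high a F.zero (s , _) = s
    safe-high a (F.suc i) (_ , s) = safe-high (a ℕ./ Q) i s

    high-split : ∀ i a → ∃ λ lo → a ≡ high i a ℕ.* Q ^ i ℕ.+ lo × lo < Q ^ i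
    high-split zero a = 0 , sym (trans (ℕ.+-identityʳ _) (ℕ.*-identityʳ a)) , s≤s z≤n
    high-split (suc i) a with high-split i (a ℕ./ Q)
    ... | lo , e , lt = a ℕ.% Q ℕ.+ lo ℕ.* Q ,
      trans (m≡m%n+[m/n]*n a Q) (trans (cong (λ t → a ℕ.% Q ℕ.+ t ℕ.* Q) e) (lemma (a ℕ.% Q) (high i (a ℕ./ Q)) (Q ^ i) lo Q)) ,
      ℕ.<-≤-trans (ℕ.+-monoˡ-< (lo ℕ.* Q) (m%n<n a Q)) (ℕ.≤-trans (ℕ.*-monoˡ-≤ Q lt) (ℕ.≤-reflexive (ℕ.*-comm (Q ^ i) Q)))
      where
      lemma : ∀ m h P lo Q → m ℕ.+ (h ℕ.* P ℕ.+ lo) ℕ.* Q ≡ h ℕ.* (Q ℕ.* P) ℕ.+ (m ℕ.+ lo ℕ.* Q)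
      lemma = ℕSolver.solve-∀

    unit-split : ∀ i a → let h = high i a in
      ∃ λ lo → + a ≡ + (h ℕ./ W) * + (W ℕ.* Q ^ i) + + (h ℕ.% W ℕ.* Q ^ i ℕ.+ lo) × lo < Q ^ i
    unit-split i a with high-split i a
    ... | lo , e , lt = lo , (begin
      + a
        ≡⟨ cong +_ e ⟩
      + (h ℕ.* P ℕ.+ lo)
        ≡⟨ cong (λ t → + (t ℕ.* P ℕ.+ lo)) (m≡m%n+[m/n]*n h W) ⟩
      + ((h ℕ.% W ℕ.+ h ℕ./ W ℕ.* W) ℕ.* P ℕ.+ lo)
        ≡⟨ cong +_ (lemma (h ℕ.% W) (h ℕ./ W) W P lo) ⟩
      + (h ℕ./ W ℕ.* (W ℕ.* P) ℕ.+ (h ℕ.% W ℕ.* P ℕ.+ lo))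
        ≡⟨ cong (_+ + (h ℕ.% W ℕ.* P ℕ.+ lo)) (pos-* (h ℕ./ W) (W ℕ.* P)) ⟩
      + (h ℕ./ W) * + (W ℕ.* P) + + (h ℕ.% W ℕ.* P ℕ.+ lo) ∎) , lt
      where
      open ≡-Reasoning
      h = high i a
      P = Q ^ i
      lemma : ∀ m d W P lo → (m ℕ.+ d ℕ.* W) ℕ.* P ℕ.+ lo ≡ d ℕ.* (W ℕ.* P) ℕ.+ (m ℕ.* P ℕ.+ lo)
      lemma = ℕSolver.solve-∀

    digit-room : ∀ {o lo e P} → o ℕ.+ e < W → lo < P → o ℕ.* P ℕ.+ lo ℕ.+ e ℕ.* P < W ℕ.* P
    digit-room {o} {lo} {e} {P} lt lo<P = ℕ.<-≤-trans
      (ℕ.+-monoˡ-< (e ℕ.* P) (ℕ.+-monoʳ-< (o ℕ.* P) lo<P))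
      (ℕ.≤-trans (ℕ.≤-reflexive (lemma o P e)) (ℕ.*-monoˡ-≤ P lt))
      where
      lemma : ∀ o P e → o ℕ.* P ℕ.+ P ℕ.+ e ℕ.* P ≡ suc (o ℕ.+ e) ℕ.* P
      lemma = ℕSolver.solve-∀

    -- A safe offset leaves room `E` on both sides, so neither the error nor the lower digits can
    -- push the digit over an end of its interval.
    block-shift : ∀ i {a a′ ρ z} → + a′ ≡ + a + z → Near i ρ E z → SafeDigit (high i a ℕ.% W) →
      ∃ λ j → + (high i a′ ℕ./ W) ≡ (+ (high i a ℕ./ W) + ρ) + j * + q
    block-shift i {a} {a′} {ρ} {z} e (near j ε s b) (E≤o , o+E<W) with unit-split i a | unit-split i a′
    ... | lo , ea , lt | lo′ , ea′ , lt′ with offset (high i a ℕ.% W ℕ.* Q ^ i ℕ.+ lo) ε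
        (ℕ.≤-trans b (ℕ.≤-trans (ℕ.*-monoˡ-≤ (Q ^ i) E≤o) (ℕ.m≤m+n _ lo)))
    ... | x , ex , x≤ = j , proj₁ (division-unique _ _
      (subst (_< U) (ℕ.+-identityʳ _) (digit-room {e = 0} (subst (_< W) (sym (ℕ.+-identityʳ _)) (m%n<n (high i a′) W)) lt′))
      (ℕ.≤-<-trans (ℕ.≤-trans x≤ (ℕ.+-monoʳ-≤ _ b)) (digit-room {o = high i a ℕ.% W} {e = E} o+E<W lt))
      (begin
        + (h′ ℕ./ W) * + U + + (h′ ℕ.% W ℕ.* Q ^ i ℕ.+ lo′) ≡⟨ sym ea′ ⟩
        + a′ ≡⟨ e ⟩
        + a + z ≡⟨ cong₂ _+_ ea s ⟩
        (+ (h ℕ./ W) * + U + + t) + ((ρ + j * + q) * + U + ε) ≡⟨ lemma (+ (h ℕ./ W)) (+ U) (+ t) ρ (j * + q) ε ⟩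
        (+ (h ℕ./ W) + ρ + j * + q) * + U + (+ t + ε) ≡⟨ cong (_+_ ((+ (h ℕ./ W) + ρ + j * + q) * + U)) ex ⟩
        (+ (h ℕ./ W) + ρ + j * + q) * + U + + x ∎))
      where
      open ≡-Reasoning
      U = W ℕ.* Q ^ i
      h = high i a
      h′ = high i a′
      t = h ℕ.% W ℕ.* Q ^ i ℕ.+ lo
      lemma : ∀ m U t ρ k ε → (m * U + t) + ((ρ + k) * U + ε) ≡ (m + ρ + k) * U + (t + ε)
      lemma = solve-∀

    module _ {n T : ℕ} {ρ : ℤ} {bad : Fin n → ℕ} (few : sum bad ≤ T) (q∤ρ : ρ %ℕ q ≢ 0) where

      private
        v : Fin q
        v = F.fromℕ< (n%ℕd<d ρ q)

        v≢0 : ∃ λ s → v ≡ F.suc s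
        v≢0 with v in eq
        ... | F.zero = contradiction (trans (sym (toℕ-fromℕ< (n%ℕd<d ρ q))) (cong toℕ eq)) q∤ρ
        ... | F.suc s = s , refl

      -- A digit of `a` in interval 0 at a good position lands in interval `v`, the nonzero residue
      -- of `ρ`. Hence 0 occurs in `a` at most `T` times more often than `v` in `a′`, where 0 beats
      -- `v` by more than `T`.
      lead-grows : ∀ {a a′ z} → + a′ ≡ + a + z → (∀ i → bad i ≡ 0 → Near (toℕ i) ρ E z) →
        Safe n a → Lead (suc T) (block n a′) → count F.zero (block n a) < count F.zero (block n a′)
      lead-grows {a} {a′} {z} e nr safe ahead = begin-strict
        count F.zero (block n a)
          ≡⟨ sym (count-sum F.zero (block n a)) ⟩
        sum (λ i → indicator (lookup (block n a) i F.≟ F.zero))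
          ≤⟨ sum-mono pointwise ⟩
        sum (λ i → indicator (lookup (block n a′) i F.≟ v) ℕ.+ bad i)
          ≡⟨ ∑-distrib-+ (λ i → indicator (lookup (block n a′) i F.≟ v)) bad ⟩
        sum (λ i → indicator (lookup (block n a′) i F.≟ v)) ℕ.+ sum bad
          ≤⟨ ℕ.+-mono-≤ (ℕ.≤-reflexive (count-sum v (block n a′))) few ⟩
        count v (block n a′) ℕ.+ T
          <⟨ ℕ.≤-reflexive (sym (ℕ.+-suc (count v (block n a′)) T)) ⟩
        count v (block n a′) ℕ.+ suc T
          ≤⟨ subst (λ t → count t (block n a′) ℕ.+ suc T ≤ count F.zero (block n a′)) (sym (proj₂ v≢0)) (ahead (proj₁ v≢0)) ⟩
        count F.zero (block n a′) ∎
        where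
        open ℕ.≤-Reasoning
        hit : ∀ i → bad i ≡ 0 → lookup (block n a) i ≡ F.zero → lookup (block n a′) i ≡ v
        hit i good zero-block with block-shift (toℕ i) e (nr i good) (safe-high a i safe)
        ... | j , ej = trans (lookup-block a′ i) (toℕ-injective (trans (toℕ-mod (high (toℕ i) a′ ℕ./ W) q)
            (trans (residue-unique (high (toℕ i) a′ ℕ./ W) ((+ (B ℕ./ q) + (ρ /ℕ q)) + j) (n%ℕd<d ρ q) total) (sym (toℕ-fromℕ< (n%ℕd<d ρ q))))))
          where
          B = high (toℕ i) a ℕ./ W
          B%q : B ℕ.% q ≡ 0
          B%q = trans (sym (toℕ-mod B q)) (cong toℕ (trans (sym (lookup-block a i)) zero-block))
          lemma : ∀ b q x d j → ((b * q + 0ℤ) + (x + d * q)) + j * q ≡ ((b + d) + j) * q + x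
          lemma = solve-∀
          total : + (high (toℕ i) a′ ℕ./ W) ≡ ((+ (B ℕ./ q) + (ρ /ℕ q)) + j) * + q + + (ρ %ℕ q)
          total = trans ej (trans (cong₂ (λ s t → (s + t) + j * + q)
            (trans (pos-division B q) (cong (λ t → + (B ℕ./ q) * + q + + t) B%q)) (a≡a%ℕn+[a/ℕn]*n ρ q))
            (lemma (+ (B ℕ./ q)) (+ q) (+ (ρ %ℕ q)) (ρ /ℕ q) j))
        pointwise : ∀ i → indicator (lookup (block n a) i F.≟ F.zero) ≤ indicator (lookup (block n a′) i F.≟ v) ℕ.+ bad i
        pointwise i with bad i in eq
        ... | suc k = ℕ.≤-trans (indicator≤1 (lookup (block n a) i F.≟ F.zero)) (ℕ.m≤n⇒m≤o+n _ (s≤s z≤n))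
        ... | zero = ℕ.≤-trans (indicator-mono (lookup (block n a) i F.≟ F.zero) (lookup (block n a′) i F.≟ v) (hit i eq)) (ℕ.m≤m+n _ 0)

    value : ∀ {n} → Word n → ℕ
    value [] = 0
    value (a ∷ x) = W ℕ.* toℕ a ℕ.+ Q ℕ.* value x

    value< : ∀ {n} (x : Word n) → value x < Q ^ n
    value< [] = s≤s z≤n
    value< {suc n} (a ∷ x) = ℕ.<-≤-trans (ℕ.+-monoˡ-< (Q ℕ.* value x) (subst (W ℕ.* toℕ a <_) (ℕ.*-comm W q) (ℕ.*-monoʳ-< W (toℕ<n a))))
      (ℕ.≤-trans (ℕ.≤-reflexive (sym (ℕ.*-suc Q (value x)))) (ℕ.*-monoʳ-≤ Q (value< x)))

    mismatch : ∀ {n} → Word n → Word n → Fin n → ℕ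
    mismatch x y i = 1 ∸ indicator (lookup y i F.≟ rotate (lookup x i))

    sum-mismatch : ∀ {n} (x y : Word n) → sum (mismatch x y) ≡ errors x y
    sum-mismatch [] [] = refl
    sum-mismatch (a ∷ x) (b ∷ y) = cong (ℕ._+_ (1 ∸ indicator (b F.≟ rotate a))) (sum-mismatch x y)

    mismatch≡0 : ∀ {n} (x y : Word n) i → mismatch x y i ≡ 0 → lookup y i ≡ rotate (lookup x i)
    mismatch≡0 x y i e with lookup y i F.≟ rotate (lookup x i)
    ... | yes p = p

    rotate-step : ∀ (a : Fin q) → ∃ λ j → + toℕ (rotate a) ≡ (+ toℕ a + 1ℤ) + j * + q
    rotate-step a with %-suc-cases q (toℕ<n a)
    ... | inj₁ (_ , e) = 0ℤ , trans (cong +_ (trans (toℕ-mod (suc (toℕ a)) q) e)) (trans (cong +_ (ℕ.+-comm 1 (toℕ a))) (sym (+-identityʳ (+ toℕ a + 1ℤ))))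
    ... | inj₂ (eq , e) = -1ℤ , trans (cong +_ (trans (toℕ-mod (suc (toℕ a)) q) e))
      (sym (trans (cong₂ _+_ (cong +_ (trans (ℕ.+-comm (toℕ a) 1) eq)) (-1*i≡-i (+ q))) (+-inverseʳ (+ q))))

    toℕ-difference : ∀ (a b : Fin q) → ∣ + toℕ b - + toℕ a ∣ ≤ r
    toℕ-difference a b = subst (λ t → ∣ t ∣ ≤ r) (sym (m-n≡m⊖n (toℕ b) (toℕ a)))
      (ℕ.≤-trans (∣m⊝n∣≤m⊔n (toℕ b) (toℕ a)) (ℕ.≤-pred (ℕ.⊔-lub (toℕ<n b) (toℕ<n a))))

    -- Seen from a rotated coordinate `i`, the higher digits contribute multiples of `q * W * Q ^ i`
    -- and the lower ones less than `Q ^ i` in total. The strict bound is kept because it carries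
    -- the induction and later shows that steps are nonzero.
    near-value : ∀ {n} (x y : Word n) i → lookup y i ≡ rotate (lookup x i) →
      Σ (Near (toℕ i) 1ℤ 1 (+ value y - + value x)) λ nr → ∣ Near.error nr ∣ < Q ^ toℕ i
    near-value (a ∷ x) (b ∷ y) F.zero refl with rotate-step a
    ... | j , e = near (j + (+ value y - + value x)) 0ℤ (begin
        + (W ℕ.* toℕ b′ ℕ.+ Q ℕ.* value y) - + (W ℕ.* toℕ a ℕ.+ Q ℕ.* value x)
          ≡⟨ cong₂ _-_ (cong₂ _+_ (pos-* W (toℕ b′)) (pos-* Q (value y))) (cong₂ _+_ (pos-* W (toℕ a)) (pos-* Q (value x))) ⟩
        (+ W * + toℕ b′ + + Q * + value y) - (+ W * + toℕ a + + Q * + value x)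
          ≡⟨ cong₂ (λ s t → (+ W * s + t * + value y) - (+ W * + toℕ a + t * + value x)) e (pos-* q W) ⟩
        (+ W * ((+ toℕ a + 1ℤ) + j * + q) + + q * + W * + value y) - (+ W * + toℕ a + + q * + W * + value x)
          ≡⟨ lemma (+ W) (+ toℕ a) j (+ q) (+ value y) (+ value x) ⟩
        (1ℤ + (j + (+ value y - + value x)) * + q) * + W + 0ℤ
          ≡⟨ cong (λ t → (1ℤ + (j + (+ value y - + value x)) * + q) * + t + 0ℤ) (sym (ℕ.*-identityʳ W)) ⟩
        (1ℤ + (j + (+ value y - + value x)) * + q) * + (W ℕ.* 1) + 0ℤ ∎) z≤n , s≤s z≤n
      where
      open ≡-Reasoning
      b′ = rotate a
      lemma : ∀ W a j q y x → (W * ((a + 1ℤ) + j * q) + q * W * y) - (W * a + q * W * x) ≡ (1ℤ + (j + (y - x)) * q) * W + 0ℤ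
      lemma = solve-∀
    near-value (a ∷ x) (b ∷ y) (F.suc i) e with near-value x y i e
    ... | near j ε s _ , lt = near j ε′ (begin
        + (W ℕ.* toℕ b ℕ.+ Q ℕ.* value y) - + (W ℕ.* toℕ a ℕ.+ Q ℕ.* value x)
          ≡⟨ cong₂ _-_ (cong₂ _+_ (pos-* W (toℕ b)) (pos-* Q (value y))) (cong₂ _+_ (pos-* W (toℕ a)) (pos-* Q (value x))) ⟩
        (+ W * + toℕ b + + Q * + value y) - (+ W * + toℕ a + + Q * + value x)
          ≡⟨ lemma (+ W) (+ toℕ b) (+ Q) (+ value y) (+ toℕ a) (+ value x) ⟩
        + Q * (+ value y - + value x) + + W * (+ toℕ b - + toℕ a)
          ≡⟨ cong (λ t → + Q * t + + W * (+ toℕ b - + toℕ a)) s ⟩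
        + Q * ((1ℤ + j * + q) * + (W ℕ.* P) + ε) + + W * (+ toℕ b - + toℕ a)
          ≡⟨ lemma′ (+ Q) (1ℤ + j * + q) (+ (W ℕ.* P)) ε (+ W * (+ toℕ b - + toℕ a)) ⟩
        (1ℤ + j * + q) * (+ Q * + (W ℕ.* P)) + ε′
          ≡⟨ cong (λ t → (1ℤ + j * + q) * t + ε′) (trans (sym (pos-* Q (W ℕ.* P))) (cong +_ (lemma″ Q W P))) ⟩
        (1ℤ + j * + q) * + (W ℕ.* (Q ℕ.* P)) + ε′ ∎)
        (ℕ.≤-trans (ℕ.<⇒≤ bound) (ℕ.≤-reflexive (sym (ℕ.*-identityˡ (Q ℕ.* P))))) , bound
      where
      open ≡-Reasoning
      P = Q ^ toℕ i
      ε′ = + Q * ε + + W * (+ toℕ b - + toℕ a)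
      lemma : ∀ W b Q y a x → (W * b + Q * y) - (W * a + Q * x) ≡ Q * (y - x) + W * (b - a)
      lemma = solve-∀
      lemma′ : ∀ Q m U ε w → Q * (m * U + ε) + w ≡ m * (Q * U) + (Q * ε + w)
      lemma′ = solve-∀
      lemma″ : ∀ Q W P → Q ℕ.* (W ℕ.* P) ≡ W ℕ.* (Q ℕ.* P)
      lemma″ = ℕSolver.solve-∀
      Wr<Q : W ℕ.* r < Q
      Wr<Q = subst (W ℕ.* r <_) (ℕ.*-comm W q) (ℕ.*-monoʳ-< W (ℕ.n<1+n r))
      bound : ∣ ε′ ∣ < Q ℕ.* P
      bound = ℕ.≤-<-trans (∣i+j∣≤∣i∣+∣j∣ (+ Q * ε) (+ W * (+ toℕ b - + toℕ a)))
        (ℕ.≤-<-trans (ℕ.+-mono-≤ (ℕ.≤-reflexive (abs-* (+ Q) ε))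
            (ℕ.≤-trans (ℕ.≤-reflexive (abs-* (+ W) (+ toℕ b - + toℕ a))) (ℕ.*-monoʳ-≤ W (toℕ-difference a b))))
          (ℕ.<-≤-trans (ℕ.+-monoʳ-< (Q ℕ.* ∣ ε ∣) Wr<Q)
            (ℕ.≤-trans (ℕ.≤-reflexive (trans (ℕ.+-comm (Q ℕ.* ∣ ε ∣) Q) (sym (ℕ.*-suc Q ∣ ε ∣)))) (ℕ.*-monoʳ-≤ Q lt))))

-- Integer sums, divisibility, large primes and small supports.

module Integer-Sums where

  open import Data.Nat using (ℕ; zero; suc; _≤_; _<_; z≤n; NonZero; _!)
  import Data.Nat as ℕ
  import Data.Nat.Properties as ℕ
  import Data.Nat.Divisibility as ℕ
  open import Data.Nat.Primality using (Prime; prime⇒nonTrivial)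
  open import Data.Nat.Primality.Factorisation using (factorise; PrimeFactorisation)
  open import Data.Integer using (ℤ; +_; _+_; _*_; ∣_∣; 0ℤ)
  open import Data.Integer.Properties
  open import Data.Integer.Tactic.RingSolver using (solve-∀)
  open import Data.Integer.Divisibility.Signed using (_∣_; divides; ∣m∣n⇒∣m+n)
  open import Data.List using ([]; _∷_)
  open import Data.Nat.ListAction using (product)
  open import Data.List.Relation.Unary.All using ([]; _∷_)
  open import Data.Fin.Subset using (Subset; _∈_)
  import Data.Fin.Subset as Subset
  open import Algebra.Properties.Semiring.Sum ℕ.+-*-semiring using (sum)
  open import Defs using (∑; ∑over)
  open Cyclic-Labels using (indicator)

  -- Euclid's argument: no prime factor of `N ! + 1` is at most `N`.
  prime-above : ∀ N → ∃ λ q → Prime q × N < q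
  prime-above N = from-factors (PrimeFactorisation.factors F) (PrimeFactorisation.isFactorisation F) (PrimeFactorisation.factorsPrime F)
    where
    F = factorise (suc (N !))
    n∣n! : ∀ n .{{_ : NonZero n}} → n ℕ.∣ n !
    n∣n! (suc n) = ℕ.m∣m*n (n !)
    from-factors : ∀ as → suc (N !) ≡ product as → Data.List.Relation.Unary.All.All Prime as → ∃ λ q → Prime q × N < q
    from-factors [] e [] = contradiction (ℕ.suc-injective e) (ℕ.≢-nonZero⁻¹ (N !) {{ℕ.>-nonZero (ℕ.1≤n! N)}})
    from-factors (q ∷ as) e (pq ∷ _) with q ℕ.≤? N
    ... | no q≰N = q , pq , ℕ.≰⇒> q≰N
    ... | yes q≤N = contradiction (ℕ.∣1⇒≡1 q∣1) (ℕ.>⇒≢ (ℕ.nonTrivial⇒n>1 q {{prime⇒nonTrivial pq}}))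
      where
      q∣1 : q ℕ.∣ 1
      q∣1 = ℕ.∣m+n∣m⇒∣n (subst (q ℕ.∣_) (trans (sym e) (ℕ.+-comm 1 (N !))) (ℕ.m∣m*n (product as)))
        (ℕ.∣-trans (n∣n! q {{ℕ.nonTrivial⇒nonZero q {{prime⇒nonTrivial pq}}}}) (ℕ.m≤n⇒m!∣n! q≤N))

  ∑-cong : ∀ {k} {f g : Fin k → ℤ} → (∀ i → f i ≡ g i) → ∑ f ≡ ∑ g
  ∑-cong {zero} e = refl
  ∑-cong {suc k} e = cong₂ _+_ (e F.zero) (∑-cong (e ∘ F.suc))

  ∑-+ : ∀ {k} (f g : Fin k → ℤ) → ∑ (λ i → f i + g i) ≡ ∑ f + ∑ g
  ∑-+ {zero} f g = refl
  ∑-+ {suc k} f g = trans (cong (_+_ (f F.zero + g F.zero)) (∑-+ (f ∘ F.suc) (g ∘ F.suc)))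
    (lemma (f F.zero) (g F.zero) (∑ (f ∘ F.suc)) (∑ (g ∘ F.suc)))
    where
    lemma : ∀ a b x y → (a + b) + (x + y) ≡ (a + x) + (b + y)
    lemma = solve-∀

  ∑-*ˡ : ∀ {k} a (f : Fin k → ℤ) → ∑ (λ i → a * f i) ≡ a * ∑ f
  ∑-*ˡ {zero} a f = sym (*-zeroʳ a)
  ∑-*ˡ {suc k} a f = trans (cong (_+_ (a * f F.zero)) (∑-*ˡ a (f ∘ F.suc))) (sym (*-distribˡ-+ a (f F.zero) (∑ (f ∘ F.suc))))

  ∑-bound : ∀ {k} B (c z : Fin k → ℤ) → (∀ i → ∣ z i ∣ ≤ B) → ∣ ∑ (λ i → c i * z i) ∣ ≤ sum (λ i → ∣ c i ∣) ℕ.* B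
  ∑-bound {zero} B c z le = z≤n
  ∑-bound {suc k} B c z le = ℕ.≤-trans (∣i+j∣≤∣i∣+∣j∣ (c F.zero * z F.zero) _)
    (ℕ.≤-trans (ℕ.+-mono-≤ (ℕ.≤-trans (ℕ.≤-reflexive (abs-* (c F.zero) (z F.zero))) (ℕ.*-monoʳ-≤ ∣ c F.zero ∣ (le F.zero)))
                           (∑-bound B (c ∘ F.suc) (z ∘ F.suc) (le ∘ F.suc)))
      (ℕ.≤-reflexive (sym (ℕ.*-distribʳ-+ B ∣ c F.zero ∣ (sum (λ i → ∣ c (F.suc i) ∣))))))

  ∑-∣ : ∀ {k p} (f : Fin k → ℤ) → (∀ i → p ∣ f i) → p ∣ ∑ f
  ∑-∣ {zero} f d = divides 0ℤ refl
  ∑-∣ {suc k} f d = ∣m∣n⇒∣m+n (d F.zero) (∑-∣ (f ∘ F.suc) (d ∘ F.suc))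

  ∣⇒≡0 : ∀ {p z} → + p ∣ z → ∣ z ∣ < p → z ≡ 0ℤ
  ∣⇒≡0 {p} {z} (divides j e) lt = trans e (trans (cong (_* + p) (∣i∣≡0⇒i≡0 {j} (small ∣ j ∣ (subst (_< p) (trans (cong ∣_∣ e) (abs-* j (+ p))) lt)))) refl)
    where
    small : ∀ k → k ℕ.* p < p → k ≡ 0
    small zero _ = refl
    small (suc k) lt = contradiction lt (ℕ.≤⇒≯ (ℕ.m≤m+n p (k ℕ.* p)))

  -- The reduction of the sum is recorded for every `g`, as it is needed both for `c` and for the
  -- products of `c` with the big lifts.
  data SmallSupport {k} (J : Subset k) : Set where
    empty : Subset.∣ J ∣ ≡ 0 → (∀ g → ∑over J g ≡ 0ℤ) → SmallSupport J
    one   : ∀ i → Subset.∣ J ∣ ≡ 1 → lookup J i ≡ true → (∀ g → ∑over J g ≡ g i) → SmallSupport J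
    two   : ∀ i j → Subset.∣ J ∣ ≡ 2 → lookup J i ≡ true → lookup J j ≡ true → (∀ g → ∑over J g ≡ g i + g j) → SmallSupport J
    many  : 3 ≤ Subset.∣ J ∣ → SmallSupport J

  small-support : ∀ {k} (J : Subset k) → SmallSupport J
  small-support [] = empty refl (λ _ → refl)
  small-support (false ∷ J) with small-support J
  ... | empty s e = empty s (λ g → trans (+-identityˡ _) (e (g ∘ F.suc)))
  ... | one i s pi e = one (F.suc i) s pi (λ g → trans (+-identityˡ _) (e (g ∘ F.suc)))
  ... | two i j s pi pj e = two (F.suc i) (F.suc j) s pi pj (λ g → trans (+-identityˡ _) (e (g ∘ F.suc)))
  ... | many le = many le
  small-support (true ∷ J) with small-support J
  ... | empty s e = one F.zero (cong suc s) refl (λ g → trans (cong (_+_ (g F.zero)) (e (g ∘ F.suc))) (+-identityʳ _))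
  ... | one i s pi e = two F.zero (F.suc i) (cong suc s) refl pi (λ g → cong (_+_ (g F.zero)) (e (g ∘ F.suc)))
  ... | two i j s _ _ _ = many (ℕ.≤-reflexive (cong suc (sym s)))
  ... | many le = many (ℕ.m≤n⇒m≤1+n le)

  select : ∀ {p} {R : Fin p → Set} → (∀ i → Dec (R i)) → Subset p
  select d = tabulate (λ i → does (d i))

  select-∈ : ∀ {p} {R : Fin p → Set} (d : ∀ i → Dec (R i)) i → R i → i ∈ select d
  select-∈ d i r = lookup⇒[]= i (select d) (trans (lookup∘tabulate _ i) (dec-true (d i) r))

  ∈-select : ∀ {p} {R : Fin p → Set} (d : ∀ i → Dec (R i)) i → i ∈ select d → R i
  ∈-select d i m with d i | trans (sym (lookup∘tabulate (λ i → does (d i)) i)) ([]=⇒lookup m)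
  ... | yes r | _ = r
  ... | no _ | ()

  ∣select∣ : ∀ {p} {R : Fin p → Set} (d : ∀ i → Dec (R i)) → Subset.∣ select d ∣ ≡ sum (λ i → indicator (d i))
  ∣select∣ {zero} d = refl
  ∣select∣ {suc p} d with d F.zero
  ... | yes _ = cong suc (∣select∣ (d ∘ F.suc))
  ... | no _ = ∣select∣ (d ∘ F.suc)

-- The set `A`, and why it contains no solution.

module Solution-Free-Set where

  open import Data.Nat using (ℕ; zero; suc; _≤_; _<_; _∸_; _^_; z≤n; NonZero)
  import Data.Nat as ℕ
  import Data.Nat.Properties as ℕ
  import Data.Nat.Tactic.RingSolver as ℕSolver
  open import Data.Integer using (ℤ; +_; _+_; _-_; _*_; -_; ∣_∣; 0ℤ; 1ℤ; _≟_)
  open import Data.Integer.Properties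
  open import Data.Integer.DivMod using (_%ℕ_; _/ℕ_; a≡a%ℕn+[a/ℕn]*n)
  open import Data.Integer.Tactic.RingSolver using (solve-∀)
  open import Data.Integer.Divisibility.Signed using (_∣_; divides; ∣ᵤ⇒∣; ∣m∣n⇒∣m-n; ∣n⇒∣m*n; _∣?_)
  open import Data.Fin.Subset using (Subset; _∈_)
  import Data.Fin.Subset as Subset
  open import Algebra.Properties.Semiring.Sum ℕ.+-*-semiring using (sum; ∑-comm)
  open import Defs
  open Cyclic-Labels
  open Cube-Faces using (errors)
  open Colour-Labels using (sum-bound)
  open Leading-Letters
  open Block-Shifts
  open Integer-Sums

  %ℕ≢0 : ∀ {q} ρ .{{_ : NonZero q}} → ρ ≢ 0ℤ → ∣ ρ ∣ < q → ρ %ℕ q ≢ 0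
  %ℕ≢0 {q} ρ ρ≢0 lt e = ρ≢0 (∣⇒≡0 (divides (ρ /ℕ q) (trans (a≡a%ℕn+[a/ℕn]*n ρ q) (trans (cong (λ t → + t + (ρ /ℕ q) * + q) e) (+-identityˡ _)))) lt)

  any-word? : ∀ {q n} (R : Vec (Fin q) n → Set) → (∀ x → Dec (R x)) → Dec (∃ R)
  any-word? {n = zero} R R? with R? []
  ... | yes p = yes ([] , p)
  ... | no ¬p = no λ { ([] , p) → ¬p p }
  any-word? {n = suc n} R R? with any? (λ a → any-word? (R ∘ (a ∷_)) (λ x → R? (a ∷ x)))
  ... | yes (a , x , p) = yes (a ∷ x , p)
  ... | no ¬p = no λ { (a ∷ x , p) → ¬p (a , x , p) }

  module Construction (K D r W n m T p w : ℕ) .{{_ : NonZero W}} where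

    open Shifts r W (K ℕ.* D) public

    -- Since 8K²w ≤ p, no combination of elements of [base, base + w) whose coefficients have nonzero sum
    -- can be cancelled modulo p by terms of size at most w.
    base : ℕ
    base = 4 ℕ.* K ℕ.* w

    Big : ℕ → Set
    Big a = base ≤ a × a < base ℕ.+ w × Core n (suc T) a

    step : Word n → Word n → ℤ
    step x y = + value y - + value x

    Small : ℕ → Set
    Small a = ∃ λ x → ∃ λ y → errors x y ≤ m × + p ∣ + a - + D * step x y

    big? : ∀ a → Dec (Big a)
    big? a = (base ℕ.≤? a) ×-dec ((a ℕ.<? base ℕ.+ w) ×-dec core? n (suc T) a)

    small? : ∀ a → Dec (Small a)
    small? a = any-word? _ (λ x → any-word? _ (λ y → (errors x y ℕ.≤? m) ×-dec (+ p ∣? (+ a - + D * step x y))))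

    member? : ∀ (i : Fin p) → Dec (Big (toℕ i) ⊎ Small (toℕ i))
    member? i = big? (toℕ i) ⊎-dec small? (toℕ i)

    A : Subset p
    A = select member?

    ∣step∣ : ∀ x y → ∣ step x y ∣ ≤ Q ^ n
    ∣step∣ x y = subst (λ z → ∣ z ∣ ≤ Q ^ n) (sym (m-n≡m⊖n (value y) (value x)))
      (ℕ.≤-trans (∣m⊝n∣≤m⊔n (value y) (value x)) (ℕ.⊔-lub (ℕ.<⇒≤ (value< y)) (ℕ.<⇒≤ (value< x))))

    -- An element of A lifted to the integer h + D s: h is the lift of a big element and s the step of a small one.
    record Piece (a : ℕ) : Set where
      field
        flag       : Bool
        h e s ρ    : ℤ
        bad        : Fin n → ℕ
        congruent  : + p ∣ + a - (h + + D * s)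
        located    : h + + D * s ≡ (if flag then + base else 0ℤ) + e
        e-small    : ∣ e ∣ ≤ w
        ρ-flag     : ρ ≡ (if flag then 0ℤ else 1ℤ)
        h-flag     : h ≡ (if flag then h else 0ℤ)
        h-core     : flag ≡ true → ∃ λ b → h ≡ + b × Core n (suc T) b
        few        : sum bad ≤ m
        approach   : ∀ j → bad j ≡ 0 → Near (toℕ j) ρ 1 s

    big-piece : ∀ {a} → Big a → Piece a
    big-piece {a} (le , lt , core) = record
      { flag = true ; h = + a ; e = + (a ∸ base) ; s = 0ℤ ; ρ = 0ℤ ; bad = λ _ → 0
      ; congruent = divides 0ℤ (lemma (+ a) (+ D))
      ; located = trans (lemma′ (+ a) (+ D)) (cong +_ (sym (ℕ.m+[n∸m]≡n le)))
      ; e-small = ℕ.≤-trans (ℕ.∸-monoˡ-≤ base (ℕ.<⇒≤ lt)) (ℕ.≤-reflexive (ℕ.m+n∸m≡n base w))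
      ; ρ-flag = refl
      ; h-flag = refl
      ; h-core = λ _ → a , refl , core
      ; few = ℕ.≤-trans (ℕ.≤-reflexive (trans (sum-const n 0) (ℕ.*-zeroʳ n))) z≤n
      ; approach = λ j _ → near-weaken z≤n near-zero
      }
      where
      lemma : ∀ a D → a - (a + D * 0ℤ) ≡ 0ℤ
      lemma = solve-∀
      lemma′ : ∀ a D → a + D * 0ℤ ≡ a
      lemma′ = solve-∀

    small-piece : D ℕ.* Q ^ n ≤ w → ∀ {a} → Small a → Piece a
    small-piece le {a} (x , y , err , dvd) = record
      { flag = false ; h = 0ℤ ; e = + D * step x y ; s = step x y ; ρ = 1ℤ ; bad = mismatch x y
      ; congruent = subst (λ z → + p ∣ + a - z) (sym (+-identityˡ (+ D * step x y))) dvd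
      ; located = refl
      ; e-small = ℕ.≤-trans (ℕ.≤-reflexive (abs-* (+ D) (step x y))) (ℕ.≤-trans (ℕ.*-monoʳ-≤ D (∣step∣ x y)) le)
      ; ρ-flag = refl
      ; h-flag = refl
      ; h-core = λ ()
      ; few = ℕ.≤-trans (ℕ.≤-reflexive (sum-mismatch x y)) err
      ; approach = λ j z → proj₁ (near-value x y j (mismatch≡0 x y j z))
      }

    -- `T-room` lets the margin absorb the positions missed by all `k` entries together, `q-large`
    -- keeps every shift `η * ∑ c` nonzero modulo `q`, and `witness` serves the case without big
    -- entries.
    module Free {k : ℕ} (c : Fin k → ℤ) (K≡ : sum (λ i → ∣ c i ∣) ≡ K) (0<K : 0 < K) (0<w : 0 < w)
      (c≢0 : ∀ i → c i ≢ 0ℤ) (D≢0 : D ≢ 0)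
      (cofactor : ∀ i → ∃ λ η → + D ≡ c i * η × ∣ η ∣ ≤ D)
      (no-zero-sum : ¬ (Σ (Subset k) λ I → 3 ≤ Subset.∣ I ∣ × ∑over I c ≡ 0ℤ))
      (σ≢0 : ∑ c ≢ 0ℤ) (q-large : D ℕ.* ∣ ∑ c ∣ < q)
      (D-room : D ℕ.* Q ^ n ≤ w) (p-room : 8 ℕ.* K ℕ.* K ℕ.* w ≤ p) (T-room : k ℕ.* m ≤ T)
      (witness : ∃ λ a → Core n (suc T) a)
      where

      module _ (x : Fin k → Fin p) (x∈A : ∀ i → x i ∈ A) (dvd : + p ∣ ∑ (λ i → c i * toℤ (x i))) where

        private
          piece : ∀ i → Piece (toℕ (x i))
          piece i = [ big-piece , small-piece D-room ]′ (∈-select member? (x i) (x∈A i))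

          open module P (i : Fin k) = Piece (piece i)

          z : Fin k → ℤ
          z i = h i + + D * s i

          J : Subset k
          J = tabulate flag

          ∑over-J : ∀ f → ∑over J f ≡ ∑ (λ i → if flag i then f i else 0ℤ)
          ∑over-J f = ∑-cong (λ i → cong (λ t → if t then f i else 0ℤ) (lookup∘tabulate flag i))

          σJ S : ℤ
          σJ = ∑over J c
          S = ∑ (λ i → c i * s i)

          z-bound : ∀ i → ∣ z i ∣ ≤ base ℕ.+ w
          z-bound i = subst (λ t → ∣ t ∣ ≤ base ℕ.+ w) (sym (located i))
            (ℕ.≤-trans (∣i+j∣≤∣i∣+∣j∣ (if flag i then + base else 0ℤ) (e i)) (ℕ.+-mono-≤ (head (flag i)) (e-small i)))
            where
            head : ∀ f → ∣ if f then + base else 0ℤ ∣ ≤ base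
            head true = ℕ.≤-refl
            head false = z≤n

          -- The left side is at most `5 * K * K * w`, which the 8 in `p-room` exceeds.
          total<p : K ℕ.* (base ℕ.+ w) < p
          total<p = ℕ.<-≤-trans (ℕ.<-≤-trans (ℕ.≤-<-trans first second) (ℕ.≤-reflexive (lemma₂ K w))) p-room
            where
            lemma₁ : ∀ K w → K ℕ.* (4 ℕ.* K ℕ.* w ℕ.+ K ℕ.* w) ≡ 5 ℕ.* (K ℕ.* K ℕ.* w)
            lemma₁ = ℕSolver.solve-∀
            lemma₂ : ∀ K w → 8 ℕ.* (K ℕ.* K ℕ.* w) ≡ 8 ℕ.* K ℕ.* K ℕ.* w
            lemma₂ = ℕSolver.solve-∀
            w≤Kw : w ≤ K ℕ.* w
            w≤Kw = ℕ.m≤n*m w K {{ℕ.>-nonZero 0<K}}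
            first : K ℕ.* (base ℕ.+ w) ≤ 5 ℕ.* (K ℕ.* K ℕ.* w)
            first = ℕ.≤-trans (ℕ.*-monoʳ-≤ K (ℕ.+-monoʳ-≤ base w≤Kw)) (ℕ.≤-reflexive (lemma₁ K w))
            second : 5 ℕ.* (K ℕ.* K ℕ.* w) < 8 ℕ.* (K ℕ.* K ℕ.* w)
            second = ℕ.*-monoˡ-< (K ℕ.* K ℕ.* w)
              {{ℕ.m*n≢0 (K ℕ.* K) w {{ℕ.m*n≢0 K K {{ℕ.>-nonZero 0<K}} {{ℕ.>-nonZero 0<K}}}} {{ℕ.>-nonZero 0<w}}}}
              {5} {8} (ℕ.m≤m+n 6 2)

          -- The lifts are so short that their combination stays below `p` in absolute value, which
          -- turns the congruence into an equation of integers.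
          lifted : ∑ (λ i → c i * z i) ≡ 0ℤ
          lifted = ∣⇒≡0 {p} difference (ℕ.≤-<-trans (∑-bound (base ℕ.+ w) c z z-bound) (subst (λ t → t ℕ.* (base ℕ.+ w) < p) (sym K≡) total<p))
            where
            regroup : ∑ (λ i → c i * toℤ (x i)) ≡ ∑ (λ i → c i * (toℤ (x i) - z i)) + ∑ (λ i → c i * z i)
            regroup = trans (∑-cong (λ i → lemma (c i) (toℤ (x i)) (z i))) (∑-+ (λ i → c i * (toℤ (x i) - z i)) (λ i → c i * z i))
              where
              lemma : ∀ c x z → c * x ≡ c * (x - z) + c * z
              lemma = solve-∀
            cancel : ∀ a b → (a + b) - a ≡ b
            cancel = solve-∀
            difference : + p ∣ ∑ (λ i → c i * z i)
            difference = subst (+ p ∣_)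
              (trans (cong (_- ∑ (λ i → c i * (toℤ (x i) - z i))) regroup)
                (cancel (∑ (λ i → c i * (toℤ (x i) - z i))) (∑ (λ i → c i * z i))))
              (∣m∣n⇒∣m-n dvd (∑-∣ _ (λ i → ∣n⇒∣m*n (c i) (congruent i))))

          -- Big entries contribute `base * σJ`, and all remainders together at most `K * w`, which
          -- is less than `base = 4 * K * w`.
          σJ≡0 : σJ ≡ 0ℤ
          σJ≡0 = decidable-stable (σJ ≟ 0ℤ) (λ ≢0 → ℕ.<-irrefl refl (ℕ.≤-<-trans (lower ≢0) upper))
            where
            split : + base * σJ + ∑ (λ i → c i * e i) ≡ 0ℤ
            split = trans (sym (trans (∑-cong term)
              (trans (∑-+ (λ i → + base * (if flag i then c i else 0ℤ)) (λ i → c i * e i))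
                (cong (_+ ∑ (λ i → c i * e i)) (trans (∑-*ˡ (+ base) (λ i → if flag i then c i else 0ℤ))
                  (cong (_*_ (+ base)) (sym (∑over-J c)))))))) lifted
              where
              pick : ∀ f c → c * (if f then + base else 0ℤ) ≡ + base * (if f then c else 0ℤ)
              pick true c = *-comm c (+ base)
              pick false c = trans (*-zeroʳ c) (sym (*-zeroʳ (+ base)))
              term : ∀ i → c i * z i ≡ + base * (if flag i then c i else 0ℤ) + c i * e i
              term i = trans (cong (_*_ (c i)) (located i)) (trans (*-distribˡ-+ (c i) _ (e i)) (cong (_+ c i * e i) (pick (flag i) (c i))))
            negated : ∀ a b → a + b ≡ 0ℤ → ∣ a ∣ ≡ ∣ b ∣
            negated a b eq = trans (cong ∣_∣ (trans (l a b) (trans (cong (_- b) eq) (+-identityˡ (- b))))) (∣-i∣≡∣i∣ b)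
              where
              l : ∀ a b → a ≡ (a + b) - b
              l = solve-∀
            lower : σJ ≢ 0ℤ → base ≤ ∣ ∑ (λ i → c i * e i) ∣
            lower ≢0 = subst (base ≤_) (trans (sym (abs-* (+ base) σJ)) (negated (+ base * σJ) _ split))
              (ℕ.m≤m*n base ∣ σJ ∣ {{ℕ.≢-nonZero (≢0 ∘ ∣i∣≡0⇒i≡0)}})
            upper : ∣ ∑ (λ i → c i * e i) ∣ < base
            upper = ℕ.≤-<-trans (∑-bound w c e e-small) (subst (λ t → t ℕ.* w < base) (sym K≡)
              (ℕ.*-monoˡ-< w {{ℕ.>-nonZero 0<w}} (ℕ.<-≤-trans (ℕ.m<m*n K 4 {{ℕ.>-nonZero 0<K}} (ℕ.m≤m+n 2 2)) (ℕ.≤-reflexive (ℕ.*-comm K 4)))))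

          -- `ρ` is 1 on the small entries and 0 on the big ones, whose coefficients sum to `σJ`,
          -- that is, to 0.
          ∑cρ : ∑ (λ i → c i * ρ i) ≡ ∑ c
          ∑cρ = trans (sym (+-identityʳ _)) (trans (cong (_+_ (∑ (λ i → c i * ρ i))) (sym (trans (sym (∑over-J c)) σJ≡0)))
            (trans (sym (∑-+ (λ i → c i * ρ i) _)) (∑-cong term)))
            where
            pick : ∀ f c → c * (if f then 0ℤ else 1ℤ) + (if f then c else 0ℤ) ≡ c
            pick true c = trans (cong (_+ c) (*-zeroʳ c)) (+-identityˡ c)
            pick false c = trans (+-identityʳ _) (*-identityʳ c)
            term : ∀ i → c i * ρ i + (if flag i then c i else 0ℤ) ≡ c i
            term i = trans (cong (λ t → c i * t + (if flag i then c i else 0ℤ)) (ρ-flag i)) (pick (flag i) (c i))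

          balance : ∑over J (λ i → c i * h i) + + D * S ≡ 0ℤ
          balance = trans (cong₂ _+_ (trans (∑over-J _) (∑-cong (λ i → pick (flag i) (c i) (h i) (h-flag i)))) (sym (∑-*ˡ (+ D) (λ i → c i * s i))))
            (trans (sym (∑-+ (λ i → c i * h i) (λ i → + D * (c i * s i)))) (trans (∑-cong (λ i → lemma (c i) (h i) (+ D) (s i))) lifted))
            where
            pick : ∀ f c h → h ≡ (if f then h else 0ℤ) → (if f then c * h else 0ℤ) ≡ c * h
            pick true c h _ = refl
            pick false c h eq = sym (trans (cong (_*_ c) eq) (*-zeroʳ c))
            lemma : ∀ c h D s → c * h + D * (c * s) ≡ c * (h + D * s)
            lemma = solve-∀

          allBad : Fin n → ℕ
          allBad j = sum (λ i → bad i j)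

          few-bad : sum allBad ≤ T
          few-bad = ℕ.≤-trans (ℕ.≤-reflexive (∑-comm (λ j i → bad i j))) (ℕ.≤-trans (sum-bound m few) T-room)

          -- Each step carries one unit of error, so `S` carries `K` and `η * S` at most `K * D`;
          -- this is why digits keep the distance `K * D` from the ends of their intervals.
          near-S : ∀ η → ∣ η ∣ ≤ D → ∀ j → allBad j ≡ 0 → Near (toℕ j) (η * ∑ c) (K ℕ.* D) (η * S)
          near-S η η≤D j good = near-weaken
            (ℕ.≤-trans (ℕ.*-mono-≤ η≤D (ℕ.≤-reflexive K≡)) (ℕ.≤-reflexive (ℕ.*-comm D K)))
            (near-* η (subst (λ t → Near (toℕ j) t (sum (λ i → ∣ c i ∣)) S) ∑cρ
              (near-∑ c ρ s (λ i → approach i j (ℕ.n≤0⇒n≡0 (subst (bad i j ≤_) good (sum-term (λ i → bad i j) i)))))))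

          -- `lead-grows` applies from `a` to `a′` and, with the opposite shift, back again, so each
          -- number would have strictly more digits in interval 0 than the other.
          clash : ∀ η {a a′} → ∣ η ∣ ≤ D → η ≢ 0ℤ → Core n (suc T) a → Core n (suc T) a′ → + a′ ≡ + a + η * S → ⊥
          clash η {a} {a′} η≤D η≢0 (safe , ahead) (safe′ , ahead′) eq = ℕ.<-asym
            (lead-grows few-bad (%ℕ≢0 (η * ∑ c) ησ≢0 ησ<q) eq (near-S η η≤D) safe ahead′)
            (lead-grows few-bad (%ℕ≢0 (- (η * ∑ c)) -ησ≢0 (subst (_< q) (sym (∣-i∣≡∣i∣ (η * ∑ c))) ησ<q)) eq′
              (λ j good → near-neg (near-S η η≤D j good)) safe′ ahead)
            where
            ησ≢0 : η * ∑ c ≢ 0ℤ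
            ησ≢0 e0 = [ η≢0 , σ≢0 ]′ (i*j≡0⇒i≡0∨j≡0 η e0)
            -ησ≢0 : - (η * ∑ c) ≢ 0ℤ
            -ησ≢0 e0 = ησ≢0 (trans (sym (neg-involutive (η * ∑ c))) (cong -_ e0))
            ησ<q : ∣ η * ∑ c ∣ < q
            ησ<q = ℕ.≤-<-trans (ℕ.≤-trans (ℕ.≤-reflexive (abs-* η (∑ c))) (ℕ.*-monoˡ-≤ ∣ ∑ c ∣ η≤D)) q-large
            eq′ : + a ≡ + a′ + - (η * S)
            eq′ = trans (lemma (+ a) (η * S)) (cong (_+ - (η * S)) (sym eq))
              where
              lemma : ∀ a b → a ≡ (a + b) + - b
              lemma = solve-∀

          -- As the two coefficients are opposite, `balance` reads `c i * (h i - h j) + D * S ≡ 0`;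
          -- writing `D` as `c i * η` and cancelling `c i` gives `h j ≡ h i + η * S`.
          opposite-pair : ∀ i j → (∀ g → ∑over J g ≡ g i + g j) → (∃ λ a → h i ≡ + a × Core n (suc T) a) →
            (∃ λ a → h j ≡ + a × Core n (suc T) a) → (∃ λ η → + D ≡ c i * η × ∣ η ∣ ≤ D) → ⊥
          opposite-pair i j only (a , ha , core) (a′ , ha′ , core′) (η , D≡ , η≤D) = clash η η≤D η≢0 core core′ (trans (sym ha′) (trans moved (cong (_+ η * S) ha)))
            where
            η≢0 : η ≢ 0ℤ
            η≢0 e0 = D≢0 (+-injective (trans D≡ (trans (cong (_*_ (c i)) e0) (*-zeroʳ (c i)))))
            opposite : c i + c j ≡ 0ℤ
            opposite = trans (sym (only c)) σJ≡0
            lemma : ∀ ci cj hi hj η S → ci * (hj - (hi + η * S)) ≡ (ci + cj) * hj - ((ci * hi + cj * hj) + (ci * η) * S)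
            lemma = solve-∀
            product≡0 : c i * (h j - (h i + η * S)) ≡ 0ℤ
            product≡0 = trans (lemma (c i) (c j) (h i) (h j) η S) (cong₂ _-_
              (trans (cong (_* h j) opposite) refl)
              (trans (cong (λ t → (c i * h i + c j * h j) + t * S) (sym D≡)) (trans (cong (_+ + D * S) (sym (only (λ l → c l * h l)))) balance)))
            moved : h j ≡ h i + η * S
            moved = [ (λ ci≡0 → contradiction ci≡0 (c≢0 i)) , i-j≡0⇒i≡j (h j) (h i + η * S) ]′ (i*j≡0⇒i≡0∨j≡0 (c i) product≡0)

          -- The sum of c over the big indices vanishes, so at most two indices are big.
          resolve : SmallSupport J → ⊥
          resolve (many le) = no-zero-sum (J , le , σJ≡0)
          resolve (one i _ _ only) = c≢0 i (trans (sym (only c)) σJ≡0)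
          -- Without big entries `S` is 0 and yet moves digits by `∑ c` intervals; adding it to any
          -- core number makes that number clash with itself.
          resolve (empty _ only) = clash 1ℤ (ℕ.n≢0⇒n>0 D≢0) (λ ()) (proj₂ witness) (proj₂ witness)
            (sym (trans (cong (λ t → + proj₁ witness + 1ℤ * t) S≡0) (+-identityʳ _)))
            where
            S≡0 : S ≡ 0ℤ
            S≡0 = [ (λ eD → contradiction (+-injective eD) D≢0) , (λ eS → eS) ]′
              (i*j≡0⇒i≡0∨j≡0 (+ D) (trans (sym (+-identityˡ (+ D * S))) (trans (cong (_+ + D * S) (sym (only (λ i → c i * h i)))) balance)))
          resolve (two i j _ Ji Jj only) = opposite-pair i j only (h-core i (trans (sym (lookup∘tabulate flag i)) Ji))
            (h-core j (trans (sym (lookup∘tabulate flag j)) Jj)) (cofactor i)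

        no-solution : ⊥
        no-solution = resolve (small-support J)

      solution-free : SolutionFree c p A
      solution-free (x , _ , x∈A , dvd) = no-solution x x∈A (∣ᵤ⇒∣ dvd)

-- Lower bounds for the chromatic number and for the size of `A`.

module Chromatic-Number-And-Size where

  open import Data.Nat using (ℕ; zero; suc; _≤_; _<_; _∸_; _^_; z≤n; s≤s; NonZero)
  import Data.Nat as ℕ
  import Data.Nat.Properties as ℕ
  import Data.Nat.DivMod as ℕ
  open import Data.Nat.Primality using (Prime; prime⇒nonTrivial)
  import Data.Nat.Tactic.RingSolver as ℕSolver
  open import Data.Integer using (ℤ; +_; -[1+_]; _+_; _-_; _*_; -_; ∣_∣; 0ℤ; 1ℤ)
  open import Data.Integer.Properties
  open import Data.Integer.DivMod using (_%ℕ_; _/ℕ_; a≡a%ℕn+[a/ℕn]*n; n%ℕd<d)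
  open import Data.Integer.Tactic.RingSolver using (solve-∀)
  open import Data.Integer.Divisibility.Signed using (divides; ∣⇒∣ᵤ)
  open import Data.Fin.Subset using (Subset)
  import Data.Fin.Subset as Subset
  open import Algebra.Properties.Semiring.Sum ℕ.+-*-semiring using (sum)
  open import Defs
  open Cochain-Calculus using (dbl)
  open Cyclic-Labels
  open Cube-Faces using (errors)
  open Colour-Labels using (sum-mono)
  open Index-Obstruction using (1+qz≢0)
  open Near-Antipodal-Colourings using (not-proper)
  open Digit-Expansions
  open Integer-Sums
  open Solution-Free-Set

  sum<n⇒zero : ∀ {n} (f : Fin n → ℕ) → sum f < n → ∃ λ i → f i ≡ 0
  sum<n⇒zero {suc n} f lt = by-head (f F.zero) refl
    where
    by-head : ∀ a → f F.zero ≡ a → ∃ λ i → f i ≡ 0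
    by-head zero e = F.zero , e
    by-head (suc a) e = F.suc (proj₁ rest) , proj₂ rest
      where
      rest = sum<n⇒zero (f ∘ F.suc) (ℕ.≤-trans (s≤s (ℕ.m≤n+m _ a)) (ℕ.≤-pred (subst (λ t → suc (t ℕ.+ sum (f ∘ F.suc)) ≤ suc n) e lt)))

  Σℕ-witness : ∀ k (h : ℕ → ℕ) → 0 < Σℕ k h → ∃ λ i → 0 < h i
  Σℕ-witness (suc k) h lt with h k in eq
  ... | zero = Σℕ-witness k h (subst (0 <_) (ℕ.+-identityʳ (Σℕ k h)) lt)
  ... | suc _ = k , subst (0 <_) (sym eq) (s≤s z≤n)

  indicator-witness : ∀ {P : Set} (d : Dec P) → 0 < indicator d → P
  indicator-witness (yes p) _ = p

  dbl-mono : ∀ {a b} → a ≤ b → dbl a ≤ dbl b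
  dbl-mono z≤n = z≤n
  dbl-mono (s≤s le) = s≤s (s≤s (dbl-mono le))

  prodAbs : ∀ {k} → (Fin k → ℤ) → ℕ
  prodAbs {zero} c = 1
  prodAbs {suc k} c = ∣ c F.zero ∣ ℕ.* prodAbs (c ∘ F.suc)

  prodAbs≢0 : ∀ {k} (c : Fin k → ℤ) → (∀ i → c i ≢ 0ℤ) → prodAbs c ≢ 0
  prodAbs≢0 {suc k} c c≢0 e = [ c≢0 F.zero ∘ ∣i∣≡0⇒i≡0 , prodAbs≢0 (c ∘ F.suc) (c≢0 ∘ F.suc) ]′ (ℕ.m*n≡0⇒m≡0∨n≡0 ∣ c F.zero ∣ e)

  ∣prodAbs : ∀ {k} (c : Fin k → ℤ) i → ∃ λ e → prodAbs c ≡ ∣ c i ∣ ℕ.* e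
  ∣prodAbs c F.zero = prodAbs (c ∘ F.suc) , refl
  ∣prodAbs c (F.suc i) with ∣prodAbs (c ∘ F.suc) i
  ... | e , eq = ∣ c F.zero ∣ ℕ.* e , trans (cong (ℕ._*_ ∣ c F.zero ∣) eq) (lemma ∣ c F.zero ∣ ∣ c (F.suc i) ∣ e)
    where
    lemma : ∀ a b e → a ℕ.* (b ℕ.* e) ≡ b ℕ.* (a ℕ.* e)
    lemma = ℕSolver.solve-∀

  signed-quotient : ∀ a e → ∃ λ η → + (∣ a ∣ ℕ.* e) ≡ a * η × ∣ η ∣ ≡ e
  signed-quotient (+ a) e = + e , pos-* a e , refl
  signed-quotient -[1+ a ] e = - + e , trans (pos-* (suc a) e) (lemma (+ suc a) (+ e)) , ∣-i∣≡∣i∣ (+ e)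
    where
    lemma : ∀ a e → a * e ≡ (- a) * (- e)
    lemma = solve-∀

  prodAbs-cofactor : ∀ {k} (c : Fin k → ℤ) → (∀ i → c i ≢ 0ℤ) → ∀ i → ∃ λ η → + prodAbs c ≡ c i * η × ∣ η ∣ ≤ prodAbs c
  prodAbs-cofactor c c≢0 i with ∣prodAbs c i
  ... | e , eq with signed-quotient (c i) e
  ... | η , eη , abs = η , trans (cong +_ eq) eη ,
    ℕ.≤-trans (ℕ.≤-reflexive abs) (ℕ.≤-trans (ℕ.m≤n*m e ∣ c i ∣ {{ℕ.≢-nonZero (c≢0 i ∘ ∣i∣≡0⇒i≡0)}}) (ℕ.≤-reflexive (sym eq)))

  module Chromatic (K D r W n m T p w : ℕ) .{{_ : NonZero W}} .{{_ : NonZero p}} (D≢0 : D ≢ 0) (q-prime : Prime (suc r))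
    (m<n : m < n) (room : D ℕ.* (suc r ℕ.* W) ^ n ≤ p) where

    open Construction K D r W n m T p w

    1<q : 1 < q
    1<q = ℕ.nonTrivial⇒n>1 q {{prime⇒nonTrivial q-prime}}

    -- Adjacent vertices have to be distinct. Because `m < n`, some coordinate is rotated; there the
    -- step is `W * Q ^ i` times an integer congruent to 1 modulo `q`, plus an error smaller than
    -- that unit.
    step≢0 : ∀ (x y : Word n) → errors x y ≤ m → step x y ≢ 0ℤ
    step≢0 x y err step≡0 = 1+qz≢0 1<q (Near.turns nr) factor≡0
      where
      good = sum<n⇒zero (mismatch x y) (subst (_< n) (sym (sum-mismatch x y)) (ℕ.≤-<-trans err m<n))
      i = toℕ (proj₁ good)
      nearby = near-value x y (proj₁ good) (mismatch≡0 x y (proj₁ good) (proj₂ good))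
      nr : Near i 1ℤ 1 (step x y)
      nr = proj₁ nearby
      U = W ℕ.* Q ^ i
      f = 1ℤ + Near.turns nr * + q
      instance
        Qⁱ≢0 : NonZero (Q ^ i)
        Qⁱ≢0 = ℕ.m^n≢0 Q i
        U≢0 : NonZero U
        U≢0 = ℕ.m*n≢0 W (Q ^ i)
      split : f * + U + Near.error nr ≡ 0ℤ
      split = trans (sym (Near.split nr)) step≡0
      lemma : ∀ a b → b ≡ (a + b) - a
      lemma = solve-∀
      lemma′ : ∀ f U → 0ℤ - f * U ≡ (- f) * U
      lemma′ = solve-∀
      error≡0 : Near.error nr ≡ 0ℤ
      error≡0 = ∣⇒≡0 {U} (divides (- f) (trans (lemma (f * + U) (Near.error nr)) (trans (cong (_- f * + U) split) (lemma′ f (+ U)))))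
        (ℕ.<-≤-trans (proj₂ nearby) (ℕ.m≤n*m (Q ^ i) W))
      fU≡0 : f * + U ≡ 0ℤ
      fU≡0 = trans (sym (+-identityʳ _)) (trans (cong (_+_ (f * + U)) (sym error≡0)) split)
      f≡0 : f ≡ 0ℤ
      f≡0 = [ (λ e → e) , (λ e → contradiction (+-injective e) (ℕ.≢-nonZero⁻¹ U)) ]′ (i*j≡0⇒i≡0∨j≡0 f fU≡0)
      factor≡0 : 1ℤ + + q * Near.turns nr ≡ 0ℤ
      factor≡0 = trans (cong (_+_ 1ℤ) (*-comm (+ q) (Near.turns nr))) f≡0

    -- By `room` nothing is reduced modulo `p`, so differences of places are exactly `D` times the
    -- steps.
    place : Word n → Fin p
    place x = F.fromℕ< {D ℕ.* value x} (ℕ.<-≤-trans (ℕ.*-monoʳ-< D {{ℕ.≢-nonZero D≢0}} (value< x)) room)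

    toℤ-place : ∀ x → toℤ (place x) ≡ + D * + value x
    toℤ-place x = trans (cong +_ (toℕ-fromℕ< _)) (pos-* D (value x))

    place-step : ∀ x y → toℤ (place y) - toℤ (place x) ≡ + D * step x y
    place-step x y = trans (cong₂ _-_ (toℤ-place y) (toℤ-place x)) (lemma (+ D) (+ value y) (+ value x))
      where
      lemma : ∀ D a b → D * a - D * b ≡ D * (a - b)
      lemma = solve-∀

    adjacent : ∀ (x y : Word n) → errors x y ≤ m → Adj A (place x) (place y)
    adjacent x y err = distinct , a , select-∈ member? a (inj₂ (x , y , err , divides (- (d /ℕ p)) above)) , inj₁ (∣⇒∣ᵤ (divides (d /ℕ p) below))
      where
      d = + D * step x y
      a : Fin p
      a = F.fromℕ< (n%ℕd<d d p)
      toℤ-a : toℤ a ≡ + (d %ℕ p)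
      toℤ-a = cong +_ (toℕ-fromℕ< (n%ℕd<d d p))
      lemma : ∀ x k p → x - (x + k * p) ≡ (- k) * p
      lemma = solve-∀
      lemma′ : ∀ x k p → (x + k * p) - x ≡ k * p
      lemma′ = solve-∀
      above : + toℕ a - d ≡ (- (d /ℕ p)) * + p
      above = trans (cong₂ _-_ toℤ-a (a≡a%ℕn+[a/ℕn]*n d p)) (lemma (+ (d %ℕ p)) (d /ℕ p) (+ p))
      below : (toℤ (place y) - toℤ (place x)) - toℤ a ≡ (d /ℕ p) * + p
      below = trans (cong₂ _-_ (trans (place-step x y) (a≡a%ℕn+[a/ℕn]*n d p)) toℤ-a) (lemma′ (+ (d %ℕ p)) (d /ℕ p) (+ p))
      distinct : place x ≢ place y
      distinct e = [ (λ D≡0 → D≢0 (+-injective D≡0)) , step≢0 x y err ]′ (i*j≡0⇒i≡0∨j≡0 (+ D)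
        (trans (sym (place-step x y)) (trans (cong (λ u → toℤ (place y) - toℤ u) e) (+-inverseʳ (toℤ (place y))))))

    chromatic : ∀ t → dbl (suc (t ℕ.* q)) ≤ m → ChromaticAtLeast A t
    chromatic t le M M<t (col , proper) = not-proper q q-prime (col ∘ place)
      (λ x y err → proper (place x) (place y) (adjacent x y (ℕ.≤-trans err (ℕ.≤-trans (dbl-mono (s≤s (ℕ.*-monoˡ-≤ q (ℕ.<⇒≤ M<t)))) le))))

  module Cardinality (K D r W n m T p w : ℕ) .{{_ : NonZero W}} where

    open Construction K D r W n m T p w

    instance
      P≢0 : NonZero (Q ^ n)
      P≢0 = ℕ.m^n≢0 Q n

    core-total : ℕ
    core-total = digitCount ^ n ℕ.* μ n (suc T)

    card-A : base ℕ.+ w ≤ p → w ℕ./ Q ^ n ℕ.* core-total ≤ Subset.∣ A ∣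
    card-A le = begin
      w ℕ./ Q ^ n ℕ.* core-total ≤⟨ core-interval n (suc T) base w ⟩
      Σℕ w (λ i → indicator (core? n (suc T) (base ℕ.+ i))) ≡⟨ Σℕ-cong w (λ {i} i<w → ℕ.≤-antisym
          (indicator-mono (core? n (suc T) (base ℕ.+ i)) (big? (base ℕ.+ i)) (λ co → ℕ.m≤m+n base i , ℕ.+-monoʳ-< base i<w , co))
          (indicator-mono (big? (base ℕ.+ i)) (core? n (suc T) (base ℕ.+ i)) (λ { (_ , _ , co) → co }))) ⟩
      Σℕ w (λ i → B (base ℕ.+ i)) ≤⟨ ℕ.m≤n+m _ (Σℕ base B) ⟩
      Σℕ base B ℕ.+ Σℕ w (λ i → B (base ℕ.+ i)) ≡⟨ sym (Σℕ-split base w B) ⟩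
      Σℕ (base ℕ.+ w) B ≤⟨ ℕ.m≤m+n _ _ ⟩
      Σℕ (base ℕ.+ w) B ℕ.+ Σℕ rest (λ i → B (base ℕ.+ w ℕ.+ i)) ≡⟨ sym (Σℕ-split (base ℕ.+ w) rest B) ⟩
      Σℕ (base ℕ.+ w ℕ.+ rest) B ≡⟨ cong (λ t → Σℕ t B) (ℕ.m+[n∸m]≡n le) ⟩
      Σℕ p B ≡⟨ Σℕ-sum p B ⟩
      sum {p} (B ∘ toℕ) ≤⟨ sum-mono {p} (λ i → indicator-mono (big? (toℕ i)) (member? i) inj₁) ⟩
      sum {p} (λ i → indicator (member? i)) ≡⟨ sym (∣select∣ member?) ⟩
      Subset.∣ A ∣ ∎
      where
      open ℕ.≤-Reasoning
      B : ℕ → ℕ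
      B a = indicator (big? a)
      rest = p ∸ (base ℕ.+ w)

    core-witness : 0 < core-total → ∃ λ a → Core n (suc T) a
    core-witness pos with Σℕ-witness (Q ^ n) _ (subst (0 <_) (sym (core-count n (suc T))) pos)
    ... | a , lt = a , indicator-witness (core? n (suc T) a) lt

    -- By `power-half` at least half of the offset patterns are safe, and leading words make up a
    -- share of at least `1 / (2 * q)`.
    period-bound : ∀ u → K ℕ.* D ℕ.+ u ℕ.+ K ℕ.* D ≡ W → W ≡ 2 ℕ.* (n ℕ.* (2 ℕ.* (K ℕ.* D))) → q ^ n ≤ 2 ℕ.* q ℕ.* μ n (suc T) →
      Q ^ n ≤ 4 ℕ.* q ℕ.* core-total
    period-bound u eu eW lead-many = begin
      Q ^ n ≡⟨ ^-distribˡ q W n ⟩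
      q ^ n ℕ.* W ^ n ≤⟨ ℕ.*-mono-≤ lead-many (ℕ.≤-trans W^n≤ (ℕ.*-monoʳ-≤ 2 (ℕ.^-monoˡ-≤ n (digitCount-bound u eu)))) ⟩
      2 ℕ.* q ℕ.* μ n (suc T) ℕ.* (2 ℕ.* digitCount ^ n) ≡⟨ lemma q (μ n (suc T)) (digitCount ^ n) ⟩
      4 ℕ.* q ℕ.* core-total ∎
      where
      open ℕ.≤-Reasoning
      ^-distribˡ : ∀ a b n → (a ℕ.* b) ^ n ≡ a ^ n ℕ.* b ^ n
      ^-distribˡ a b zero = refl
      ^-distribˡ a b (suc n) = trans (cong (ℕ._*_ (a ℕ.* b)) (^-distribˡ a b n)) (swap a b (a ^ n) (b ^ n))
        where
        swap : ∀ a b x y → a ℕ.* b ℕ.* (x ℕ.* y) ≡ a ℕ.* x ℕ.* (b ℕ.* y)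
        swap = ℕSolver.solve-∀
      lemma : ∀ q m d → 2 ℕ.* q ℕ.* m ℕ.* (2 ℕ.* d) ≡ 4 ℕ.* q ℕ.* (d ℕ.* m)
      lemma = ℕSolver.solve-∀
      regroup : ∀ e u → e ℕ.+ u ℕ.+ e ≡ u ℕ.+ 2 ℕ.* e
      regroup = ℕSolver.solve-∀
      W≡ : W ≡ u ℕ.+ 2 ℕ.* (K ℕ.* D)
      W≡ = trans (sym eu) (regroup (K ℕ.* D) u)
      W^n≤ : W ^ n ≤ 2 ℕ.* u ^ n
      W^n≤ = subst (λ t → t ^ n ≤ 2 ℕ.* u ^ n) (sym W≡)
        (power-half u (2 ℕ.* (K ℕ.* D)) n {{subst NonZero W≡ recomputed}} (trans (sym W≡) eW))
        where
        recomputed : NonZero W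
        recomputed = ℕ.≢-nonZero (ℕ.≢-nonZero⁻¹ W)

    -- The factor 16 combines the 4 of `period-bound` with a 2 for cutting `w` down to whole periods
    -- and a 2 for rounding in `w = p / N`.
    density : ∀ {N} → Q ^ n ≤ 4 ℕ.* q ℕ.* core-total → base ℕ.+ w ≤ p → 2 ℕ.* Q ^ n ≤ w → p ≤ N ℕ.* (2 ℕ.* w) →
      p ≤ N ℕ.* 16 ℕ.* q ℕ.* Subset.∣ A ∣
    density {N} period room long p≤ = begin
      p ≤⟨ p≤ ⟩
      N ℕ.* (2 ℕ.* w) ≤⟨ ℕ.*-monoʳ-≤ N (ℕ.*-monoʳ-≤ 2 w≤) ⟩
      N ℕ.* (2 ℕ.* (2 ℕ.* (d ℕ.* Q ^ n))) ≤⟨ ℕ.*-monoʳ-≤ N (ℕ.*-monoʳ-≤ 2 (ℕ.*-monoʳ-≤ 2 (ℕ.*-monoʳ-≤ d period))) ⟩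
      N ℕ.* (2 ℕ.* (2 ℕ.* (d ℕ.* (4 ℕ.* q ℕ.* core-total)))) ≡⟨ lemma N d q core-total ⟩
      N ℕ.* 16 ℕ.* q ℕ.* (d ℕ.* core-total) ≤⟨ ℕ.*-monoʳ-≤ (N ℕ.* 16 ℕ.* q) (card-A room) ⟩
      N ℕ.* 16 ℕ.* q ℕ.* Subset.∣ A ∣ ∎
      where
      open ℕ.≤-Reasoning
      d = w ℕ./ Q ^ n
      lemma : ∀ N d q c → N ℕ.* (2 ℕ.* (2 ℕ.* (d ℕ.* (4 ℕ.* q ℕ.* c)))) ≡ N ℕ.* 16 ℕ.* q ℕ.* (d ℕ.* c)
      lemma = ℕSolver.solve-∀
      double : ∀ a → a ℕ.+ a ≡ 2 ℕ.* a
      double = ℕSolver.solve-∀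
      w≤P+dP : w ≤ Q ^ n ℕ.+ d ℕ.* Q ^ n
      w≤P+dP = ℕ.≤-trans (ℕ.≤-reflexive (ℕ.m≡m%n+[m/n]*n w (Q ^ n))) (ℕ.+-monoˡ-≤ (d ℕ.* Q ^ n) (ℕ.<⇒≤ (ℕ.m%n<n w (Q ^ n))))
      P≤dP : Q ^ n ≤ d ℕ.* Q ^ n
      P≤dP = ℕ.+-cancelˡ-≤ (Q ^ n) _ _ (ℕ.≤-trans (ℕ.≤-reflexive (double (Q ^ n))) (ℕ.≤-trans long w≤P+dP))
      w≤ : w ≤ 2 ℕ.* (d ℕ.* Q ^ n)
      w≤ = ℕ.≤-trans w≤P+dP (ℕ.≤-trans (ℕ.+-monoˡ-≤ (d ℕ.* Q ^ n) P≤dP) (ℕ.≤-reflexive (double (d ℕ.* Q ^ n))))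

-- Choice of the parameters.

module Parameters where

  open import Data.Nat using (ℕ; suc; _≤_; _<_; _∸_; _^_; z≤n; s≤s; NonZero)
  import Data.Nat as ℕ
  import Data.Nat.Properties as ℕ
  import Data.Nat.DivMod as ℕ
  open import Data.Nat.Primality using (Prime; prime⇒nonTrivial; prime⇒nonZero)
  import Data.Nat.Tactic.RingSolver as ℕSolver
  open import Data.Integer using (ℤ; ∣_∣; 0ℤ)
  open import Data.Integer.Properties using (∣i∣≡0⇒i≡0)
  open import Data.Fin.Subset using (Subset; ⊤)
  open import Data.Fin.Subset.Properties using (∣⊤∣≡n)
  import Data.Fin.Subset as Subset
  open import Algebra.Properties.Semiring.Sum ℕ.+-*-semiring using (sum)
  open import Defs
  open Cochain-Calculus using (dbl)
  open Leading-Letters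
  open Solution-Free-Set
  open Integer-Sums
  open Chromatic-Number-And-Size

  module Assembly {k : ℕ} (3≤k : 3 ≤ k) (c : Fin k → ℤ) (c≢0 : ∀ i → c i ≢ 0ℤ)
    (no-zero-sum : ¬ (Σ (Subset k) λ I → 3 ≤ Subset.∣ I ∣ × ∑over I c ≡ 0ℤ))
    (r : ℕ) (q-prime : Prime (suc r)) (q-large : prodAbs c ℕ.* ∣ ∑ c ∣ < suc r) where

    K D E N q : ℕ
    K = sum (λ i → ∣ c i ∣)
    D = prodAbs c
    E = K ℕ.* D
    N = 8 ℕ.* K ℕ.* K
    q = suc r

    0<K : 0 < K
    0<K = positive 3≤k c c≢0
      where
      positive : ∀ {k} → 3 ≤ k → (c : Fin k → ℤ) → (∀ i → c i ≢ 0ℤ) → 0 < sum (λ i → ∣ c i ∣)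
      positive (s≤s _) c c≢0 = ℕ.<-≤-trans (ℕ.n≢0⇒n>0 (λ e → c≢0 F.zero (∣i∣≡0⇒i≡0 e))) (sum-term (λ i → ∣ c i ∣) F.zero)

    D≢0 : D ≢ 0
    D≢0 = prodAbs≢0 c c≢0

    -- The hypothesis for the full index set, admissible because `3 ≤ k`.
    σ≢0 : ∑ c ≢ 0ℤ
    σ≢0 e = no-zero-sum (⊤ , subst (3 ≤_) (sym (∣⊤∣≡n k)) 3≤k ,
      trans (∑-cong (λ i → cong (λ t → if t then c i else 0ℤ) (lookup-replicate i true))) e)

    instance
      K≢0 : NonZero K
      K≢0 = ℕ.>-nonZero 0<K
      D-nonZero : NonZero D
      D-nonZero = ℕ.≢-nonZero D≢0
      E≢0 : NonZero E
      E≢0 = ℕ.m*n≢0 K D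
      N≢0 : NonZero N
      N≢0 = ℕ.m*n≢0 (8 ℕ.* K) K {{ℕ.m*n≢0 8 K}}
      r≢0 : NonZero r
      r≢0 = ℕ.>-nonZero (ℕ.≤-pred (ℕ.nonTrivial⇒n>1 q {{prime⇒nonTrivial q-prime}}))

    module _ (t : ℕ) where

      -- `m` is the tolerance for `t` colours, and `T` bounds the positions missed by `k` entries.
      -- `l` and `n` are what `lead-density` asks for at margin `suc T`, and `W` makes the `2 * E`
      -- excluded offsets a share `1 / (2 * n)` of each interval. `N` and `q` are fixed before `t`.
      m T l n W u P : ℕ
      m = dbl (suc (t ℕ.* q))
      T = k ℕ.* m
      l = 4 ℕ.* q ℕ.* suc T
      n = Words.length-for r l
      W = 2 ℕ.* (n ℕ.* (2 ℕ.* E))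
      u = W ∸ 2 ℕ.* E
      P = (q ℕ.* W) ^ n

      m<n : m < n
      m<n = begin-strict
        m ≤⟨ ℕ.m≤n*m m k {{ℕ.>-nonZero (ℕ.<-≤-trans (s≤s z≤n) 3≤k)}} ⟩
        T <⟨ ℕ.n<1+n T ⟩
        suc T ≤⟨ ℕ.m≤n*m (suc T) (4 ℕ.* q) ⟩
        l ≤⟨ ℕ.m≤m*n l l ⟩
        l ℕ.* l ≤⟨ ℕ.m≤n*m (l ℕ.* l) r ⟩
        n ∎
        where open ℕ.≤-Reasoning

      instance
        n≢0 : NonZero n
        n≢0 = ℕ.>-nonZero (ℕ.≤-<-trans z≤n m<n)
        W≢0 : NonZero W
        W≢0 = ℕ.m*n≢0 2 (n ℕ.* (2 ℕ.* E)) {{_}} {{ℕ.m*n≢0 n (2 ℕ.* E) {{n≢0}} {{ℕ.m*n≢0 2 E}}}}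
        Q≢0 : NonZero (q ℕ.* W)
        Q≢0 = ℕ.m*n≢0 q W
        P≢0 : NonZero P
        P≢0 = ℕ.m^n≢0 (q ℕ.* W) n

      margins : E ℕ.+ u ℕ.+ E ≡ W
      margins = trans (regroup E u) (ℕ.m∸n+n≡m 2E≤W)
        where
        regroup : ∀ e u → e ℕ.+ u ℕ.+ e ≡ u ℕ.+ 2 ℕ.* e
        regroup = ℕSolver.solve-∀
        2E≤W : 2 ℕ.* E ≤ W
        2E≤W = ℕ.≤-trans (ℕ.m≤n*m (2 ℕ.* E) n) (ℕ.m≤n*m (n ℕ.* (2 ℕ.* E)) 2)

      -- Ensures `2 * (D * P) ≤ w`, hence room both for the small steps and for two full periods of
      -- digits.
      P₀ : ℕ
      P₀ = N ℕ.* (2 ℕ.* (D ℕ.* P))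

      result : ∀ p → P₀ ≤ p → Prime p →
        Σ (Subset p) λ A → SolutionFree c p A × 1 ℕ.* p ≤ N ℕ.* 16 ℕ.* q ℕ.* Subset.∣ A ∣ × ChromaticAtLeast A t
      result p P₀≤p p-prime = Construction.A K D r W n m T p w ,
        Construction.Free.solution-free K D r W n m T p w c refl 0<K 0<w c≢0 D≢0 (prodAbs-cofactor c c≢0) no-zero-sum σ≢0 q-large
          DP≤w Nw≤p ℕ.≤-refl (Cardinality.core-witness K D r W n m T p w 0<core) ,
        subst (_≤ N ℕ.* 16 ℕ.* q ℕ.* Subset.∣ Construction.A K D r W n m T p w ∣) (sym (ℕ.*-identityˡ p))
          (Cardinality.density K D r W n m T p w {N} period room 2P≤w p≤2Nw) ,
        Chromatic.chromatic K D r W n m T p w {{_}} {{prime⇒nonZero p-prime}} D≢0 q-prime m<n (ℕ.≤-trans DP≤w w≤p) t ℕ.≤-refl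
        where
        open ℕ.≤-Reasoning
        w : ℕ
        w = p ℕ./ N
        2DP≤w : 2 ℕ.* (D ℕ.* P) ≤ w
        2DP≤w = ℕ.≤-trans (ℕ.≤-reflexive (trans (sym (ℕ.m*n/n≡m X N)) (cong (ℕ._/ N) (ℕ.*-comm X N)))) (ℕ./-monoˡ-≤ N P₀≤p)
          where
          X = 2 ℕ.* (D ℕ.* P)
        DP≤w : D ℕ.* P ≤ w
        DP≤w = ℕ.≤-trans (ℕ.m≤n*m (D ℕ.* P) 2) 2DP≤w
        2P≤w : 2 ℕ.* P ≤ w
        2P≤w = ℕ.≤-trans (ℕ.*-monoʳ-≤ 2 (ℕ.m≤n*m P D)) 2DP≤w
        0<w : 0 < w
        0<w = ℕ.<-≤-trans (ℕ.>-nonZero⁻¹ (D ℕ.* P) {{ℕ.m*n≢0 D P}}) DP≤w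
        w≤p : w ≤ p
        w≤p = ℕ.m/n≤m p N
        Nw≤p : N ℕ.* w ≤ p
        Nw≤p = ℕ.≤-trans (ℕ.≤-reflexive (ℕ.*-comm N w)) (ℕ.m/n*n≤m p N)
        room : 4 ℕ.* K ℕ.* w ℕ.+ w ≤ p
        room = begin
          4 ℕ.* K ℕ.* w ℕ.+ w ≤⟨ ℕ.+-mono-≤ (ℕ.*-monoˡ-≤ w (ℕ.m≤m*n (4 ℕ.* K) K)) (ℕ.m≤n*m w (4 ℕ.* K ℕ.* K) {{ℕ.m*n≢0 (4 ℕ.* K) K {{ℕ.m*n≢0 4 K}}}}) ⟩
          4 ℕ.* K ℕ.* K ℕ.* w ℕ.+ 4 ℕ.* K ℕ.* K ℕ.* w ≡⟨ lemma K w ⟩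
          N ℕ.* w ≤⟨ Nw≤p ⟩
          p ∎
          where
          lemma : ∀ K w → 4 ℕ.* K ℕ.* K ℕ.* w ℕ.+ 4 ℕ.* K ℕ.* K ℕ.* w ≡ 8 ℕ.* K ℕ.* K ℕ.* w
          lemma = ℕSolver.solve-∀
        p≤2Nw : p ≤ N ℕ.* (2 ℕ.* w)
        p≤2Nw = begin
          p ≡⟨ ℕ.m≡m%n+[m/n]*n p N ⟩
          p ℕ.% N ℕ.+ w ℕ.* N ≤⟨ ℕ.+-monoˡ-≤ (w ℕ.* N) (ℕ.<⇒≤ (ℕ.m%n<n p N)) ⟩
          N ℕ.+ w ℕ.* N ≤⟨ ℕ.+-monoˡ-≤ (w ℕ.* N) (ℕ.m≤n*m N w {{ℕ.>-nonZero 0<w}}) ⟩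
          w ℕ.* N ℕ.+ w ℕ.* N ≡⟨ lemma w N ⟩
          N ℕ.* (2 ℕ.* w) ∎
          where
          lemma : ∀ w N → w ℕ.* N ℕ.+ w ℕ.* N ≡ N ℕ.* (2 ℕ.* w)
          lemma = ℕSolver.solve-∀
        period : P ≤ 4 ℕ.* q ℕ.* Cardinality.core-total K D r W n m T p w
        period = Cardinality.period-bound K D r W n m T p w u margins refl (Words.lead-density r (suc T))
        0<core : 0 < Cardinality.core-total K D r W n m T p w
        0<core = ℕ.n≢0⇒n>0 (λ e → ℕ.<-irrefl refl (ℕ.<-≤-trans (ℕ.>-nonZero⁻¹ P)
          (ℕ.≤-trans period (ℕ.≤-reflexive (trans (cong (ℕ._*_ (4 ℕ.* q)) e) (ℕ.*-zeroʳ (4 ℕ.* q)))))))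

-- The final statement, with `ε` as the fraction `1 / (N * 16 * q)`.

open Parameters
open Integer-Sums using (prime-above)
open Chromatic-Number-And-Size using (prodAbs)
open import Defs
open import Data.Nat using (ℕ; suc; _≤_; _<_; _*_; s≤s; z≤n; >-nonZero⁻¹)
open import Data.Nat.Properties using (m*n≢0)
open import Data.Nat.Primality using (Prime)
open import Data.Integer using (ℤ; +_)
open import Data.Fin using (Fin)
open import Data.Fin.Subset using (Subset; ∣_∣)
open import Data.Product using (Σ; ∃; _×_; _,_)
open import Relation.Nullary using (¬_)
open import Relation.Binary.PropositionalEquality using (_≡_; _≢_)
import Data.Integer as ℤ

theorem5p1 : (k : ℕ) → 3 ≤ k → (c : Fin k → ℤ) → (∀ i → c i ≢ + 0) →
    (¬ (Σ (Subset k) λ I → 3 ≤ ∣ I ∣ × ∑over I c ≡ + 0)) →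
    Σ ℕ λ a → Σ ℕ λ b → 0 < a × 0 < b ×
    ((t : ℕ) → Σ ℕ λ P₀ → (p : ℕ) → P₀ ≤ p → Prime p →
    Σ (Subset p) λ A → SolutionFree c p A × a * p ≤ b * ∣ A ∣ × ChromaticAtLeast A t)
theorem5p1 k 3≤k c c≢0 no-zero-sum = from-prime (prime-above (prodAbs c * ℤ.∣ ∑ c ∣))
  where
  from-prime : (∃ λ q → Prime q × prodAbs c * ℤ.∣ ∑ c ∣ < q) → _
  from-prime (suc r , q-prime , q-large) = 1 , N * 16 * q , s≤s z≤n ,
    >-nonZero⁻¹ (N * 16 * q) {{m*n≢0 (N * 16) q {{m*n≢0 N 16}}}} ,
    λ t → P₀ t , result t
    where open Assembly 3≤k c c≢0 no-zero-sum r q-prime q-large
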